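{- Let $K$ be a field of characteristic $0$, let $n\ge1$, and let $r$ be an integer not equal to any of $0,1,\dots,n-2$ nor to $-\binom{n-1}{2}$. For $1\le j\le n$ let $$u_j^{(r)}=(-1)^{j-1}z_j^{r}\,\Delta(z_1,\dots,\widehat{z_j},\dots,z_n),\qquad \Delta(y_1,\dots,y_k)=\prod_{1\le a<b\le k}(y_a-y_b),$$ where $\widehat{z_j}$ means that $z_j$ is omitted. Then for every series $\Phi(z_1,\dots,z_n)\in K^{\rho}\langle\!\langle z_1,\dots,z_n\rangle\!\rangle$, where $\rho$ sends $z_i$ to the initial term of $u_i^{(r)}$, $$\mathop{\mathrm{CT}}_{z_1,\dots,z_n}\Phi(u_1^{(r)},\dots,u_n^{(r)})=\mathop{\mathrm{CT}}_{u_1^{(r)},\dots,u_n^{(r)}}\Phi(u_1^{(r)},\dots,u_n^{(r)}),$$ where the left-hand constant term is taken in $K\langle\!\langle z_1,\dots,z_n\rangle\!\rangle$ and the right-hand side means the constant term (coefficient of $z_1^0\cdots z_n^0$) of $\Phi(z_1,\dots,z_n)$.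
   Context: $K\langle\!\langle z_1,\dots,z_n\rangle\!\rangle$ is the field of iterated Laurent series $K((z_1))((z_2))\cdots((z_n))$; equivalently, the formal series $\sum_{\mathbf k\in\mathbb{Z}^n}c_{\mathbf k}\mathbf z^{\mathbf k}$ ($c_{\mathbf k}\in K$) whose support $\{\mathbf k:c_{\mathbf k}\ne0\}$ is well-ordered in the reverse lexicographic ordering of $\mathbb{Z}^n$ ($\mathbf k<\mathbf l$ iff for some $i$, $k_i<l_i$ and $k_j=l_j$ for all $j>i$). The initial term of a nonzero series is the term whose exponent is the minimum of its support (e.g. the initial term of $z_i-z_j$ is $z_i$ if $i<j$). If the initial term of $u_i^{(r)}$ is $\pm\mathbf z^{\mathbf b_i}$, $\rho$ also denotes the endomorphism of $\mathbb{Z}^n$ sending the $i$-th standard basis vector to $\mathbf b_i$ (injective under the stated hypothesis on $r$). $K^{\rho}\langle\!\langle z_1,\dots,z_n\rangle\!\rangle$ is the field of formal series $\sum_{\mathbf k}c_{\mathbf k}\mathbf z^{\mathbf k}$ whose support is well-ordered for the ordering $\mathbf k\le^\rho\mathbf l\iff\rho(\mathbf k)\le\rho(\mathbf l)$ (reverse lexicographic ordering on the right). For $\Phi=\sum c_{\mathbf k}\mathbf z^{\mathbf k}$ in this field, $\Phi(u_1^{(r)},\dots,u_n^{(r)})=\sum c_{\mathbf k}\prod_i(u_i^{(r)})^{k_i}$ converges in $K\langle\!\langle z_1,\dots,z_n\rangle\!\rangle$ (each monomial receives only finitely many nonzero contributions). -}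

module Defs where

open import Algebra.Apartness.Bundles using (HeytingField; HeytingCommutativeRing)
open import Algebra.Bundles using (CommutativeRing; Semiring)
open import Algebra.Structures using (IsCommutativeRing)
import Algebra.Definitions.RawMonoid
import Algebra.Definitions.RawSemiring
import Algebra.Properties.CommutativeMonoid.Sum
import Algebra.Properties.Ring
import Algebra.Properties.Semiring.Sum
open import Data.Empty using (⊥-elim)
open import Data.Fin.Base as Fin using (Fin; zero; suc; toℕ; fromℕ; inject₁; opposite)
import Data.Fin.Permutation as Perm
import Data.Fin.Properties as Finₚ
open import Data.Fin.Relation.Unary.Top using (view; ‵fromℕ; ‵inj₁; ‵inject₁)
open import Data.Integer.Base as ℤ using (ℤ; +_; -[1+_])
import Data.Integer.Properties as ℤₚ
open import Data.Integer.Tactic.RingSolver using (solve-∀)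
open import Data.List.Base as List using (List)
open import Data.List.Membership.Propositional using (_∉_)
open import Data.List.Relation.Unary.Unique.Propositional using (Unique)
open import Data.Nat.Base as ℕ using (ℕ; zero; suc)
import Data.Nat.Properties as ℕₚ
open import Data.Product.Base using (Σ; ∃; _×_; _,_; proj₁; proj₂)
open import Data.Sum.Base using (_⊎_; inj₁; inj₂)
open import Data.Vec.Base as Vec using (Vec)
open import Data.Vec.Functional using (Vector; removeAt; head; tail)
open import Function.Base using (_∘_; _on_)
open import Induction.WellFounded using (WellFounded)
open import Level using (Level; _⊔_)
open import Relation.Binary.PropositionalEquality as ≡ using (_≡_)
open import Relation.Nullary using (¬_; yes; no)

private
  variable
    ℓ : Level

private
  transfer : ∀ {x y x′ y′} → y ℤ.- x ≡ y′ ℤ.- x′ → x ℤ.≤ y → x′ ℤ.≤ y′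
  transfer eq x≤y = ℤₚ.0≤i-j⇒j≤i (≡.subst (+ 0 ℤ.≤_) eq (ℤₚ.i≤j⇒0≤j-i x≤y))

  ≤-span : ∀ {x y} → x ℤ.≤ y → ∃ λ p → y ≡ x ℤ.+ + p
  ≤-span {x} {y} x≤y with y ℤ.- x in eq | ℤₚ.i≤j⇒0≤j-i x≤y
  ... | + p | _ = p , ≡.trans (lem x y) (≡.cong (λ z → x ℤ.+ z) eq)
    where
    lem : ∀ x y → y ≡ x ℤ.+ (y ℤ.- x)
    lem = solve-∀

module RingNotation (R : CommutativeRing ℓ ℓ) where

  open CommutativeRing R hiding (zero)
  open Algebra.Definitions.RawSemiring (Semiring.rawSemiring semiring) public
    using (_^_; product)
  open Algebra.Properties.Ring ring using (-‿distribˡ-*; -‿distribʳ-*; -‿involutive)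

  record IsUnit (x : Carrier) : Set ℓ where
    constructor isUnit
    field
      inverse   : Carrier
      x*inverse : x * inverse ≈ 1#

  open IsUnit

  power : ∀ x → IsUnit x → ℤ → Carrier
  power x p (+ n)    = x ^ n
  power x p -[1+ n ] = inverse p ^ suc n

  -- Δ (y₁, …, yₖ) = ∏ (yₐ - y_b) over a < b, by splitting off a = 1
  Δ : ∀ {k} → Vector Carrier k → Carrier
  Δ {zero}  y = 1#
  Δ {suc k} y = product (λ b → head y - tail y b) * Δ (tail y)

  unit-resp : ∀ {x y} → x ≈ y → IsUnit x → IsUnit y
  unit-resp x≈y (isUnit z xz≈1) = isUnit z (trans (*-congʳ (sym x≈y)) xz≈1)

  1-unit : IsUnit 1#
  1-unit = isUnit 1# (*-identityˡ 1#)

  -1-unit : IsUnit (- 1#)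
  -1-unit = isUnit (- 1#) (trans (sym (-‿distribˡ-* 1# (- 1#)))
    (trans (-‿cong (*-identityˡ (- 1#))) (-‿involutive 1#)))

  *-unit : ∀ {x y} → IsUnit x → IsUnit y → IsUnit (x * y)
  *-unit {x} {y} (isUnit x⁻¹ p) (isUnit y⁻¹ q) = isUnit (x⁻¹ * y⁻¹) (begin
    (x * y) * (x⁻¹ * y⁻¹)  ≈⟨ *-congʳ (*-comm x y) ⟩
    (y * x) * (x⁻¹ * y⁻¹)  ≈⟨ *-assoc y x _ ⟩
    y * (x * (x⁻¹ * y⁻¹))  ≈⟨ *-congˡ (*-assoc x x⁻¹ y⁻¹) ⟨
    y * (x * x⁻¹ * y⁻¹)    ≈⟨ *-congˡ (*-congʳ p) ⟩
    y * (1# * y⁻¹)         ≈⟨ *-congˡ (*-identityˡ y⁻¹) ⟩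
    y * y⁻¹                ≈⟨ q ⟩
    1#                     ∎)
    where open import Relation.Binary.Reasoning.Setoid setoid

  ^-unit : ∀ {x} n → IsUnit x → IsUnit (x ^ n)
  ^-unit zero    _ = 1-unit
  ^-unit (suc n) p = *-unit p (^-unit n p)

  power-unit : ∀ {x} (p : IsUnit x) n → IsUnit (power x p n)
  power-unit p (+ n)    = ^-unit n p
  power-unit {x} p -[1+ n ] =
    ^-unit (suc n) (isUnit x (trans (*-comm (inverse p) x) (x*inverse p)))

  product-unit : ∀ {k} {y : Vector Carrier k} → (∀ i → IsUnit (y i)) → IsUnit (product y)
  product-unit {zero}  _ = 1-unit
  product-unit {suc k} p = *-unit (p zero) (product-unit (p ∘ suc))

  Δ-unit : ∀ {k} {y : Vector Carrier k} →
           (∀ {a b} → a Fin.< b → IsUnit (y a - y b)) → IsUnit (Δ y)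
  Δ-unit {zero}  _ = 1-unit
  Δ-unit {suc k} p = *-unit (product-unit (λ b → p {zero} {suc b} (ℕ.s≤s ℕ.z≤n)))
                            (Δ-unit (λ a<b → p (ℕ.s≤s a<b)))

module LaurentSeries (R : CommutativeRing ℓ ℓ) where

  open CommutativeRing R
  open Algebra.Properties.Ring ring using (-0#≈0#; -‿distribˡ-*)
  open Algebra.Properties.CommutativeMonoid.Sum +-commutativeMonoid
    using (sum; sum-cong-≋; sum-replicate-zero; ∑-distrib-+; ∑-comm; sum-permute)
  open Algebra.Properties.Semiring.Sum semiring
    using (*-distribˡ-sum; *-distribʳ-sum)
  import Relation.Binary.Reasoning.Setoid setoid as ≈-Reasoning

  record Laurent : Set ℓ where
    no-eta-equality
    field
      coeff    : ℤ → Carrier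
      low      : ℤ
      vanishes : ∀ {k} → k ℤ.< low → coeff k ≈ 0#

  open Laurent public

  infix 4 _≈ᴸ_
  record _≈ᴸ_ (f g : Laurent) : Set ℓ where
    constructor mk≈
    field
      coeff-≈ : ∀ k → coeff f k ≈ coeff g k

  open _≈ᴸ_ public

  -- window a n h = h a + h (a + 1) + ⋯ + h (a + n - 1)
  window : ℤ → ℕ → (ℤ → Carrier) → Carrier
  window a n h = sum {n} (λ t → h (a ℤ.+ + toℕ t))

  length : ℤ → ℕ
  length (+ n)    = n
  length -[1+ _ ] = 0

  sum-zero : ∀ n {h : Vector Carrier n} → (∀ i → h i ≈ 0#) → sum h ≈ 0#
  sum-zero n z = trans (sum-cong-≋ z) (sum-replicate-zero n)

  extendʳ : ∀ n p (g : ℕ → Carrier) → (∀ t → n ℕ.≤ t → g t ≈ 0#) →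
            sum {n ℕ.+ p} (g ∘ toℕ) ≈ sum {n} (g ∘ toℕ)
  extendʳ zero    p g z = sum-zero p (λ i → z (toℕ i) ℕ.z≤n)
  extendʳ (suc n) p g z =
    +-congˡ (extendʳ n p (g ∘ suc) (λ t n≤t → z (suc t) (ℕ.s≤s n≤t)))

  extendˡ : ∀ p n (g : ℕ → Carrier) → (∀ t → t ℕ.< p → g t ≈ 0#) →
            sum {p ℕ.+ n} (g ∘ toℕ) ≈ sum {n} (λ i → g (p ℕ.+ toℕ i))
  extendˡ zero    n g z = refl
  extendˡ (suc p) n g z = trans
    (+-cong (z 0 (ℕ.s≤s ℕ.z≤n))
            (extendˡ p n (g ∘ suc) (λ t t<p → z (suc t) (ℕ.s≤s t<p))))
    (+-identityˡ _)

  record Within (a : ℤ) (n : ℕ) (h : ℤ → Carrier) : Set ℓ where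
    constructor within
    field
      below : ∀ i → i ℤ.< a → h i ≈ 0#
      above : ∀ i → a ℤ.+ + n ℤ.≤ i → h i ≈ 0#

  open Within

  window-cong : ∀ a n {h h′} → (∀ i → h i ≈ h′ i) → window a n h ≈ window a n h′
  window-cong a n e = sum-cong-≋ {n} (λ t → e _)

  window-extendʳ : ∀ a n p {h} → Within a n h → window a (n ℕ.+ p) h ≈ window a n h
  window-extendʳ a n p {h} w = extendʳ n p (λ t → h (a ℤ.+ + t))
    (λ t n≤t → above w _ (ℤₚ.+-monoʳ-≤ a (ℤ.+≤+ n≤t)))

  within-extend : ∀ a p n {h} → Within (a ℤ.+ + p) n h → Within a (p ℕ.+ n) h
  within-extend a p n w = within
    (λ i i<a → below w i (ℤₚ.<-≤-trans i<a (ℤₚ.i≤i+j a (+ p))))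
    (λ i le → above w i (≡.subst (ℤ._≤ i) (≡.sym (ℤₚ.+-assoc a (+ p) (+ n))) le))

  window-extendˡ : ∀ a p n {h} → Within (a ℤ.+ + p) n h →
                   window a (p ℕ.+ n) h ≈ window (a ℤ.+ + p) n h
  window-extendˡ a p n {h} w = trans
    (extendˡ p n (λ t → h (a ℤ.+ + t))
      (λ t t<p → below w _ (ℤₚ.+-monoʳ-< a (ℤ.+<+ t<p))))
    (sum-cong-≋ {n} (λ t → reflexive
      (≡.cong h (≡.sym (ℤₚ.+-assoc a (+ p) (+ toℕ t))))))

  window-unique≤ : ∀ {a n b m h} → a ℤ.≤ b → Within a n h → Within b m h →
                   window a n h ≈ window b m h
  window-unique≤ {a} {n} {b} {m} {h} a≤b u v with ≤-span a≤b
  ... | p , ≡.refl = begin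
    window a n h                    ≈⟨ window-extendʳ a n (p ℕ.+ m) u ⟨
    window a (n ℕ.+ (p ℕ.+ m)) h    ≡⟨ ≡.cong (λ l → window a l h) (ℕₚ.+-comm n _) ⟩
    window a ((p ℕ.+ m) ℕ.+ n) h    ≈⟨ window-extendʳ a (p ℕ.+ m) n (within-extend a p m v) ⟩
    window a (p ℕ.+ m) h            ≈⟨ window-extendˡ a p m v ⟩
    window (a ℤ.+ + p) m h          ∎
    where open ≈-Reasoning

  window-unique : ∀ {a n b m h} → Within a n h → Within b m h →
                  window a n h ≈ window b m h
  window-unique {a} {n} {b} {m} u v with ℤₚ.≤-total a b
  ... | inj₁ a≤b = window-unique≤ a≤b u v
  ... | inj₂ b≤a = sym (window-unique≤ b≤a v u)

  record IsSum (h : ℤ → Carrier) (s : Carrier) : Set ℓ where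
    constructor isSum
    field
      start  : ℤ
      size   : ℕ
      inside : Within start size h
      total  : window start size h ≈ s

  open IsSum

  sum-window : ∀ {h s a n} → IsSum h s → Within a n h → window a n h ≈ s
  sum-window x w = trans (window-unique w (inside x)) (total x)

  sum-unique : ∀ {h s t} → IsSum h s → IsSum h t → s ≈ t
  sum-unique x y = trans (sym (sum-window x (inside y))) (total y)

  sum-resp : ∀ {h s t} → s ≈ t → IsSum h s → IsSum h t
  sum-resp e (isSum a n w x) = isSum a n w (trans x e)

  sum-cong : ∀ {h h′ s} → (∀ i → h i ≈ h′ i) → IsSum h s → IsSum h′ s
  sum-cong e (isSum a n (within b c) x) = isSum a n
    (within (λ i p → trans (sym (e i)) (b i p)) (λ i p → trans (sym (e i)) (c i p)))
    (trans (sym (window-cong a n e)) x)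

  enlarge : ∀ {a n h c N} → c ℤ.≤ a → a ℤ.+ + n ℤ.≤ c ℤ.+ + N →
            Within a n h → Within c N h
  enlarge c≤a e w = within (λ i l → below w i (ℤₚ.<-≤-trans l c≤a))
                           (λ i l → above w i (ℤₚ.≤-trans e l))

  sum-+ : ∀ {h h′ s s′} → IsSum h s → IsSum h′ s′ →
          IsSum (λ i → h i + h′ i) (s + s′)
  sum-+ {h} {h′} x@(isSum a n w _) y@(isSum b m v _) with ≤-span c≤d
    where
    c≤d : a ℤ.⊓ b ℤ.≤ (a ℤ.+ + n) ℤ.⊔ (b ℤ.+ + m)
    c≤d = ℤₚ.≤-trans (ℤₚ.i⊓j≤i a b) (ℤₚ.≤-trans (ℤₚ.i≤i+j a (+ n)) (ℤₚ.i≤i⊔j _ _))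
  ... | N , eq = isSum (a ℤ.⊓ b) N
    (within (λ i l → trans (+-cong (below w′ i l) (below v′ i l)) (+-identityˡ 0#))
            (λ i l → trans (+-cong (above w′ i l) (above v′ i l)) (+-identityˡ 0#)))
    (trans (∑-distrib-+ {N} _ _) (+-cong (sum-window x w′) (sum-window y v′)))
    where
    w′ : Within (a ℤ.⊓ b) N h
    w′ = enlarge (ℤₚ.i⊓j≤i a b) (≡.subst (a ℤ.+ + n ℤ.≤_) eq (ℤₚ.i≤i⊔j _ _)) w
    v′ : Within (a ℤ.⊓ b) N h′
    v′ = enlarge (ℤₚ.i⊓j≤j a b) (≡.subst (b ℤ.+ + m ℤ.≤_) eq (ℤₚ.i≤j⊔i _ _)) v

  sum-*ˡ : ∀ {h s} c → IsSum h s → IsSum (λ i → c * h i) (c * s)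
  sum-*ˡ c (isSum a n w x) = isSum a n
    (within (λ i l → trans (*-congˡ (below w i l)) (zeroʳ c))
            (λ i l → trans (*-congˡ (above w i l)) (zeroʳ c)))
    (trans (sym (*-distribˡ-sum {n} c _)) (*-congˡ x))

  sum-*ʳ : ∀ {h s} c → IsSum h s → IsSum (λ i → h i * c) (s * c)
  sum-*ʳ c x = sum-resp (*-comm c _) (sum-cong (λ i → *-comm c _) (sum-*ˡ c x))

  sum-shift : ∀ {h s} c → IsSum h s → IsSum (λ i → h (i ℤ.- c)) s
  sum-shift {h} c (isSum a n w x) = isSum (a ℤ.+ c) n
    (within (λ i l → below w _ (ℤₚ.suc[i]≤j⇒i<j (transfer (lem₁ a c i) (ℤₚ.i<j⇒suc[i]≤j l))))
            (λ i l → above w _ (transfer (lem₂ a c i (+ n)) l)))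
    (trans (sum-cong-≋ {n} (λ t → reflexive (≡.cong h (lem₃ a c (+ toℕ t))))) x)
    where
    lem₁ : ∀ a c i → (a ℤ.+ c) ℤ.- (+ 1 ℤ.+ i) ≡ a ℤ.- (+ 1 ℤ.+ (i ℤ.- c))
    lem₁ = solve-∀
    lem₂ : ∀ a c i n → i ℤ.- (a ℤ.+ c ℤ.+ n) ≡ (i ℤ.- c) ℤ.- (a ℤ.+ n)
    lem₂ = solve-∀
    lem₃ : ∀ a c t → a ℤ.+ c ℤ.+ t ℤ.- c ≡ a ℤ.+ t
    lem₃ = solve-∀

  sum-reflect : ∀ {h s} m → IsSum h s → IsSum (λ i → h (m ℤ.- i)) s
  sum-reflect {h} m (isSum a n w x) = isSum b n
    (within (λ i l → above w _ (transfer (lem₁ m a (+ n) i) (ℤₚ.i<j⇒suc[i]≤j l)))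
            (λ i l → below w _ (ℤₚ.suc[i]≤j⇒i<j (transfer (lem₂ m a (+ n) i) l))))
    (trans (sym (trans (sum-permute {n} _ Perm.reverse)
                       (sum-cong-≋ {n} (λ t → reflexive (≡.cong h (lem₃ t)))))) x)
    where
    b = m ℤ.- a ℤ.- + n ℤ.+ + 1
    lem₁ : ∀ m a n i → (m ℤ.- a ℤ.- n ℤ.+ + 1) ℤ.- (+ 1 ℤ.+ i) ≡ (m ℤ.- i) ℤ.- (a ℤ.+ n)
    lem₁ = solve-∀
    lem₂ : ∀ m a n i → i ℤ.- (m ℤ.- a ℤ.- n ℤ.+ + 1 ℤ.+ n) ≡ a ℤ.- (+ 1 ℤ.+ (m ℤ.- i))
    lem₂ = solve-∀
    lem₄ : ∀ m a n t o → n ≡ t ℤ.+ (+ 1 ℤ.+ o) →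
           a ℤ.+ o ≡ m ℤ.- (m ℤ.- a ℤ.- n ℤ.+ + 1 ℤ.+ t)
    lem₄ m a n t o ≡.refl = lem m a t o
      where
      lem : ∀ m a t o → a ℤ.+ o ≡ m ℤ.- (m ℤ.- a ℤ.- (t ℤ.+ (+ 1 ℤ.+ o)) ℤ.+ + 1 ℤ.+ t)
      lem = solve-∀
    lem₅ : ∀ {n} (t : Fin n) → n ≡ toℕ t ℕ.+ suc (toℕ (opposite t))
    lem₅ {n} t = ≡.sym (≡.trans (ℕₚ.+-suc (toℕ t) _)
      (≡.trans (≡.cong (λ o → suc (toℕ t) ℕ.+ o) (Finₚ.opposite-prop t))
               (ℕₚ.m+[n∸m]≡n (Finₚ.toℕ<n t))))
    lem₃ : (t : Fin n) → a ℤ.+ + toℕ (opposite t) ≡ m ℤ.- (b ℤ.+ + toℕ t)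
    lem₃ t = lem₄ m a (+ n) (+ toℕ t) (+ toℕ (opposite t)) (≡.cong +_ (lem₅ t))

  single-sum : ∀ a {h} → (∀ i → ¬ i ≡ a → h i ≈ 0#) → IsSum h (h a)
  single-sum a {h} z = isSum a 1
    (within (λ i i<a → z i (ℤₚ.<⇒≢ i<a))
            (λ i l → z i (λ i≡a → ℤₚ.<⇒≢ (ℤₚ.suc[i]≤j⇒i<j (≡.subst (ℤ._≤ i) (ℤₚ.+-comm a (+ 1)) l)) (≡.sym i≡a))))
    (trans (+-identityʳ _) (reflexive (≡.cong h (ℤₚ.+-identityʳ a))))

  single : ℤ → Carrier → Laurent
  single a x = record
    { coeff    = λ k → [ k ]
    ; low      = a
    ; vanishes = λ {k} k<a → off k (ℤₚ.<⇒≢ k<a)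
    }
    where
    [_] : ℤ → Carrier
    [ k ] with k ℤₚ.≟ a
    ... | yes _ = x
    ... | no  _ = 0#
    off : ∀ k → ¬ k ≡ a → [ k ] ≈ 0#
    off k k≢a with k ℤₚ.≟ a
    ... | yes k≡a = ⊥-elim (k≢a k≡a)
    ... | no  _   = refl

  single-at : ∀ {a x k} → k ≡ a → coeff (single a x) k ≈ x
  single-at {a} {x} {k} k≡a with k ℤₚ.≟ a
  ... | yes _   = refl
  ... | no  k≢a = ⊥-elim (k≢a k≡a)

  single-off : ∀ {a x k} → ¬ k ≡ a → coeff (single a x) k ≈ 0#
  single-off {a} {x} {k} k≢a with k ℤₚ.≟ a
  ... | yes k≡a = ⊥-elim (k≢a k≡a)
  ... | no  _   = refl

  infixl 7 _*ᴸ_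
  infixl 6 _+ᴸ_
  infix  8 -ᴸ_

  0ᴸ 1ᴸ : Laurent
  0ᴸ = record { coeff = λ _ → 0# ; low = + 0 ; vanishes = λ _ → refl }
  1ᴸ = single (+ 0) 1#

  _+ᴸ_ : Laurent → Laurent → Laurent
  f +ᴸ g = record
    { coeff    = λ k → coeff f k + coeff g k
    ; low      = low f ℤ.⊓ low g
    ; vanishes = λ k< → trans
        (+-cong (vanishes f (ℤₚ.<-≤-trans k< (ℤₚ.i⊓j≤i (low f) (low g))))
                (vanishes g (ℤₚ.<-≤-trans k< (ℤₚ.i⊓j≤j (low f) (low g)))))
        (+-identityˡ 0#)
    }

  -ᴸ_ : Laurent → Laurent
  -ᴸ f = record
    { coeff    = λ k → - coeff f k
    ; low      = low f
    ; vanishes = λ k< → trans (-‿cong (vanishes f k<)) -0#≈0#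
    }

  -- the sum of coeff f i * coeff g (k - i) over low f ≤ i ≤ k - low g
  _*ᴸ_ : Laurent → Laurent → Laurent
  f *ᴸ g = record
    { coeff    = λ k → window (low f) (length (k ℤ.- low f ℤ.- low g ℤ.+ + 1))
                              (λ i → coeff f i * coeff g (k ℤ.- i))
    ; low      = low f ℤ.+ low g
    ; vanishes = λ {k} k< → reflexive (empty k k<)
    }
    where
    length≡0 : ∀ x → x ℤ.≤ + 0 → length x ≡ 0
    length≡0 (+ 0)    _ = ≡.refl
    length≡0 (+ suc _) (ℤ.+≤+ ())
    length≡0 -[1+ _ ] _ = ≡.refl
    lem : ∀ k f g → (f ℤ.+ g) ℤ.- (+ 1 ℤ.+ k) ≡ + 0 ℤ.- (k ℤ.- f ℤ.- g ℤ.+ + 1)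
    lem = solve-∀
    empty : ∀ k → k ℤ.< low f ℤ.+ low g →
            window (low f) (length (k ℤ.- low f ℤ.- low g ℤ.+ + 1))
                   (λ i → coeff f i * coeff g (k ℤ.- i)) ≡ 0#
    empty k k< = ≡.cong (λ n → window (low f) n (λ i → coeff f i * coeff g (k ℤ.- i)))
      (length≡0 (k ℤ.- low f ℤ.- low g ℤ.+ + 1) (transfer (lem k (low f) (low g)) (ℤₚ.i<j⇒suc[i]≤j k<)))

  term : Laurent → Laurent → ℤ → ℤ → Carrier
  term f g k i = coeff f i * coeff g (k ℤ.- i)

  ≤length : ∀ x → x ℤ.≤ + length x
  ≤length (+ _)    = ℤₚ.≤-refl
  ≤length -[1+ _ ] = ℤ.-≤+

  *-within : ∀ f g k → Within (low f) (length (k ℤ.- low f ℤ.- low g ℤ.+ + 1)) (term f g k)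
  *-within f g k = within
    (λ i l → trans (*-congʳ (vanishes f l)) (zeroˡ _))
    (λ i l → trans (*-congˡ (vanishes g (ℤₚ.suc[i]≤j⇒i<j
      (transfer (lem k (low f) (low g) i)
        (ℤₚ.≤-trans (ℤₚ.+-monoʳ-≤ (low f) (≤length _)) l))))) (zeroʳ _))
    where
    lem : ∀ k f g i → i ℤ.- (f ℤ.+ (k ℤ.- f ℤ.- g ℤ.+ + 1)) ≡ g ℤ.- (+ 1 ℤ.+ (k ℤ.- i))
    lem = solve-∀

  *-sum : ∀ f g k → IsSum (term f g k) (coeff (f *ᴸ g) k)
  *-sum f g k = isSum _ _ (*-within f g k) refl

  k-[k-i]≡i : ∀ k i → k ℤ.- (k ℤ.- i) ≡ i
  k-[k-i]≡i = solve-∀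

  *ᴸ-comm : ∀ f g → f *ᴸ g ≈ᴸ g *ᴸ f
  *ᴸ-comm f g = mk≈ λ k → sum-unique
    (sum-cong (λ i → *-comm _ _) (*-sum f g k))
    (sum-cong (λ i → *-congˡ (reflexive (≡.cong (coeff f) (k-[k-i]≡i k i))))
              (sum-reflect k (*-sum g f k)))

  *ᴸ-cong : ∀ {f f′ g g′} → f ≈ᴸ f′ → g ≈ᴸ g′ → f *ᴸ g ≈ᴸ f′ *ᴸ g′
  *ᴸ-cong {f} {f′} {g} {g′} e e′ = mk≈ λ k → sum-unique
    (sum-cong (λ i → *-cong (coeff-≈ e i) (coeff-≈ e′ _)) (*-sum f g k))
    (*-sum f′ g′ k)

  *ᴸ-distribˡ : ∀ f g h → f *ᴸ (g +ᴸ h) ≈ᴸ f *ᴸ g +ᴸ f *ᴸ h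
  *ᴸ-distribˡ f g h = mk≈ λ k → sum-unique
    (*-sum f (g +ᴸ h) k)
    (sum-cong (λ i → sym (distribˡ _ _ _)) (sum-+ (*-sum f g k) (*-sum f h k)))

  *ᴸ-assoc : ∀ f g h → (f *ᴸ g) *ᴸ h ≈ᴸ f *ᴸ (g *ᴸ h)
  *ᴸ-assoc f g h = mk≈ λ k → let open ≈-Reasoning in begin
    coeff ((f *ᴸ g) *ᴸ h) k
      ≈⟨ window-cong (low f ℤ.+ low g) (P k)
           (λ p → sym (sum-window (rowˡ k p) (in-I k p))) ⟩
    window (low f ℤ.+ low g) (P k) (λ p → window (low f) (I k) (λ i → T k i p))
      ≈⟨ ∑-comm {P k} {I k} _ ⟩
    window (low f) (I k) (λ i → window (low f ℤ.+ low g) (P k) (λ p → T k i p))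
      ≈⟨ window-cong (low f) (I k)
           {h′ = term f (g *ᴸ h) k}
           (λ i → sum-window (rowʳ k i) (in-P k i)) ⟩
    window (low f) (I k) (term f (g *ᴸ h) k)
      ≡⟨⟩
    coeff (f *ᴸ (g *ᴸ h)) k ∎
    where
    T : ℤ → ℤ → ℤ → Carrier
    T k i p = coeff f i * coeff g (p ℤ.- i) * coeff h (k ℤ.- p)

    I P : ℤ → ℕ
    I k = length (k ℤ.- low f ℤ.- (low g ℤ.+ low h) ℤ.+ + 1)
    P k = length (k ℤ.- (low f ℤ.+ low g) ℤ.- low h ℤ.+ + 1)

    T-f : ∀ k i p → i ℤ.< low f → T k i p ≈ 0#
    T-f k i p l = trans (*-congʳ (trans (*-congʳ (vanishes f l)) (zeroˡ _))) (zeroˡ _)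

    T-g : ∀ k i p → p ℤ.- i ℤ.< low g → T k i p ≈ 0#
    T-g k i p l = trans (*-congʳ (trans (*-congˡ (vanishes g l)) (zeroʳ _))) (zeroˡ _)

    T-h : ∀ k i p → k ℤ.- p ℤ.< low h → T k i p ≈ 0#
    T-h k i p l = trans (*-congˡ (vanishes h l)) (zeroʳ _)

    in-I : ∀ k p → Within (low f) (I k) (λ i → T k i p)
    in-I k p = within (λ i → T-f k i p) above-I
      where
      lem₁ : ∀ k p i f g h → i ℤ.- (f ℤ.+ (k ℤ.- f ℤ.- (g ℤ.+ h) ℤ.+ + 1)) ≡
               (g ℤ.+ h ℤ.- (k ℤ.- p)) ℤ.- (+ 1 ℤ.+ (p ℤ.- i))
      lem₁ = solve-∀
      above-I : ∀ i → low f ℤ.+ + I k ℤ.≤ i → T k i p ≈ 0#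
      above-I i l with (k ℤ.- p) ℤₚ.<? low h
      ... | yes k-p<h = T-h k i p k-p<h
      ... | no  k-p≮h = T-g k i p (ℤₚ.<-≤-trans
        (ℤₚ.suc[i]≤j⇒i<j (transfer (lem₁ k p i (low f) (low g) (low h))
          (ℤₚ.≤-trans (ℤₚ.+-monoʳ-≤ (low f) (≤length _)) l)))
        (transfer (lem₃ (low g) (low h) (k ℤ.- p)) (ℤₚ.≮⇒≥ k-p≮h)))
        where
        lem₃ : ∀ g h x → x ℤ.- h ≡ g ℤ.- (g ℤ.+ h ℤ.- x)
        lem₃ = solve-∀

    in-P : ∀ k i → Within (low f ℤ.+ low g) (P k) (λ p → T k i p)
    in-P k i = within below-P (λ p l → T-h k i p (ℤₚ.suc[i]≤j⇒i<j
      (transfer (lem₁ k (low f) (low g) (low h) p)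
        (ℤₚ.≤-trans (ℤₚ.+-monoʳ-≤ (low f ℤ.+ low g) (≤length _)) l))))
      where
      lem₁ : ∀ k f g h p → p ℤ.- (f ℤ.+ g ℤ.+ (k ℤ.- (f ℤ.+ g) ℤ.- h ℤ.+ + 1)) ≡
               h ℤ.- (+ 1 ℤ.+ (k ℤ.- p))
      lem₁ = solve-∀
      lem₂ : ∀ f g i p → f ℤ.+ g ℤ.- (+ 1 ℤ.+ p) ≡ (f ℤ.+ g ℤ.- i) ℤ.- (+ 1 ℤ.+ (p ℤ.- i))
      lem₂ = solve-∀
      lem₃ : ∀ f g i → i ℤ.- f ≡ g ℤ.- (f ℤ.+ g ℤ.- i)
      lem₃ = solve-∀
      below-P : ∀ p → p ℤ.< low f ℤ.+ low g → T k i p ≈ 0#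
      below-P p l with i ℤₚ.<? low f
      ... | yes i<f = T-f k i p i<f
      ... | no  i≮f = T-g k i p (ℤₚ.<-≤-trans
        (ℤₚ.suc[i]≤j⇒i<j (transfer (lem₂ (low f) (low g) i p) (ℤₚ.i<j⇒suc[i]≤j l)))
        (transfer (lem₃ (low f) (low g) i) (ℤₚ.≮⇒≥ i≮f)))

    rowˡ : ∀ k p → IsSum (λ i → T k i p) (term (f *ᴸ g) h k p)
    rowˡ k p = sum-*ʳ _ (*-sum f g p)

    rowʳ : ∀ k i → IsSum (λ p → T k i p) (term f (g *ᴸ h) k i)
    rowʳ k i = sum-cong
      (λ p → trans (sym (*-assoc _ _ _))
               (*-congˡ (reflexive (≡.cong (coeff h) (lem k i p)))))
      (sum-*ˡ (coeff f i) (sum-shift i (*-sum g h (k ℤ.- i))))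
      where
      lem : ∀ k i p → k ℤ.- i ℤ.- (p ℤ.- i) ≡ k ℤ.- p
      lem = solve-∀

  coeff-single-* : ∀ a x f k → coeff (single a x *ᴸ f) k ≈ x * coeff f (k ℤ.- a)
  coeff-single-* a x f k = trans
    (sum-unique (*-sum (single a x) f k)
      (single-sum a (λ i i≢a → trans (*-congʳ (single-off i≢a)) (zeroˡ _))))
    (*-congʳ (single-at {a} ≡.refl))

  *ᴸ-identityˡ : ∀ f → 1ᴸ *ᴸ f ≈ᴸ f
  *ᴸ-identityˡ f = mk≈ λ k → trans (coeff-single-* (+ 0) 1# f k)
    (trans (*-identityˡ _) (reflexive (≡.cong (coeff f) (ℤₚ.+-identityʳ k))))

  isCommutativeRing-ᴸ : IsCommutativeRing _≈ᴸ_ _+ᴸ_ _*ᴸ_ -ᴸ_ 0ᴸ 1ᴸ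
  isCommutativeRing-ᴸ = record
    { isRing = record
      { +-isAbelianGroup = record
        { isGroup = record
          { isMonoid = record
            { isSemigroup = record
              { isMagma = record
                { isEquivalence = record
                  { refl  = mk≈ λ _ → refl
                  ; sym   = λ e → mk≈ λ k → sym (coeff-≈ e k)
                  ; trans = λ e e′ → mk≈ λ k → trans (coeff-≈ e k) (coeff-≈ e′ k)
                  }
                ; ∙-cong = λ e e′ → mk≈ λ k → +-cong (coeff-≈ e k) (coeff-≈ e′ k)
                }
              ; assoc = λ f g h → mk≈ λ k → +-assoc _ _ _
              }
            ; identity = (λ f → mk≈ λ k → +-identityˡ _) , (λ f → mk≈ λ k → +-identityʳ _)
            }
          ; inverse = (λ f → mk≈ λ k → -‿inverseˡ _) , (λ f → mk≈ λ k → -‿inverseʳ _)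
          ; ⁻¹-cong = λ e → mk≈ λ k → -‿cong (coeff-≈ e k)
          }
        ; comm = λ f g → mk≈ λ k → +-comm _ _
        }
      ; *-cong     = *ᴸ-cong
      ; *-assoc    = *ᴸ-assoc
      ; *-identity = *ᴸ-identityˡ , λ f → transᴸ (*ᴸ-comm f 1ᴸ) (*ᴸ-identityˡ f)
      ; distrib    = *ᴸ-distribˡ , λ f g h → transᴸ (*ᴸ-comm (g +ᴸ h) f)
          (transᴸ (*ᴸ-distribˡ f g h)
            (mk≈ λ k → +-cong (coeff-≈ (*ᴸ-comm f g) k) (coeff-≈ (*ᴸ-comm f h) k)))
      }
    ; *-comm = *ᴸ-comm
    }
    where
    transᴸ : ∀ {f g h} → f ≈ᴸ g → g ≈ᴸ h → f ≈ᴸ h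
    transᴸ e e′ = mk≈ λ k → trans (coeff-≈ e k) (coeff-≈ e′ k)

  laurentRing : CommutativeRing ℓ ℓ
  laurentRing = record { isCommutativeRing = isCommutativeRing-ᴸ }

  C : Carrier → Laurent
  C x = single (+ 0) x

  X : Laurent
  X = single (+ 1) 1#

  coeff-C-* : ∀ x f k → coeff (C x *ᴸ f) k ≈ x * coeff f k
  coeff-C-* x f k = trans (coeff-single-* (+ 0) x f k)
    (*-congˡ (reflexive (≡.cong (coeff f) (ℤₚ.+-identityʳ k))))

  coeff-X-* : ∀ f k → coeff (X *ᴸ f) k ≈ coeff f (k ℤ.- + 1)
  coeff-X-* f k = trans (coeff-single-* (+ 1) 1# f k) (*-identityˡ _)

  C-cong : ∀ {x y} → x ≈ y → C x ≈ᴸ C y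
  C-cong {x} {y} x≈y = mk≈ at
    where
    at : ∀ k → coeff (C x) k ≈ coeff (C y) k
    at k with k ℤₚ.≟ + 0
    ... | yes _ = x≈y
    ... | no  _ = refl

  C-* : ∀ x y → C x *ᴸ C y ≈ᴸ C (x * y)
  C-* x y = mk≈ λ k → trans (coeff-C-* x (C y) k) (at k)
    where
    at : ∀ k → x * coeff (C y) k ≈ coeff (C (x * y)) k
    at k with k ℤₚ.≟ + 0
    ... | yes _ = refl
    ... | no  _ = zeroʳ x

  C-‿- : ∀ x y → C (x - y) ≈ᴸ C x +ᴸ -ᴸ C y
  C-‿- x y = mk≈ at
    where
    at : ∀ k → coeff (C (x - y)) k ≈ coeff (C x) k - coeff (C y) k
    at k with k ℤₚ.≟ + 0
    ... | yes _ = refl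
    ... | no  _ = sym (-‿inverseʳ 0#)

  private
    module U  = RingNotation R
    module Uᴸ = RingNotation laurentRing

  C-unit : ∀ x → U.IsUnit x → Uᴸ.IsUnit (C x)
  C-unit x (U.isUnit y xy≈1) =
    Uᴸ.isUnit (C y) (mk≈ λ k → trans (coeff-≈ (C-* x y) k) (coeff-≈ (C-cong xy≈1) k))

  X-unit : Uᴸ.IsUnit X
  X-unit = Uᴸ.isUnit (single -[1+ 0 ] 1#)
    (mk≈ λ k → trans (coeff-X-* (single -[1+ 0 ] 1#) k) (at k))
    where
    lem : ∀ k → k ≡ k ℤ.- + 1 ℤ.+ + 1
    lem = solve-∀
    at : ∀ k → coeff (single -[1+ 0 ] 1#) (k ℤ.- + 1) ≈ coeff 1ᴸ k
    at k with k ℤₚ.≟ + 0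
    ... | yes ≡.refl = refl
    ... | no  k≢0    = single-off {a = -[1+ 0 ]} {1#} {k ℤ.- + 1}
      (λ k-1≡-1 → k≢0 (≡.trans (lem k) (≡.cong (ℤ._+ + 1) k-1≡-1)))

  -- x - X is inverted by expanding in powers of X: its inverse is
  -- y + y² X + y³ X² + ⋯ where y = x⁻¹
  C-X-unit : ∀ x → U.IsUnit x → Uᴸ.IsUnit (C x +ᴸ -ᴸ X)
  C-X-unit x (U.isUnit y xy≈1) = Uᴸ.isUnit g (mk≈ λ k →
    trans (coeff-≈ (L.distribʳ g (C x) (-ᴸ X)) k)
      (trans (+-cong (coeff-C-* x g k)
                     (trans (sym (coeff-≈ (Lₚ.-‿distribˡ-* X g) k)) (-‿cong (coeff-X-* g k))))
             (at k)))
    where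
    module L = CommutativeRing laurentRing
    module Lₚ = Algebra.Properties.Ring L.ring
    open Algebra.Definitions.RawMonoid *-rawMonoid
      using () renaming (_×_ to _×*_)
    geometric : ℤ → Carrier
    geometric (+ k)    = suc k ×* y
    geometric -[1+ _ ] = 0#
    g : Laurent
    g = record { coeff = geometric ; low = + 0 ; vanishes = λ { {+ _} (ℤ.+<+ ()) ; { -[1+ _ ]} _ → refl } }
    cancel : ∀ w → x * (y * w) ≈ w
    cancel w = trans (sym (*-assoc x y w)) (trans (*-congʳ xy≈1) (*-identityˡ w))
    at : ∀ k → x * geometric k - geometric (k ℤ.- + 1) ≈ coeff 1ᴸ k
    at (+ 0)     = trans (+-cong (cancel 1#) -0#≈0#) (+-identityʳ 1#)
    at (+ suc k) = trans (+-congʳ (cancel _)) (-‿inverseʳ _)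
    at -[1+ k ]  = trans (+-cong (zeroʳ x) -0#≈0#) (+-identityˡ 0#)

infix 4 _<ʳ_ _≤ʳ_

-- reverse lexicographic order
_<ʳ_ _≤ʳ_ : ∀ {n} → Vec ℤ n → Vec ℤ n → Set
k <ʳ l = ∃ λ i → Vec.lookup k i ℤ.< Vec.lookup l i
               × (∀ j → i Fin.< j → Vec.lookup k j ≡ Vec.lookup l j)
k ≤ʳ l = k <ʳ l ⊎ k ≡ l

-- the endomorphism of ℤⁿ sending the i-th basis vector to b i
linear : ∀ {n} → (Fin n → Vec ℤ n) → Vec ℤ n → Vec ℤ n
linear b k = Vec.tabulate (λ j → sum (λ i → Vec.lookup k i ℤ.* Vec.lookup (b i) j))
  where open Algebra.Definitions.RawMonoid ℤ.+-0-rawMonoid using (sum)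

-- With excluded middle a Heyting field is a field in the usual sense: tightness
-- then makes x # y equivalent to ¬ x ≈ y.
module SeriesOver (K : HeytingField ℓ ℓ ℓ) where

  open HeytingField K using (Carrier; _≈_; 0#; 1#; _+_; _*_)

  fieldRing : CommutativeRing ℓ ℓ
  fieldRing = HeytingCommutativeRing.commutativeRing (HeytingField.heytingCommutativeRing K)

  open Algebra.Definitions.RawMonoid (CommutativeRing.+-rawMonoid fieldRing)
    using () renaming (_×_ to _×ᴷ_)

  CharacteristicZero : Set ℓ
  CharacteristicZero = ∀ n → ¬ suc n ×ᴷ 1# ≈ 0#

  Support : ∀ {n} → (Vec ℤ n → Carrier) → Vec ℤ n → Set ℓ
  Support c k = ¬ c k ≈ 0#

  -- IsSum f s: only finitely many values of f are nonzero, and they add up to s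
  IsSum : ∀ {n} → (Vec ℤ n → Carrier) → Carrier → Set ℓ
  IsSum {n} f s = Σ (List (Vec ℤ n)) λ ks →
    Unique ks × (∀ k → k ∉ ks → f k ≈ 0#) × List.foldr _+_ 0# (List.map f ks) ≈ s

  -- the formal series with well-ordered support for the ordering
  -- k ≤ l ⇔ ρ k ≤ʳ ρ l (total when ρ is injective)
  record Series {n} (ρ : Vec ℤ n → Vec ℤ n) : Set ℓ where
    field
      coeff       : Vec ℤ n → Carrier
      wellOrdered : WellFounded {A = ∃ (Support coeff)} (_<ʳ_ on ρ ∘ proj₁)

  constantTerm : ∀ {n} {ρ : Vec ℤ n → Vec ℤ n} → Series ρ → Carrier
  constantTerm Φ = Series.coeff Φ (Vec.replicate _ (+ 0))

  -- K((z₁))((z₂))⋯((zₙ)): the last variable is the outermost one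
  iterated : ℕ → CommutativeRing ℓ ℓ
  iterated zero    = fieldRing
  iterated (suc n) = LaurentSeries.laurentRing (iterated n)

  K⟪z⟫ : ℕ → Set ℓ
  K⟪z⟫ n = CommutativeRing.Carrier (iterated n)

  module Iterated (n : ℕ) where
    open CommutativeRing (iterated n) public using (_*_; _-_; -_; 1#)
    open RingNotation (iterated n) public

  coefficient : ∀ n → K⟪z⟫ n → Vec ℤ n → Carrier
  coefficient zero    f _ = f
  coefficient (suc n) f k =
    coefficient n (LaurentSeries.Laurent.coeff f (Vec.last k)) (Vec.init k)

  CT : ∀ {n} → K⟪z⟫ n → Carrier
  CT {n} f = coefficient n f (Vec.replicate _ (+ 0))

  IsInitialExponent : ∀ {n} → K⟪z⟫ n → Vec ℤ n → Set ℓ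
  IsInitialExponent {n} f b =
    Support (coefficient n f) b × (∀ k → Support (coefficient n f) k → b ≤ʳ k)

  z : ∀ n → Fin n → K⟪z⟫ n
  z (suc n) i with view i
  ... | ‵fromℕ     = LaurentSeries.X (iterated n)
  ... | ‵inject₁ j = LaurentSeries.C (iterated n) (z n j)

  -- Inverses in a commutative ring are unique, so the powers below with negative
  -- exponents do not depend on the choice of these proofs.
  z-unit : ∀ n i → Iterated.IsUnit n (z n i)
  z-unit (suc n) i with view i
  ... | ‵fromℕ     = LaurentSeries.X-unit (iterated n)
  ... | ‵inject₁ j = LaurentSeries.C-unit (iterated n) (z n j) (z-unit n j)

  z-z-unit : ∀ n {i j} → i Fin.< j →
             let open Iterated n in IsUnit (z n i - z n j)
  z-z-unit (suc n) {i} {j} i<j with view i | view j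
  ... | ‵fromℕ | ‵fromℕ = ⊥-elim (ℕₚ.<-irrefl ≡.refl i<j)
  ... | ‵fromℕ | ‵inject₁ j′ = ⊥-elim (ℕₚ.<-asym i<j
    (≡.subst₂ ℕ._<_ (≡.sym (Finₚ.toℕ-inject₁ j′)) (≡.sym (Finₚ.toℕ-fromℕ n)) (Finₚ.toℕ<n j′)))
  ... | ‵inject₁ i′ | ‵fromℕ =
    LaurentSeries.C-X-unit (iterated n) (z n i′) (z-unit n i′)
  ... | ‵inject₁ i′ | ‵inject₁ j′ = Iterated.unit-resp (suc n)
    (LaurentSeries.C-‿- (iterated n) (z n i′) (z n j′))
    (LaurentSeries.C-unit (iterated n) _ (z-z-unit n
      (≡.subst₂ ℕ._<_ (Finₚ.toℕ-inject₁ i′) (Finₚ.toℕ-inject₁ j′) i<j)))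

  module _ {m : ℕ} (r : ℤ) where

    private
      n = suc m

    open Iterated (suc m) using (IsUnit; power; product; Δ; _^_; *-unit; ^-unit;
      -1-unit; power-unit; Δ-unit) renaming (_*_ to _*ᶻ_; -_ to -ᶻ_; 1# to 1ᶻ)

    -- indices are counted from 0, so the sign (-1)^(j-1) becomes (-1)^j
    u : Fin n → K⟪z⟫ n
    u j = (-ᶻ 1ᶻ) ^ toℕ j *ᶻ power (z n j) (z-unit n j) r *ᶻ Δ (removeAt (z n) j)

    u-unit : ∀ j → IsUnit (u j)
    u-unit j = *-unit
      (*-unit (^-unit (toℕ j) -1-unit) (power-unit (z-unit n j) r))
      (Δ-unit {y = removeAt (z n) j} (λ {a} {b} a<b → z-z-unit n (punchIn-< a b a<b)))
      where
      punchIn-< : ∀ a b → a Fin.< b → Fin.punchIn j a Fin.< Fin.punchIn j b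
      punchIn-< a b a<b = ℕₚ.≰⇒> (λ le → ℕₚ.<⇒≱ a<b (Finₚ.punchIn-cancel-≤ j b a le))

    u^ : Vec ℤ n → K⟪z⟫ n
    u^ k = product (λ i → power (u i) (u-unit i) (Vec.lookup k i))

    -- Ψ = Φ(u₁, …, uₙ) = ∑ₖ cₖ u^k, computed monomial by monomial: for every l only
    -- finitely many k contribute to the coefficient of z^l
    IsSubstitution : {ρ : Vec ℤ n → Vec ℤ n} → Series ρ → K⟪z⟫ n → Set ℓ
    IsSubstitution Φ Ψ = ∀ l →
      IsSum (λ k → Series.coeff Φ k * coefficient n (u^ k) l) (coefficient n Ψ l)

{-# OPTIONS --safe #-}

-- Write R for the field of iterated Laurent series, θ_j = z_j ∂/∂z_j for the commuting Euler
-- derivations of R, whose values have constant term 0, and M for the matrix of the logarithmic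
-- derivatives M_ij = θ_j(u_i) / u_i.
--
-- Put Z_ip = z_i^p.  The derivation V_p = ∑_j z_j^p θ_j maps z_j to z_j^(p+1), hence multiplies
-- z_a - z_b by the complete symmetric polynomial h_p(z_a, z_b), and so
--   (M Z)_ip = V_p(u_i) / u_i = r z_i^p + ∑_{a<b; a,b≠i} h_p(z_a, z_b)
-- is a polynomial of degree p in z_i whose coefficients do not depend on i.  Thus M Z = Z T with
-- T upper triangular, and T has the constant diagonal entries r + C(n-1,2), r - (n-2), …, r - 1, r,
-- which the hypothesis on r makes nonzero.  So M has an inverse W.  As det M = det T is constant
-- and θ_b(M_ij) = θ_j(M_ib), the columns of W are divergence free: ∑_j θ_j(W_jl) = 0.  Therefore
--   ∑_j θ_j(W_jl u^k) = k_l u^k,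
-- and the constant term of u^k vanishes unless k = 0.
--
-- If ρ(k) = 0 then the constant term of u^k is its initial coefficient, which is not 0, so k = 0:
-- the injectivity of ρ comes for free.  The exponents of u^k lie in ρ(k) + C, where C consists of
-- the vectors all of whose tail sums c_i + ⋯ + c_n are nonnegative.  A well-ordered subset of ℤⁿ
-- meets l - C in a finite set, by induction on n, which gives the convergence of Φ(u_1, …, u_n);
-- its constant term is then computed term by term.

module Submission where

open import Defs
open import Algebra.Apartness.Bundles using (HeytingField)
open import Algebra.Bundles using (CommutativeRing)
import Algebra.Definitions.RawMonoid
import Algebra.Properties.CommutativeMonoid.Sum
import Algebra.Properties.Ring
import Algebra.Properties.Semiring.Mult
import Algebra.Properties.Semiring.Sum
import Algebra.Solver.Ring
open import Algebra.Solver.Ring.AlmostCommutativeRing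
  using (fromCommutativeRing; _-Raw-AlmostCommutative⟶_)
open import Axiom.ExcludedMiddle using (ExcludedMiddle)
open import Data.Empty using (⊥-elim)
open import Data.Empty.Polymorphic using (⊥)
open import Data.Fin.Base as Fin using (Fin; zero; suc; toℕ; fromℕ; inject₁)
import Data.Fin.Properties as Finₚ
open import Data.Fin.Relation.Unary.Top using (view; ‵fromℕ; ‵inject₁)
open import Data.Integer.Base as ℤ using (ℤ; +_; -[1+_])
import Data.Integer.Properties as ℤₚ
open import Data.Integer.Tactic.RingSolver using (solve-∀)
open import Data.List.Base as List using (List)
open import Data.List.Membership.Propositional using (_∈_; _∉_)
open import Data.List.Membership.Propositional.Properties using (∈-++⁺ˡ; ∈-++⁺ʳ; ∈-deduplicate⁺)
import Data.List.Relation.Unary.All as All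
open import Data.List.Relation.Unary.AllPairs using ([]; _∷_)
open import Data.List.Relation.Unary.Any using (here; there)
open import Data.List.Relation.Unary.Unique.Propositional using (Unique)
import Data.List.Relation.Unary.Unique.DecPropositional.Properties as UniqueDec
open import Data.Maybe.Base using (just; nothing)
open import Data.Nat.Base as ℕ using (ℕ; zero; suc; z≤n; s≤s)
open import Data.Nat.Combinatorics
  using (nC1≡n; nCk+nC[k+1]≡[n+1]C[k+1]) renaming (_C_ to _choose_)
import Data.Nat.Properties as ℕₚ
open import Data.Product.Base using (Σ; ∃; _×_; _,_; proj₁; proj₂)
open import Data.Sum.Base using (_⊎_; inj₁; inj₂)
open import Data.Unit.Polymorphic using (⊤; tt)
open import Data.Vec.Base as Vec using (Vec)
open import Data.Vec.Functional using (removeAt)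
import Data.Vec.Properties as Vecₚ
open import Function.Base using (_∘_; _on_; flip)
open import Induction.WellFounded using (WellFounded; Acc; acc; module Subrelation)
open import Relation.Binary.Definitions using (DecidableEquality)
open import Relation.Binary.PropositionalEquality as ≡ using (_≡_; _≢_; _≗_)
import Relation.Binary.Construct.On as On
open import Relation.Nullary using (¬_; yes; no)
open import Relation.Nullary.Decidable using (decidable-stable)

-- The integers inside a commutative ring, and a ring solver.

module IntegerMultiples {ℓ} (R : CommutativeRing ℓ ℓ) where

  open CommutativeRing R
  open Algebra.Properties.Ring ring
    using (-0#≈0#; -‿+-comm; -‿involutive; -‿distribˡ-*)
  open Algebra.Properties.Semiring.Mult semiring using (×-homo-+) renaming (_×_ to _×ᴿ_)
  open import Relation.Binary.Reasoning.Setoid setoid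

  -- The canonical ring homomorphism from the integers; it carries the exponents of monomials and
  -- the diagonal entries of the triangular matrix `T` into the ring.
  ι : ℤ → Carrier
  ι (+ n)    = n ×ᴿ 1#
  ι -[1+ n ] = - (suc n ×ᴿ 1#)

  ι-⊖ : ∀ m n → ι (m ℤ.⊖ n) ≈ m ×ᴿ 1# - n ×ᴿ 1#
  ι-⊖ m       zero    = sym (trans (+-congˡ -0#≈0#) (+-identityʳ _))
  ι-⊖ zero    (suc n) = sym (+-identityˡ _)
  ι-⊖ (suc m) (suc n) = begin
    ι (suc m ℤ.⊖ suc n)                     ≡⟨ ≡.cong ι (ℤₚ.[1+m]⊖[1+n]≡m⊖n m n) ⟩
    ι (m ℤ.⊖ n)                             ≈⟨ ι-⊖ m n ⟩
    m ×ᴿ 1# - n ×ᴿ 1#                         ≈⟨ +-congʳ (+-identityˡ _) ⟨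
    0# + m ×ᴿ 1# - n ×ᴿ 1#                    ≈⟨ +-congʳ (+-congʳ (-‿inverseʳ 1#)) ⟨
    1# - 1# + m ×ᴿ 1# - n ×ᴿ 1#               ≈⟨ +-congʳ (+-assoc _ _ _) ⟩
    1# + (- 1# + m ×ᴿ 1#) - n ×ᴿ 1#           ≈⟨ +-congʳ (+-congˡ (+-comm _ _)) ⟩
    1# + (m ×ᴿ 1# - 1#) - n ×ᴿ 1#             ≈⟨ +-congʳ (+-assoc _ _ _) ⟨
    1# + m ×ᴿ 1# - 1# - n ×ᴿ 1#               ≈⟨ +-assoc _ _ _ ⟩
    1# + m ×ᴿ 1# + (- 1# - n ×ᴿ 1#)           ≈⟨ +-congˡ (-‿+-comm _ _) ⟩
    1# + m ×ᴿ 1# - (1# + n ×ᴿ 1#)             ∎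

  ι-+ : ∀ i j → ι (i ℤ.+ j) ≈ ι i + ι j
  ι-+ (+ m)    (+ n)    = ×-homo-+ 1# m n
  ι-+ (+ m)    -[1+ n ] = ι-⊖ m (suc n)
  ι-+ -[1+ m ] (+ n)    = trans (ι-⊖ n (suc m)) (+-comm _ _)
  ι-+ -[1+ m ] -[1+ n ] = begin
    - (suc (suc (m ℕ.+ n)) ×ᴿ 1#)       ≡⟨ ≡.cong (λ k → - (suc k ×ᴿ 1#)) (≡.sym (ℕₚ.+-suc m n)) ⟩
    - ((suc m ℕ.+ suc n) ×ᴿ 1#)         ≈⟨ -‿cong (×-homo-+ 1# (suc m) (suc n)) ⟩
    - (suc m ×ᴿ 1# + suc n ×ᴿ 1#)        ≈⟨ -‿+-comm _ _ ⟨
    - (suc m ×ᴿ 1#) - suc n ×ᴿ 1#        ∎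

  ι-neg : ∀ i → ι (ℤ.- i) ≈ - ι i
  ι-neg (+ zero)  = sym -0#≈0#
  ι-neg (+ suc n) = refl
  ι-neg -[1+ n ]  = sym (-‿involutive _)

  ι-1 : ι (+ 1) ≈ 1#
  ι-1 = +-identityʳ 1#

  ι-* : ∀ i j → ι (i ℤ.* j) ≈ ι i * ι j
  ι-* (+ n)    j = positive n
    where
    positive : ∀ n → ι (+ n ℤ.* j) ≈ ι (+ n) * ι j
    positive zero    = trans (reflexive (≡.cong ι (ℤₚ.*-zeroˡ j))) (sym (zeroˡ _))
    positive (suc n) = begin
      ι (+ suc n ℤ.* j)           ≡⟨ ≡.cong ι (ℤₚ.suc-* (+ n) j) ⟩
      ι (j ℤ.+ + n ℤ.* j)         ≈⟨ ι-+ j (+ n ℤ.* j) ⟩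
      ι j + ι (+ n ℤ.* j)         ≈⟨ +-cong (sym (*-identityˡ _)) (positive n) ⟩
      1# * ι j + ι (+ n) * ι j    ≈⟨ distribʳ _ _ _ ⟨
      ι (+ suc n) * ι j           ∎
  ι-* -[1+ n ] j = begin
    ι (-[1+ n ] ℤ.* j)            ≡⟨ ≡.cong ι (ℤₚ.neg-distribˡ-* (+ suc n) j) ⟨
    ι (ℤ.- (+ suc n ℤ.* j))       ≈⟨ ι-neg (+ suc n ℤ.* j) ⟩
    - ι (+ suc n ℤ.* j)           ≈⟨ -‿cong (ι-* (+ suc n) j) ⟩
    - (ι (+ suc n) * ι j)         ≈⟨ -‿distribˡ-* _ _ ⟩
    ι -[1+ n ] * ι j              ∎

  private
    ι-morphism : ℤ.+-*-rawRing -Raw-AlmostCommutative⟶ fromCommutativeRing R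
    ι-morphism = record
      { ⟦_⟧ = ι ; +-homo = ι-+ ; *-homo = ι-* ; -‿homo = ι-neg ; 0-homo = refl ; 1-homo = ι-1 }

    ι-≟ : ∀ i j → _
    ι-≟ i j with i ℤₚ.≟ j
    ... | yes i≡j = just (reflexive (≡.cong ι i≡j))
    ... | no  _   = nothing

  -- The carrier has no decidable equality, so the solver takes its coefficients from the integers,
  -- where cancellations can be recognised.
  module Solver = Algebra.Solver.Ring ℤ.+-*-rawRing (fromCommutativeRing R) ι-morphism ι-≟

-- Matrices: triangular inverses and the Vandermonde matrix.

module Matrices {ℓ} (R : CommutativeRing ℓ ℓ) where

  open CommutativeRing R hiding (zero)
  open RingNotation R
  open Algebra.Properties.Ring ring using (-1*x≈-x)
  open Algebra.Properties.Semiring.Sum semiring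
    using (sum; sum-cong-≋; sum-replicate-zero; ∑-comm; ∑-distrib-+; *-distribˡ-sum; *-distribʳ-sum)
  open IntegerMultiples R using (module Solver)
  open Solver using (solve; _:+_; _:*_; :-_; _:-_; _:=_; con)
  open import Relation.Binary.Reasoning.Setoid setoid

  sum-zero : ∀ {n} {f : Fin n → Carrier} → (∀ i → f i ≈ 0#) → sum f ≈ 0#
  sum-zero {n} f≈0 = trans (sum-cong-≋ f≈0) (sum-replicate-zero n)

  δ : ∀ {n} → Fin n → Fin n → Carrier
  δ zero    zero    = 1#
  δ zero    (suc j) = 0#
  δ (suc i) zero    = 0#
  δ (suc i) (suc j) = δ i j

  δ-comm : ∀ {n} (i j : Fin n) → δ i j ≈ δ j i
  δ-comm zero    zero    = refl
  δ-comm zero    (suc j) = refl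
  δ-comm (suc i) zero    = refl
  δ-comm (suc i) (suc j) = δ-comm i j

  δ-diagonal : ∀ {n} (i : Fin n) → δ i i ≈ 1#
  δ-diagonal zero    = refl
  δ-diagonal (suc i) = δ-diagonal i

  δ-off : ∀ {n} (i j : Fin n) → i ≢ j → δ i j ≈ 0#
  δ-off zero    zero    i≢j = ⊥-elim (i≢j ≡.refl)
  δ-off zero    (suc j) i≢j = refl
  δ-off (suc i) zero    i≢j = refl
  δ-off (suc i) (suc j) i≢j = δ-off i j (i≢j ∘ ≡.cong suc)

  δ-sumˡ : ∀ {n} (i : Fin n) (f : Fin n → Carrier) → sum (λ k → δ i k * f k) ≈ f i
  δ-sumˡ zero    f =
    trans (+-cong (*-identityˡ _) (sum-zero (λ k → zeroˡ (f (suc k))))) (+-identityʳ _)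
  δ-sumˡ (suc i) f = trans (+-cong (zeroˡ _) (δ-sumˡ i (f ∘ suc))) (+-identityˡ _)

  δ-sumʳ : ∀ {n} (j : Fin n) (f : Fin n → Carrier) → sum (λ k → f k * δ k j) ≈ f j
  δ-sumʳ j f = trans
    (sum-cong-≋ (λ k → trans (*-comm _ _) (*-congʳ (δ-comm k j)))) (δ-sumˡ j f)

  Matrix : ℕ → Set ℓ
  Matrix n = Fin n → Fin n → Carrier

  infixl 7 _⊗_
  infix  4 _≋_

  _⊗_ : ∀ {n} → Matrix n → Matrix n → Matrix n
  (A ⊗ B) i j = sum (λ k → A i k * B k j)

  record _≋_ {n} (A B : Matrix n) : Set ℓ where
    constructor entries
    field
      entry : ∀ i j → A i j ≈ B i j

  open _≋_ public

  ≋-sym : ∀ {n} {A B : Matrix n} → A ≋ B → B ≋ A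
  ≋-sym e = entries λ i j → sym (entry e i j)

  ≋-trans : ∀ {n} {A B C : Matrix n} → A ≋ B → B ≋ C → A ≋ C
  ≋-trans e e′ = entries λ i j → trans (entry e i j) (entry e′ i j)

  ⊗-cong : ∀ {n} {A A′ B B′ : Matrix n} → A ≋ A′ → B ≋ B′ → A ⊗ B ≋ A′ ⊗ B′
  ⊗-cong e e′ = entries λ i j → sum-cong-≋ (λ k → *-cong (entry e i k) (entry e′ k j))

  ≋-refl : ∀ {n} {A : Matrix n} → A ≋ A
  ≋-refl = entries λ i j → refl

  ⊗-assoc : ∀ {n} (A B C : Matrix n) → (A ⊗ B) ⊗ C ≋ A ⊗ (B ⊗ C)
  ⊗-assoc A B C = entries λ i j → begin
    sum (λ k → sum (λ l → A i l * B l k) * C k j)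
      ≈⟨ sum-cong-≋ (λ k → *-distribʳ-sum (C k j) (λ l → A i l * B l k)) ⟩
    sum (λ k → sum (λ l → A i l * B l k * C k j))
      ≈⟨ ∑-comm (λ k l → A i l * B l k * C k j) ⟩
    sum (λ l → sum (λ k → A i l * B l k * C k j))
      ≈⟨ sum-cong-≋ (λ l → trans (sum-cong-≋ (λ k → *-assoc (A i l) (B l k) (C k j)))
                                 (sym (*-distribˡ-sum (A i l) (λ k → B l k * C k j)))) ⟩
    sum (λ l → A i l * sum (λ k → B l k * C k j)) ∎

  ⊗-identityˡ : ∀ {n} (A : Matrix n) → δ ⊗ A ≋ A
  ⊗-identityˡ A = entries λ i j → δ-sumˡ i (λ k → A k j)

  ⊗-identityʳ : ∀ {n} (A : Matrix n) → A ⊗ δ ≋ A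
  ⊗-identityʳ A = entries λ i j → δ-sumʳ j (A i)

  trace : ∀ {n} → Matrix n → Carrier
  trace A = sum (λ i → A i i)

  trace-cong : ∀ {n} {A B : Matrix n} → A ≋ B → trace A ≈ trace B
  trace-cong e = sum-cong-≋ (λ i → entry e i i)

  trace-comm : ∀ {n} (A B : Matrix n) → trace (A ⊗ B) ≈ trace (B ⊗ A)
  trace-comm A B = trans (∑-comm (λ i k → A i k * B k i))
    (sum-cong-≋ (λ k → sum-cong-≋ (λ i → *-comm (A i k) (B k i))))

  record Inverse {n} (A : Matrix n) : Set ℓ where
    field
      inv      : Matrix n
      inverseˡ : inv ⊗ A ≋ δ
      inverseʳ : A ⊗ inv ≋ δ

  open Inverse public

  ⊗-inverse : ∀ {n} {A B : Matrix n} → Inverse A → Inverse B → Inverse (A ⊗ B)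
  ⊗-inverse {A = A} {B} p q = record
    { inv      = inv q ⊗ inv p
    ; inverseˡ = cancel (inv q) (inv p) A B (inverseˡ p) (inverseˡ q)
    ; inverseʳ = cancel A B (inv q) (inv p) (inverseʳ q) (inverseʳ p)
    }
    where
    cancel : ∀ {n} (C D E F : Matrix n) → D ⊗ E ≋ δ → C ⊗ F ≋ δ → (C ⊗ D) ⊗ (E ⊗ F) ≋ δ
    cancel C D E F de cf = ≋-trans (⊗-assoc C D (E ⊗ F)) (≋-trans
      (⊗-cong ≋-refl (≋-trans (≋-sym (⊗-assoc D E F))
        (≋-trans (⊗-cong de ≋-refl) (⊗-identityˡ F)))) cf)

  inverse-sym : ∀ {n} {A : Matrix n} (p : Inverse A) → Inverse (inv p)
  inverse-sym {A = A} p = record { inv = A ; inverseˡ = inverseʳ p ; inverseʳ = inverseˡ p }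

  inverse-resp : ∀ {n} {A B : Matrix n} → A ≋ B → Inverse A → Inverse B
  inverse-resp e p = record
    { inv      = inv p
    ; inverseˡ = ≋-trans (⊗-cong ≋-refl (≋-sym e)) (inverseˡ p)
    ; inverseʳ = ≋-trans (⊗-cong (≋-sym e) ≋-refl) (inverseʳ p)
    }

  flip-⊗ : ∀ {n} (A B : Matrix n) → flip A ⊗ flip B ≋ flip (B ⊗ A)
  flip-⊗ A B = entries λ i j → sum-cong-≋ (λ k → *-comm (A k i) (B j k))

  flip-inverse : ∀ {n} {A : Matrix n} → Inverse A → Inverse (flip A)
  flip-inverse {A = A} p = record
    { inv      = flip (inv p)
    ; inverseˡ = ≋-trans (flip-⊗ (inv p) A) (flip-δ (inverseʳ p))
    ; inverseʳ = ≋-trans (flip-⊗ A (inv p)) (flip-δ (inverseˡ p))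
    }
    where
    flip-δ : ∀ {n} {B : Matrix n} → B ≋ δ → flip B ≋ δ
    flip-δ e = entries λ i j → trans (entry e j i) (δ-comm j i)

  Upper : ∀ {n} → Matrix n → Set ℓ
  Upper A = ∀ i j → j Fin.< i → A i j ≈ 0#

  -- The shape of the inverse is recorded because `logDet-upper` needs both factors of
  -- `inv p ⊗ DM A` to be triangular.
  record UpperInverse {n} (A : Matrix n) : Set ℓ where
    field
      inverse : Inverse A
      upper   : Upper (inv inverse)

  open UpperInverse public

  -- Block recursion: if the first row is (a, r) and the lower right block `A′` has inverse `S′`,
  -- the inverse has first row (a⁻¹, - a⁻¹ r S′) and lower right block `S′`.
  upper-inverse : ∀ {n} (A : Matrix n) → Upper A → (∀ i → IsUnit (A i i)) → UpperInverse A
  upper-inverse {zero} A _ _ = record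
    { inverse = record { inv = A ; inverseˡ = entries λ () ; inverseʳ = entries λ () }
    ; upper   = λ ()
    }
  upper-inverse {suc n} A A-upper A-diagonal = record
    { inverse = record { inv = S ; inverseˡ = entries SA ; inverseʳ = entries AS }
    ; upper   = S-upper
    }
    where
    A′ : Matrix n
    A′ i j = A (suc i) (suc j)
    r : Fin n → Carrier
    r j = A zero (suc j)
    a a⁻¹ : Carrier
    a = A zero zero
    a⁻¹ = IsUnit.inverse (A-diagonal zero)
    aa⁻¹≈1 : a * a⁻¹ ≈ 1#
    aa⁻¹≈1 = IsUnit.x*inverse (A-diagonal zero)
    rest : UpperInverse A′
    rest = upper-inverse A′ (λ i j j<i → A-upper (suc i) (suc j) (s≤s j<i)) (A-diagonal ∘ suc)
    S′ : Matrix n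
    S′ = inv (inverse rest)
    rS′ : Fin n → Carrier
    rS′ j = sum (λ k → r k * S′ k j)
    S : Matrix (suc n)
    S zero    zero    = a⁻¹
    S zero    (suc j) = - (a⁻¹ * rS′ j)
    S (suc i) zero    = 0#
    S (suc i) (suc j) = S′ i j
    S-upper : Upper S
    S-upper (suc i) zero    _         = refl
    S-upper (suc i) (suc j) (s≤s j<i) = upper rest i j j<i
    below : ∀ i → A (suc i) zero ≈ 0#
    below i = A-upper (suc i) zero (s≤s z≤n)
    AS : ∀ i j → (A ⊗ S) i j ≈ δ i j
    AS zero    zero    = trans (+-cong aa⁻¹≈1 (sum-zero (λ k → zeroʳ (r k)))) (+-identityʳ 1#)
    AS zero    (suc j) = begin
      a * - (a⁻¹ * rS′ j) + rS′ j   ≈⟨ +-congʳ (solve 3 (λ a b s → a :* :- (b :* s) := :- (a :* b :* s)) refl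
                                                   a a⁻¹ (rS′ j)) ⟩
      - (a * a⁻¹ * rS′ j) + rS′ j   ≈⟨ +-congʳ (-‿cong (trans (*-congʳ aa⁻¹≈1) (*-identityˡ _))) ⟩
      - rS′ j + rS′ j               ≈⟨ -‿inverseˡ _ ⟩
      0#                            ∎
    AS (suc i) zero    = trans
      (+-cong (trans (*-congʳ (below i)) (zeroˡ _)) (sum-zero (λ k → zeroʳ (A′ i k)))) (+-identityʳ 0#)
    AS (suc i) (suc j) = trans
      (+-cong (trans (*-congʳ (below i)) (zeroˡ _)) (entry (inverseʳ (inverse rest)) i j)) (+-identityˡ _)
    SA : ∀ i j → (S ⊗ A) i j ≈ δ i j
    SA zero    zero    = trans
      (+-cong (trans (*-comm _ _) aa⁻¹≈1) (sum-zero (λ k → trans (*-congˡ (below k)) (zeroʳ _)))) (+-identityʳ 1#)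
    SA zero    (suc j) = begin
      a⁻¹ * r j + sum (λ k → - (a⁻¹ * rS′ k) * A′ k j)
        ≈⟨ +-congˡ (sum-cong-≋ (λ k → solve 3 (λ a s t → :- (a :* s) :* t := :- a :* (s :* t)) refl
             a⁻¹ (rS′ k) (A′ k j))) ⟩
      a⁻¹ * r j + sum (λ k → - a⁻¹ * (rS′ k * A′ k j))
        ≈⟨ +-congˡ (*-distribˡ-sum (- a⁻¹) (λ k → rS′ k * A′ k j)) ⟨
      a⁻¹ * r j + - a⁻¹ * sum (λ k → rS′ k * A′ k j)
        ≈⟨ +-congˡ (*-congˡ rS′A′≈r) ⟩
      a⁻¹ * r j + - a⁻¹ * r j
        ≈⟨ solve 2 (λ a r → a :* r :+ :- a :* r := con (+ 0)) refl a⁻¹ (r j) ⟩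
      0# ∎
      where
      rS′A′≈r : sum (λ k → rS′ k * A′ k j) ≈ r j
      -- The row vector `r` is viewed as a matrix all of whose rows are `r`, so that `⊗-assoc`
      -- yields (r S′) A′ = r (S′ A′).
      rS′A′≈r = trans (entry (⊗-assoc (λ _ → r) S′ A′) j j) (trans
        (sum-cong-≋ (λ k → *-congˡ (entry (inverseˡ (inverse rest)) k j))) (δ-sumʳ j r))
    SA (suc i) zero    = trans
      (+-cong (zeroˡ _) (sum-zero (λ k → trans (*-congˡ (below k)) (zeroʳ _)))) (+-identityʳ 0#)
    SA (suc i) (suc j) = trans
      (+-cong (zeroˡ _) (entry (inverseˡ (inverse rest)) i j)) (+-identityˡ _)

  vandermonde : ∀ {n} → (Fin n → Carrier) → Matrix n
  vandermonde y i p = y i ^ toℕ p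

  -- The product of `x - y i` over `i < q`. It vanishes at every node before `y q`, which makes the
  -- matrix of its values triangular.
  newton : ∀ {n} → (Fin n → Carrier) → Fin n → Carrier → Carrier
  newton y zero    x = 1#
  newton y (suc q) x = (x - y zero) * newton (y ∘ suc) q x

  -- the coefficient of newton y q in the expansion of x ^ p
  newtonCoefficient : ∀ {n} → (Fin n → Carrier) → Fin n → ℕ → Carrier
  newtonCoefficient y zero    p       = y zero ^ p
  newtonCoefficient y (suc q) zero    = 0#
  newtonCoefficient y (suc q) (suc p) =
    y zero * newtonCoefficient y (suc q) p + newtonCoefficient (y ∘ suc) q p

  -- Induction on `p` through x^(p+1) = y₀ x^p + (x - y₀) x^p. The first summand is expanded again
  -- at all the nodes, the second at the nodes after y₀, whose Newton polynomials times x - y₀ are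
  -- Newton polynomials for all the nodes.
  newton-expansion : ∀ {n} (y : Fin n → Carrier) p → p ℕ.< n → ∀ x →
                     sum (λ q → newton y q x * newtonCoefficient y q p) ≈ x ^ p
  newton-expansion {suc n} y zero    _ x = trans
    (+-cong (*-identityˡ 1#) (sum-zero (λ q → zeroʳ (newton y (suc q) x)))) (+-identityʳ 1#)
  newton-expansion {suc n} y (suc p) (s≤s p<n) x = begin
    1# * (y₀ * y₀ ^ p) + sum (λ q → (x - y₀) * N q * (y₀ * B q + B′ q))
      ≈⟨ +-congˡ (sum-cong-≋ (λ q → solve 5
           (λ d n y b b′ → d :* n :* (y :* b :+ b′) := y :* (d :* n :* b) :+ d :* (n :* b′))
           refl (x - y₀) (N q) y₀ (B q) (B′ q))) ⟩
    1# * (y₀ * y₀ ^ p) + sum (λ q → y₀ * ((x - y₀) * N q * B q) + (x - y₀) * (N q * B′ q))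
      ≈⟨ +-congˡ (∑-distrib-+ (λ q → y₀ * ((x - y₀) * N q * B q)) (λ q → (x - y₀) * (N q * B′ q))) ⟩
    1# * (y₀ * y₀ ^ p) + (sum (λ q → y₀ * ((x - y₀) * N q * B q)) + sum (λ q → (x - y₀) * (N q * B′ q)))
      ≈⟨ +-congˡ (+-cong (*-distribˡ-sum y₀ (λ q → (x - y₀) * N q * B q))
                         (*-distribˡ-sum (x - y₀) (λ q → N q * B′ q))) ⟨
    1# * (y₀ * y₀ ^ p) + (y₀ * sum (λ q → (x - y₀) * N q * B q) + (x - y₀) * sum (λ q → N q * B′ q))
      ≈⟨ +-cong (*-identityˡ _) (+-congˡ (*-congˡ (newton-expansion (y ∘ suc) p p<n x))) ⟩
    y₀ * y₀ ^ p + (y₀ * sum (λ q → (x - y₀) * N q * B q) + (x - y₀) * x ^ p)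
      ≈⟨ solve 4 (λ y p s t → y :* p :+ (y :* s :+ t) := y :* (p :+ s) :+ t) refl
           y₀ (y₀ ^ p) (sum (λ q → (x - y₀) * N q * B q)) ((x - y₀) * x ^ p) ⟩
    y₀ * (y₀ ^ p + sum (λ q → (x - y₀) * N q * B q)) + (x - y₀) * x ^ p
      ≈⟨ +-congʳ (*-congˡ (+-congʳ (*-identityˡ _))) ⟨
    y₀ * (1# * y₀ ^ p + sum (λ q → (x - y₀) * N q * B q)) + (x - y₀) * x ^ p
      ≈⟨ +-congʳ (*-congˡ (newton-expansion y p (ℕₚ.m<n⇒m<1+n p<n) x)) ⟩
    y₀ * x ^ p + (x - y₀) * x ^ p
      ≈⟨ solve 3 (λ y x p → y :* p :+ (x :- y) :* p := x :* p) refl y₀ x (x ^ p) ⟩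
    x * x ^ p ∎
    where
    y₀ : Carrier
    y₀ = y zero
    N B B′ : Fin n → Carrier
    N q = newton (y ∘ suc) q x
    B q = newtonCoefficient y (suc q) p
    B′ q = newtonCoefficient (y ∘ suc) q p

  newton-root : ∀ {n} (y : Fin n → Carrier) q i → i Fin.< q → newton y q (y i) ≈ 0#
  newton-root y (suc q) zero    _         = trans (*-congʳ (-‿inverseʳ _)) (zeroˡ _)
  newton-root y (suc q) (suc i) (s≤s i<q) = trans (*-congˡ (newton-root (y ∘ suc) q i i<q)) (zeroʳ _)

  newton-unit : ∀ {n} (y : Fin n → Carrier) → (∀ {i j} → i Fin.< j → IsUnit (y i - y j)) →
                ∀ q → IsUnit (newton y q (y q))
  newton-unit y d zero    = 1-unit
  newton-unit y d (suc q) = *-unit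
    -- The hypothesis inverts the earlier node minus the later one; the Newton polynomial contains
    -- the opposite difference.
    (unit-resp (trans (-1*x≈-x _) (solve 2 (λ a b → :- (a :- b) := b :- a) refl (y zero) (y (suc q))))
      (*-unit -1-unit (d (s≤s z≤n))))
    (newton-unit (y ∘ suc) (λ i<j → d (s≤s i<j)) q)

  newtonCoefficient-upper : ∀ {n} (y : Fin n → Carrier) q p → p ℕ.< toℕ q →
                            newtonCoefficient y q p ≈ 0#
  newtonCoefficient-upper y (suc q) zero    _         = refl
  newtonCoefficient-upper y (suc q) (suc p) (s≤s p<q) = trans
    (+-cong (trans (*-congˡ (newtonCoefficient-upper y (suc q) p (ℕₚ.m<n⇒m<1+n p<q))) (zeroʳ _))
            (newtonCoefficient-upper (y ∘ suc) q p p<q))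
    (+-identityʳ 0#)

  newtonCoefficient-diagonal : ∀ {n} (y : Fin n → Carrier) q → newtonCoefficient y q (toℕ q) ≈ 1#
  newtonCoefficient-diagonal y zero    = refl
  newtonCoefficient-diagonal y (suc q) = trans
    (+-cong (trans (*-congˡ (newtonCoefficient-upper y (suc q) (toℕ q) ℕₚ.≤-refl)) (zeroʳ _))
            (newtonCoefficient-diagonal (y ∘ suc) q))
    (+-identityˡ 1#)

  -- The Vandermonde matrix is the product of the lower triangular matrix of the values of
  -- the Newton polynomials and the upper triangular matrix of Newton coefficients.
  vandermonde-inverse : ∀ {n} (y : Fin n → Carrier) →
                        (∀ {i j} → i Fin.< j → IsUnit (y i - y j)) → Inverse (vandermonde y)
  vandermonde-inverse y d = inverse-resp
    (entries λ i p → newton-expansion y (toℕ p) (Finₚ.toℕ<n p) (y i))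
    (⊗-inverse
      (flip-inverse (inverse (upper-inverse (λ q i → newton y q (y i))
        (λ q i i<q → newton-root y q i i<q) (newton-unit y d))))
      (inverse (upper-inverse (λ q p → newtonCoefficient y q (toℕ p))
        (λ q p → newtonCoefficient-upper y q (toℕ p))
        (λ q → unit-resp (sym (newtonCoefficient-diagonal y q)) 1-unit))))

-- Derivations and logarithmic derivatives.

module Derivations {ℓ} (R : CommutativeRing ℓ ℓ) where

  open CommutativeRing R hiding (zero)
  open RingNotation R
  open Algebra.Properties.Ring ring using (-0#≈0#; x+x≈x⇒x≈0; +-inverseˡ-unique)
  open Algebra.Properties.Semiring.Sum semiring
    using (sum; sum-cong-≋; ∑-distrib-+; *-distribˡ-sum; *-distribʳ-sum; sum-remove)
  open IntegerMultiples R using (ι; module Solver)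
  open Solver using (solve; _:+_; _:*_; :-_; _:-_; _:=_)
  open Matrices R
  open import Relation.Binary.Reasoning.Setoid setoid

  record Derivation : Set ℓ where
    field
      D       : Carrier → Carrier
      D-cong  : ∀ {x y} → x ≈ y → D x ≈ D y
      D-+     : ∀ x y → D (x + y) ≈ D x + D y
      leibniz : ∀ x y → D (x * y) ≈ D x * y + x * D y

    D-0 : D 0# ≈ 0#
    D-0 = x+x≈x⇒x≈0 (D 0#) (trans (sym (D-+ 0# 0#)) (D-cong (+-identityʳ 0#)))

    D-1 : D 1# ≈ 0#
    D-1 = x+x≈x⇒x≈0 (D 1#) (begin
      D 1# + D 1#            ≈⟨ +-cong (*-identityʳ _) (*-identityˡ _) ⟨
      D 1# * 1# + 1# * D 1#  ≈⟨ leibniz 1# 1# ⟨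
      D (1# * 1#)            ≈⟨ D-cong (*-identityˡ 1#) ⟩
      D 1#                   ∎)

    D-neg : ∀ x → D (- x) ≈ - D x
    D-neg x = +-inverseˡ-unique (D (- x)) (D x)
      (trans (sym (D-+ (- x) x)) (trans (D-cong (-‿inverseˡ x)) D-0))

    D-ι⁺ : ∀ n → D (ι (+ n)) ≈ 0#
    D-ι⁺ zero    = D-0
    D-ι⁺ (suc n) = trans (D-+ 1# _) (trans (+-cong D-1 (D-ι⁺ n)) (+-identityʳ 0#))

    D-ι : ∀ k → D (ι k) ≈ 0#
    D-ι (+ n)    = D-ι⁺ n
    D-ι -[1+ n ] = trans (D-neg _) (trans (-‿cong (D-ι⁺ (suc n))) -0#≈0#)

    D-sum : ∀ {n} (f : Fin n → Carrier) → D (sum f) ≈ sum (D ∘ f)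
    D-sum {zero}  f = D-0
    D-sum {suc n} f = trans (D-+ _ _) (+-congˡ (D-sum (f ∘ suc)))

    D-δ : ∀ {n} (i j : Fin n) → D (δ i j) ≈ 0#
    D-δ zero    zero    = D-1
    D-δ zero    (suc j) = D-0
    D-δ (suc i) zero    = D-0
    D-δ (suc i) (suc j) = D-δ i j

  open Derivation

  combination : ∀ {n} → (Fin n → Carrier) → (Fin n → Derivation) → Derivation
  combination c θ = record
    { D       = λ x → sum (λ j → c j * D (θ j) x)
    ; D-cong  = λ x≈y → sum-cong-≋ (λ j → *-congˡ (D-cong (θ j) x≈y))
    ; D-+     = λ x y → trans
        (sum-cong-≋ (λ j → trans (*-congˡ (D-+ (θ j) x y)) (distribˡ _ _ _)))
        (∑-distrib-+ (λ j → c j * D (θ j) x) (λ j → c j * D (θ j) y))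
    ; leibniz = λ x y → begin
        sum (λ j → c j * D (θ j) (x * y))
          ≈⟨ sum-cong-≋ (λ j → trans (*-congˡ (leibniz (θ j) x y))
               (solve 5 (λ c a x y b → c :* (a :* y :+ x :* b) := c :* a :* y :+ x :* (c :* b))
                 refl (c j) (D (θ j) x) x y (D (θ j) y))) ⟩
        sum (λ j → c j * D (θ j) x * y + x * (c j * D (θ j) y))
          ≈⟨ ∑-distrib-+ (λ j → c j * D (θ j) x * y) (λ j → x * (c j * D (θ j) y)) ⟩
        sum (λ j → c j * D (θ j) x * y) + sum (λ j → x * (c j * D (θ j) y))
          ≈⟨ +-cong (*-distribʳ-sum y (λ j → c j * D (θ j) x)) (*-distribˡ-sum x (λ j → c j * D (θ j) y)) ⟨
        sum (λ j → c j * D (θ j) x) * y + x * sum (λ j → c j * D (θ j) y) ∎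
    }

  unit-cancel : ∀ {x y v} → IsUnit v → x * v ≈ y * v → x ≈ y
  unit-cancel {x} {y} {v} (isUnit w vw≈1) xv≈yv = begin
    x            ≈⟨ *-identityʳ x ⟨
    x * 1#       ≈⟨ *-congˡ vw≈1 ⟨
    x * (v * w)  ≈⟨ *-assoc x v w ⟨
    x * v * w    ≈⟨ *-congʳ xv≈yv ⟩
    y * v * w    ≈⟨ *-assoc y v w ⟩
    y * (v * w)  ≈⟨ *-congˡ vw≈1 ⟩
    y * 1#       ≈⟨ *-identityʳ y ⟩
    y            ∎

  module Logarithmic (d : Derivation) where

    -- `a` is a logarithmic derivative of `x`, stated without division so that it makes sense before
    -- `x` is known to be invertible.
    Log : Carrier → Carrier → Set ℓ
    Log x a = D d x ≈ a * x

    log-resp : ∀ {x a b} → a ≈ b → Log x a → Log x b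
    log-resp a≈b l = trans l (*-congʳ a≈b)

    log-constant : ∀ {x} → D d x ≈ 0# → Log x 0#
    log-constant Dx≈0 = trans Dx≈0 (sym (zeroˡ _))

    log-* : ∀ {x y a b} → Log x a → Log y b → Log (x * y) (a + b)
    log-* {x} {y} {a} {b} p q = begin
      D d (x * y)            ≈⟨ leibniz d x y ⟩
      D d x * y + x * D d y  ≈⟨ +-cong (*-congʳ p) (*-congˡ q) ⟩
      a * x * y + x * (b * y)
        ≈⟨ solve 4 (λ a b x y → a :* x :* y :+ x :* (b :* y) := (a :+ b) :* (x :* y)) refl a b x y ⟩
      (a + b) * (x * y)      ∎

    log-^ : ∀ {x a} n → Log x a → Log (x ^ n) (ι (+ n) * a)
    log-^ zero    p = log-resp (sym (zeroˡ _)) (log-constant (D-1 d))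
    log-^ {x} {a} (suc n) p =
      log-resp (trans (+-congʳ (sym (*-identityˡ a))) (sym (distribʳ a 1# _))) (log-* p (log-^ n p))

    -- Differentiate `x * y ≈ 1` and cancel the unit `x`.
    log-inverse : ∀ {x y a} → x * y ≈ 1# → Log x a → Log y (- a)
    log-inverse {x} {y} {a} xy≈1 p =
      unit-cancel (isUnit y xy≈1) (+-inverseˡ-unique (D d y * x) (a * y * x) (begin
        D d y * x + a * y * x
          ≈⟨ solve 4 (λ e a x y → e :* x :+ a :* y :* x := a :* x :* y :+ x :* e) refl (D d y) a x y ⟩
        a * x * y + x * D d y   ≈⟨ +-congʳ (*-congʳ p) ⟨
        D d x * y + x * D d y   ≈⟨ leibniz d x y ⟨
        D d (x * y)             ≈⟨ D-cong d xy≈1 ⟩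
        D d 1#                  ≈⟨ D-1 d ⟩
        0#                      ∎)
        ∙ solve 3 (λ a x y → :- (a :* y :* x) := :- a :* y :* x) refl a x y)
      where _∙_ = trans

    log-power : ∀ {x a} (p : IsUnit x) k → Log x a → Log (power x p k) (ι k * a)
    log-power p (+ n)    l = log-^ n l
    log-power {a = a} p -[1+ n ] l = log-resp
      (solve 2 (λ n a → n :* :- a := :- n :* a) refl (ι (+ suc n)) a)
      (log-^ (suc n) (log-inverse (IsUnit.x*inverse p) l))

    log-product : ∀ {n} (x a : Fin n → Carrier) → (∀ i → Log (x i) (a i)) → Log (product x) (sum a)
    log-product {zero}  x a l = log-constant (D-1 d)
    log-product {suc n} x a l = log-* (l zero) (log-product (x ∘ suc) (a ∘ suc) (l ∘ suc))

  -- The recursion runs parallel to that of `Δ`, whose logarithmic derivative it computes.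
  pairSum : ∀ {n} → (Carrier → Carrier → Carrier) → (Fin n → Carrier) → Carrier
  pairSum {zero}  g y = 0#
  pairSum {suc n} g y = sum (λ b → g (y zero) (y (suc b))) + pairSum g (y ∘ suc)

  -- This expresses a sum over the pairs avoiding `i` through the sum over all pairs, which does not
  -- depend on `i`. Symmetry of `g` is what lets the pairs in which `i` comes second be written with
  -- `y i` first.
  pairSum-remove : ∀ {n} g → (∀ x y → g x y ≈ g y x) → (y : Fin (suc n) → Carrier) → ∀ i →
                   pairSum g y ≈ sum (λ b → g (y i) (removeAt y i b)) + pairSum g (removeAt y i)
  pairSum-remove g g-comm y zero = refl
  pairSum-remove {suc n} g g-comm y (suc i) = begin
    sum (λ b → g y₀ (y (suc b))) + pairSum g y′
      ≈⟨ +-cong (sum-remove {i = i} (λ b → g y₀ (y′ b))) (pairSum-remove g g-comm y′ i) ⟩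
    (g y₀ (y′ i) + A) + (B + C)
      ≈⟨ +-congʳ (+-congʳ (g-comm y₀ (y′ i))) ⟩
    (g (y′ i) y₀ + A) + (B + C)
      ≈⟨ solve 4 (λ x a b c → (x :+ a) :+ (b :+ c) := (x :+ b) :+ (a :+ c)) refl (g (y′ i) y₀) A B C ⟩
    (g (y′ i) y₀ + B) + (A + C) ∎
    where
    y₀ : Carrier
    y₀ = y zero
    y′ : Fin (suc n) → Carrier
    y′ = y ∘ suc
    A B C : Carrier
    A = sum (λ b → g y₀ (removeAt y′ i b))
    B = sum (λ b → g (y′ i) (removeAt y′ i b))
    C = pairSum g (removeAt y′ i)

  log-Δ : ∀ d {n} g (y : Fin n → Carrier) → let open Logarithmic d in
          (∀ a b → Log (y a - y b) (g (y a) (y b))) → Log (Δ y) (pairSum g y)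
  log-Δ d {zero}  g y l = Logarithmic.log-constant d (D-1 d)
  log-Δ d {suc n} g y l = Logarithmic.log-* d
    (Logarithmic.log-product d (λ b → y zero - y (suc b)) _ (λ b → l zero (suc b)))
    (log-Δ d g (y ∘ suc) (λ a b → l (suc a) (suc b)))

  -- complete homogeneous symmetric polynomials in two variables
  h : ℕ → Carrier → Carrier → Carrier
  h zero    x y = 1#
  h (suc p) x y = x ^ suc p + y * h p x y

  -- The mirror image of the defining recursion; from the two together symmetry follows by
  -- induction.
  h-step : ∀ p x y → h (suc p) x y ≈ y ^ suc p + x * h p x y
  h-step zero    x y = +-comm _ _
  h-step (suc p) x y = begin
    x * x ^ suc p + y * h (suc p) x y                  ≈⟨ +-congˡ (*-congˡ (h-step p x y)) ⟩
    x * x ^ suc p + y * (y ^ suc p + x * h p x y)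
      ≈⟨ solve 5 (λ x y a b e → x :* a :+ y :* (b :+ x :* e) := y :* b :+ x :* (a :+ y :* e))
           refl x y (x ^ suc p) (y ^ suc p) (h p x y) ⟩
    y * y ^ suc p + x * (x ^ suc p + y * h p x y)      ∎

  h-comm : ∀ p x y → h p x y ≈ h p y x
  h-comm zero    x y = refl
  h-comm (suc p) x y = trans (+-congˡ (*-congˡ (h-comm p x y))) (sym (h-step p y x))

  -- This makes `h p x y` the logarithmic derivative of `x - y` under a derivation that sends `x`
  -- and `y` to their powers with exponent p + 1.
  h-difference : ∀ p x y → x ^ suc p - y ^ suc p ≈ h p x y * (x - y)
  h-difference zero    x y = solve 3 (λ x y e → x :* e :- y :* e := e :* (x :- y)) refl x y 1#
  h-difference (suc p) x y = begin
    x * x ^ suc p - y * y ^ suc p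
      ≈⟨ solve 4 (λ x y a b → x :* a :- y :* b := a :* (x :- y) :+ y :* (a :- b)) refl
           x y (x ^ suc p) (y ^ suc p) ⟩
    x ^ suc p * (x - y) + y * (x ^ suc p - y ^ suc p)
      ≈⟨ +-congˡ (*-congˡ (h-difference p x y)) ⟩
    x ^ suc p * (x - y) + y * (h p x y * (x - y))
      ≈⟨ solve 4 (λ d y a e → a :* d :+ y :* (e :* d) := (a :+ y :* e) :* d) refl (x - y) y (x ^ suc p) (h p x y) ⟩
    (x ^ suc p + y * h p x y) * (x - y) ∎

  h-diagonal : ∀ p x → h p x x ≈ ι (+ suc p) * x ^ p
  h-diagonal zero    x = sym (trans (*-identityʳ _) (+-identityʳ 1#))
  h-diagonal (suc p) x = begin
    x * x ^ p + x * h p x x                   ≈⟨ +-congˡ (*-congˡ (h-diagonal p x)) ⟩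
    x * x ^ p + x * (ι (+ suc p) * x ^ p)     ≈⟨ +-congʳ (*-identityˡ _) ⟨
    1# * (x * x ^ p) + x * (ι (+ suc p) * x ^ p)
      ≈⟨ solve 4 (λ e x a n → e :* (x :* a) :+ x :* (n :* a) := (e :+ n) :* (x :* a)) refl
           1# x (x ^ p) (ι (+ suc p)) ⟩
    (1# + ι (+ suc p)) * (x * x ^ p)          ∎

  -- trace (A⁻¹ · D A), the logarithmic derivative of the determinant
  module LogDeterminant (d : Derivation) where

    DM : ∀ {n} → Matrix n → Matrix n
    DM A i j = D d (A i j)

    DM-cong : ∀ {n} {A B : Matrix n} → A ≋ B → DM A ≋ DM B
    DM-cong e = entries λ i j → D-cong d (entry e i j)

    D-⊗ : ∀ {n} (A B : Matrix n) i j → D d ((A ⊗ B) i j) ≈ (DM A ⊗ B) i j + (A ⊗ DM B) i j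
    D-⊗ A B i j = trans (D-sum d (λ k → A i k * B k j)) (trans
      (sum-cong-≋ (λ k → leibniz d (A i k) (B k j)))
      (∑-distrib-+ (λ k → D d (A i k) * B k j) (λ k → A i k * D d (B k j))))

    logDet : ∀ {n} {A : Matrix n} → Inverse A → Carrier
    logDet {A = A} p = trace (inv p ⊗ DM A)

    logDet-resp : ∀ {n} {A B : Matrix n} (e : A ≋ B) (p : Inverse A) →
                  logDet (inverse-resp e p) ≈ logDet p
    logDet-resp e p = trace-cong (⊗-cong (≋-refl {A = inv p}) (≋-sym (DM-cong e)))

    -- Apply D(A B) = D(A) B + A D(B). In the first summand `B` cancels against its inverse after a
    -- cyclic permutation under the trace; in the second `A` cancels directly.
    logDet-⊗ : ∀ {n} {A B : Matrix n} (p : Inverse A) (q : Inverse B) →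
               logDet (⊗-inverse p q) ≈ logDet p + logDet q
    logDet-⊗ {n} {A} {B} p q = begin
      trace ((inv q ⊗ inv p) ⊗ DM (A ⊗ B))
        ≈⟨ sum-cong-≋ (λ i → trans
             (sum-cong-≋ (λ k → trans (*-congˡ (D-⊗ A B k i)) (distribˡ _ _ _)))
             (∑-distrib-+ (λ k → (inv q ⊗ inv p) i k * (DM A ⊗ B) k i)
                          (λ k → (inv q ⊗ inv p) i k * (A ⊗ DM B) k i))) ⟩
      sum (λ i → ((inv q ⊗ inv p) ⊗ (DM A ⊗ B)) i i + ((inv q ⊗ inv p) ⊗ (A ⊗ DM B)) i i)
        ≈⟨ ∑-distrib-+ (λ i → ((inv q ⊗ inv p) ⊗ (DM A ⊗ B)) i i)
                       (λ i → ((inv q ⊗ inv p) ⊗ (A ⊗ DM B)) i i) ⟩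
      trace ((inv q ⊗ inv p) ⊗ (DM A ⊗ B)) + trace ((inv q ⊗ inv p) ⊗ (A ⊗ DM B))
        ≈⟨ +-cong first (trace-cong second) ⟩
      trace (inv p ⊗ DM A) + trace (inv q ⊗ DM B) ∎
      where
      first : trace ((inv q ⊗ inv p) ⊗ (DM A ⊗ B)) ≈ trace (inv p ⊗ DM A)
      first = trans (trace-cong (⊗-assoc (inv q) (inv p) (DM A ⊗ B))) (trans
        (trace-comm (inv q) (inv p ⊗ (DM A ⊗ B)))
        (trace-cong (≋-trans (⊗-assoc (inv p) (DM A ⊗ B) (inv q))
          (⊗-cong (≋-refl {A = inv p}) (≋-trans (⊗-assoc (DM A) B (inv q)) (≋-trans
            (⊗-cong (≋-refl {A = DM A}) (inverseʳ q)) (⊗-identityʳ (DM A))))))))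
      second : (inv q ⊗ inv p) ⊗ (A ⊗ DM B) ≋ inv q ⊗ DM B
      second = ≋-trans (⊗-assoc (inv q) (inv p) (A ⊗ DM B))
        (⊗-cong (≋-refl {A = inv q}) (≋-trans (≋-sym (⊗-assoc (inv p) A (DM B))) (≋-trans
          (⊗-cong (inverseˡ p) (≋-refl {A = DM B})) (⊗-identityˡ (DM B)))))

    -- The trace of the derivative of A A⁻¹ = 1, up to one exchange of factors under the trace.
    logDet-inverse : ∀ {n} {A : Matrix n} (p : Inverse A) →
                     logDet p + logDet (inverse-sym p) ≈ 0#
    logDet-inverse {A = A} p = begin
      trace (inv p ⊗ DM A) + trace (A ⊗ DM (inv p))   ≈⟨ +-congʳ (trace-comm (inv p) (DM A)) ⟩
      trace (DM A ⊗ inv p) + trace (A ⊗ DM (inv p))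
        ≈⟨ ∑-distrib-+ (λ i → (DM A ⊗ inv p) i i) (λ i → (A ⊗ DM (inv p)) i i) ⟨
      sum (λ i → (DM A ⊗ inv p) i i + (A ⊗ DM (inv p)) i i)
        ≈⟨ sum-zero (λ i → trans (sym (D-⊗ A (inv p) i i))
             (trans (D-cong d (entry (inverseʳ p) i i)) (D-δ d i i))) ⟩
      0# ∎

    -- In the product of `inv (inverse p) i k` and `D d (A k i)` the first factor is 0 for k < i and
    -- the second is 0 for k > i by triangularity; for k = i the second is 0 because the diagonal is
    -- constant.
    logDet-upper : ∀ {n} {A : Matrix n} → Upper A → (∀ i → D d (A i i) ≈ 0#) →
                   (p : UpperInverse A) → logDet (inverse p) ≈ 0#
    logDet-upper {n} {A} A-upper constant p = sum-zero λ i → sum-zero λ k → zero-term i k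
      where
      zero-term : ∀ i k → inv (inverse p) i k * D d (A k i) ≈ 0#
      zero-term i k with k Finₚ.<? i | k Finₚ.≟ i
      ... | yes k<i | _          = trans (*-congʳ (upper p i k k<i)) (zeroˡ _)
      ... | no  _   | yes ≡.refl = trans (*-congˡ (constant i)) (zeroʳ _)
      ... | no  k≮i | no k≢i     = trans
        (*-congˡ (trans (D-cong d (A-upper k i
          (ℕₚ.≤∧≢⇒< (ℕₚ.≮⇒≥ k≮i) (k≢i ∘ ≡.sym ∘ Finₚ.toℕ-injective)))) (D-0 d)))
        (zeroʳ _)

-- The logarithmic Jacobian matrix and the exactness of monomials.

module Exactness {ℓ} (R : CommutativeRing ℓ ℓ) where

  open CommutativeRing R hiding (zero)
  open RingNotation R
  open Derivations R
  open Derivation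
  open Matrices R
  open IntegerMultiples R using (ι; ι-+; ι-neg; ι-1; module Solver)
  open Algebra.Properties.Ring ring using (-0#≈0#; +-inverseˡ-unique)
  open Algebra.Properties.Semiring.Mult semiring using (×-homo-+)
  open Algebra.Properties.Semiring.Sum semiring
    using (sum; sum-cong-≋; sum-replicate; ∑-distrib-+; ∑-comm; *-distribˡ-sum; *-distribʳ-sum; sum-remove)
  open Solver using (solve; _:+_; _:*_; :-_; _:-_; _:=_)
  open import Relation.Binary.Reasoning.Setoid setoid

  -- The data from which exactness is derived over any ring: commuting derivations acting on the
  -- variables as z_j ∂/∂z_j, the inverses that occur in `alternant`, and those that invert the
  -- Vandermonde matrix.
  record EulerDerivations n : Set ℓ where
    field
      θ        : Fin n → Derivation
      θ-comm   : ∀ i j x → D (θ i) (D (θ j) x) ≈ D (θ j) (D (θ i) x)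
      z        : Fin n → Carrier
      z-unit   : ∀ i → IsUnit (z i)
      z-z-unit : ∀ {i j} → i Fin.< j → IsUnit (z i - z j)
      θ-z      : ∀ i j → D (θ j) (z i) ≈ δ i j * z i

  alternant : ∀ {m} → EulerDerivations (suc m) → ℤ → Fin (suc m) → Carrier
  alternant euler r j = (- 1#) ^ toℕ j * power (z j) (z-unit j) r * Δ (removeAt z j)
    where open EulerDerivations euler

  -- The multiple k_l u^k is a divergence. As values of the Euler derivations of Laurent series have
  -- constant term 0, in characteristic 0 this kills the constant term of u^k as soon as some k_l is
  -- nonzero.
  IsExact : ∀ {n} → EulerDerivations n → (u : Fin n → Carrier) → (∀ i → IsUnit (u i)) → Set ℓ
  IsExact {n} euler u u-unit = ∀ (k : Fin n → ℤ) l → ∃ λ (F : Fin n → Carrier) →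
    sum (λ j → D (θ j) (F j)) ≈ ι (k l) * product (λ i → power (u i) (u-unit i) (k i))
    where open EulerDerivations euler

  module Jacobian (m : ℕ) (euler : EulerDerivations (suc m))
    (ι-unit : ∀ k → k ≢ + 0 → IsUnit (ι k))
    (u : Fin (suc m) → Carrier) (u-unit : ∀ i → IsUnit (u i))
    (r : ℤ) (u≈alternant : ∀ j → u j ≈ alternant euler r j)
    (r≢i : ∀ i → i ℕ.< m → r ≢ + i) (r≢-mC2 : r ≢ ℤ.- (+ (m choose 2)))
    where

    open EulerDerivations euler

    private
      n = suc m

    Z : Matrix n
    Z = vandermonde z

    V : ℕ → Derivation
    V p = combination (λ j → z j ^ p) θ

    V-z : ∀ p i → D (V p) (z i) ≈ z i ^ suc p
    V-z p i = begin
      sum (λ j → z j ^ p * D (θ j) (z i))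
        ≈⟨ sum-cong-≋ (λ j → trans (*-congˡ (θ-z i j))
             (solve 3 (λ a e x → a :* (e :* x) := e :* (x :* a)) refl (z j ^ p) (δ i j) (z i))) ⟩
      sum (λ j → δ i j * (z i * z j ^ p))   ≈⟨ δ-sumˡ i (λ j → z i * z j ^ p) ⟩
      z i * z i ^ p                         ∎

    -- The logarithmic derivatives of the three factors add up: 0 from the sign, r z_i^p from the
    -- power of z_i, and the sum of `h p` over pairs from the Vandermonde product.
    V-alternant : ∀ p i → D (V p) (alternant euler r i) ≈
      (ι r * z i ^ p + pairSum (h p) (removeAt z i)) * alternant euler r i
    V-alternant p i = log-resp (+-congʳ (trans (+-congʳ (zeroʳ _)) (+-identityˡ _)))
      (log-* (log-* (log-^ (toℕ i) (log-constant D-1≈0))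
                    (log-power (z-unit i) r (trans (V-z p i) (*-comm _ _))))
             (log-Δ (V p) (h p) (removeAt z i) (λ a b → difference (Fin.punchIn i a) (Fin.punchIn i b))))
      where
      open Logarithmic (V p)
      D-1≈0 : D (V p) (- 1#) ≈ 0#
      D-1≈0 = trans (D-neg (V p) 1#) (trans (-‿cong (D-1 (V p))) -0#≈0#)
      difference : ∀ a b → Log (z a - z b) (h p (z a) (z b))
      difference a b = begin
        D (V p) (z a - z b)              ≈⟨ D-+ (V p) (z a) (- z b) ⟩
        D (V p) (z a) + D (V p) (- z b)  ≈⟨ +-cong (V-z p a) (trans (D-neg (V p) (z b)) (-‿cong (V-z p b))) ⟩
        z a ^ suc p - z b ^ suc p        ≈⟨ h-difference p (z a) (z b) ⟩
        h p (z a) (z b) * (z a - z b)    ∎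

    V-u : ∀ p i → D (V p) (u i) ≈ (ι r * z i ^ p + pairSum (h p) (removeAt z i)) * u i
    V-u p i = trans (D-cong (V p) (u≈alternant i))
      (trans (V-alternant p i) (*-congˡ (sym (u≈alternant i))))

    powerSum : ℕ → Carrier
    powerSum p = sum (λ j → z j ^ p)

    -- the coefficient of x ^ a in the sum of h p x (z j) over j
    columnCoefficient : ℕ → ℕ → Carrier
    columnCoefficient p       zero    = powerSum p
    columnCoefficient zero    (suc a) = 0#
    columnCoefficient (suc p) (suc a) = columnCoefficient p a

    -- By `h-step`, passing from p to p + 1 multiplies the sum by x and adds the power sum of
    -- exponent p + 1 as the new constant coefficient: the coefficients shift by one place.
    columnCoefficient-expansion : ∀ {N} p → p ℕ.< N → ∀ x →
      sum {N} (λ a → x ^ toℕ a * columnCoefficient p (toℕ a)) ≈ sum (λ j → h p x (z j))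
    columnCoefficient-expansion {suc N} zero _ x = begin
      1# * powerSum 0 + sum {N} (λ a → x * x ^ toℕ a * 0#)
        ≈⟨ +-cong (*-identityˡ _) (sum-zero {N} (λ a → zeroʳ (x * x ^ toℕ a))) ⟩
      powerSum 0 + 0#    ≈⟨ +-identityʳ _ ⟩
      powerSum 0         ∎
    columnCoefficient-expansion {suc N} (suc p) (s≤s p<N) x = begin
      1# * powerSum (suc p) + sum {N} (λ a → x * x ^ toℕ a * columnCoefficient p (toℕ a))
        ≈⟨ +-cong (*-identityˡ _) (trans
             (sum-cong-≋ {N} (λ a → *-assoc x (x ^ toℕ a) (columnCoefficient p (toℕ a))))
             (sym (*-distribˡ-sum {N} x (λ a → x ^ toℕ a * columnCoefficient p (toℕ a))))) ⟩
      powerSum (suc p) + x * sum {N} (λ a → x ^ toℕ a * columnCoefficient p (toℕ a))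
        ≈⟨ +-congˡ (*-congˡ (columnCoefficient-expansion p p<N x)) ⟩
      powerSum (suc p) + x * sum (λ j → h p x (z j))
        ≈⟨ +-congˡ (*-distribˡ-sum x (λ j → h p x (z j))) ⟩
      powerSum (suc p) + sum (λ j → x * h p x (z j))
        ≈⟨ ∑-distrib-+ (λ j → z j ^ suc p) (λ j → x * h p x (z j)) ⟨
      sum (λ j → z j ^ suc p + x * h p x (z j))
        ≈⟨ sum-cong-≋ (λ j → h-step p x (z j)) ⟨
      sum (λ j → h (suc p) x (z j)) ∎

    columnCoefficient-upper : ∀ p a → p ℕ.< a → columnCoefficient p a ≈ 0#
    columnCoefficient-upper zero    (suc a) _         = refl
    columnCoefficient-upper (suc p) (suc a) (s≤s p<a) = columnCoefficient-upper p a p<a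

    columnCoefficient-diagonal : ∀ p → columnCoefficient p p ≈ ι (+ n)
    columnCoefficient-diagonal zero    = sum-replicate n
    columnCoefficient-diagonal (suc p) = columnCoefficient-diagonal p

    -- Column p holds the coefficients, as a polynomial in z_i, of r z_i^p plus the sum of `h p`
    -- over the pairs avoiding i. That sum is the sum over all pairs, minus the sum of h_p(z_i, z_j)
    -- over all j, plus h_p(z_i, z_i) = (p + 1) z_i^p. These contribute, in this order, the corner
    -- row `δ zero a`, the `columnCoefficient` and the `suc (toℕ p)`.
    T : Matrix n
    T a p = δ a p * (ι r + ι (+ suc (toℕ p))) - columnCoefficient (toℕ p) (toℕ a)
          + δ zero a * pairSum (h (toℕ p)) z

    Z⊗T : ∀ i p → (Z ⊗ T) i p ≈ ι r * z i ^ toℕ p + pairSum (h (toℕ p)) (removeAt z i)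
    Z⊗T i p = begin
      sum (λ a → x ^ toℕ a * (δ a p * λ′ - c a + δ zero a * P))
        ≈⟨ sum-cong-≋ (λ a → solve 6 (λ x e l c f P → x :* (e :* l :- c :+ f :* P) :=
             (x :* e) :* l :+ :- (x :* c) :+ f :* (x :* P)) refl (x ^ toℕ a) (δ a p) λ′ (c a) (δ zero a) P) ⟩
      sum (λ a → x ^ toℕ a * δ a p * λ′ + - (x ^ toℕ a * c a) + δ zero a * (x ^ toℕ a * P))
        ≈⟨ trans (∑-distrib-+ (λ a → x ^ toℕ a * δ a p * λ′ + - (x ^ toℕ a * c a))
                             (λ (a : Fin n) → δ zero a * (x ^ toℕ a * P)))
                 (+-congʳ (∑-distrib-+ (λ a → x ^ toℕ a * δ a p * λ′) (λ a → - (x ^ toℕ a * c a)))) ⟩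
      sum (λ a → x ^ toℕ a * δ a p * λ′) + sum (λ a → - (x ^ toℕ a * c a))
        + sum (λ (a : Fin n) → δ zero a * (x ^ toℕ a * P))
        ≈⟨ +-cong (+-cong
             (trans (sym (*-distribʳ-sum λ′ (λ a → x ^ toℕ a * δ a p))) (*-congʳ (δ-sumʳ p (λ a → x ^ toℕ a))))
             (trans (sum-neg (λ a → x ^ toℕ a * c a)) (-‿cong
               (columnCoefficient-expansion (toℕ p) (Finₚ.toℕ<n p) x))))
             (trans (δ-sumˡ zero (λ (a : Fin n) → x ^ toℕ a * P)) (*-identityˡ P)) ⟩
      x ^ toℕ p * λ′ - sum (λ j → h (toℕ p) x (z j)) + P
        ≈⟨ +-cong (+-congˡ (-‿cong (trans (sum-remove {i = i} (λ j → h (toℕ p) x (z j)))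
             (+-congʳ (h-diagonal (toℕ p) x))))) (pairSum-remove (h (toℕ p)) (h-comm (toℕ p)) z i) ⟩
      x ^ toℕ p * λ′ - (ι (+ suc (toℕ p)) * x ^ toℕ p + S) + (S + Q)
        ≈⟨ solve 5 (λ x r p s q → x :* (r :+ p) :- (p :* x :+ s) :+ (s :+ q) := r :* x :+ q) refl
             (x ^ toℕ p) (ι r) (ι (+ suc (toℕ p))) S Q ⟩
      ι r * x ^ toℕ p + Q ∎
      where
      x λ′ P S Q : Carrier
      x = z i
      λ′ = ι r + ι (+ suc (toℕ p))
      P = pairSum (h (toℕ p)) z
      S = sum (λ b → h (toℕ p) x (removeAt z i b))
      Q = pairSum (h (toℕ p)) (removeAt z i)
      c : Fin n → Carrier
      c a = columnCoefficient (toℕ p) (toℕ a)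
      sum-neg : ∀ {N} (f : Fin N → Carrier) → sum (λ a → - f a) ≈ - sum f
      sum-neg f = +-inverseˡ-unique _ _ (trans (sym (∑-distrib-+ (λ a → - f a) f))
        (sum-zero (λ a → -‿inverseˡ (f a))))

    T-upper : Upper T
    T-upper (suc a) p p<a = begin
      δ (suc a) p * _ - columnCoefficient (toℕ p) (suc (toℕ a)) + 0# * pairSum (h (toℕ p)) z
        ≈⟨ +-cong (+-cong (trans (*-congʳ (δ-off (suc a) p (λ { ≡.refl → ℕₚ.<-irrefl ≡.refl p<a }))) (zeroˡ _))
             (trans (-‿cong (columnCoefficient-upper (toℕ p) (suc (toℕ a)) p<a)) -0#≈0#)) (zeroˡ _) ⟩
      0# + 0# + 0#  ≈⟨ trans (+-identityʳ _) (+-identityʳ _) ⟩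
      0#            ∎

    pairSum-1 : ∀ {k} (y : Fin k → Carrier) → pairSum (λ _ _ → 1#) y ≈ ι (+ (k choose 2))
    pairSum-1 {zero}  y = refl
    pairSum-1 {suc k} y = begin
      sum {k} (λ _ → 1#) + pairSum (λ _ _ → 1#) (y ∘ suc)
        ≈⟨ +-cong (sum-replicate k) (pairSum-1 (y ∘ suc)) ⟩
      ι (+ k) + ι (+ (k choose 2))       ≈⟨ ×-homo-+ 1# k (k choose 2) ⟨
      ι (+ (k ℕ.+ k choose 2))           ≡⟨ ≡.cong (λ l → ι (+ (l ℕ.+ k choose 2))) (nC1≡n k) ⟨
      ι (+ (k choose 1 ℕ.+ k choose 2))       ≡⟨ ≡.cong (λ l → ι (+ l)) (nCk+nC[k+1]≡[n+1]C[k+1] k 1) ⟩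
      ι (+ (suc k choose 2))             ∎

    -- The entry is exhibited as the image of a nonzero integer, which makes it both invertible and
    -- constant under every derivation. In the corner, h_0 = 1 gives r + 1 - n + C(n,2), which
    -- Pascal's rule turns into r + C(n-1,2); the other entries are r + (p + 1) - n.
    T-diagonal : ∀ p → ∃ λ k → k ≢ + 0 × T p p ≈ ι k
    T-diagonal zero = r ℤ.+ + (m choose 2) , nonzero , (begin
      1# * (ι r + ι (+ 1)) - powerSum 0 + 1# * pairSum (λ _ _ → 1#) z
        ≈⟨ +-cong (+-cong (*-identityˡ _) (-‿cong (columnCoefficient-diagonal 0)))
                  (trans (*-identityˡ _) (pairSum-1 z)) ⟩
      ι r + ι (+ 1) - ι (+ n) + ι (+ (n choose 2))
        ≈⟨ +-congˡ (trans (reflexive (≡.cong (λ l → ι (+ l)) nC2≡m+mC2)) (ι-+ (+ m) (+ (m choose 2)))) ⟩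
      ι r + ι (+ 1) - (1# + ι (+ m)) + (ι (+ m) + ι (+ (m choose 2)))
        ≈⟨ +-congʳ (+-congʳ (+-congˡ ι-1)) ⟩
      ι r + 1# - (1# + ι (+ m)) + (ι (+ m) + ι (+ (m choose 2)))
        ≈⟨ solve 4 (λ r e m c → r :+ e :- (e :+ m) :+ (m :+ c) := r :+ c) refl
             (ι r) 1# (ι (+ m)) (ι (+ (m choose 2))) ⟩
      ι r + ι (+ (m choose 2))
        ≈⟨ ι-+ r (+ (m choose 2)) ⟨
      ι (r ℤ.+ + (m choose 2)) ∎)
      where
      nC2≡m+mC2 : n choose 2 ≡ m ℕ.+ m choose 2
      nC2≡m+mC2 = ≡.trans (≡.sym (nCk+nC[k+1]≡[n+1]C[k+1] m 1)) (≡.cong (ℕ._+ m choose 2) (nC1≡n m))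
      lem : ∀ a b → a ≡ (a ℤ.+ b) ℤ.- b
      lem = solve-∀
      nonzero : r ℤ.+ + (m choose 2) ≢ + 0
      nonzero eq = r≢-mC2 (≡.trans (lem r (+ (m choose 2)))
        (≡.trans (≡.cong (ℤ._- + (m choose 2)) eq) (ℤₚ.+-identityˡ _)))
    T-diagonal p@(suc p′) = r ℤ.+ + suc (toℕ p) ℤ.- + n , nonzero , (begin
      δ p p * (ι r + ι (+ suc (toℕ p))) - columnCoefficient (toℕ p) (toℕ p) + 0# * pairSum (h (toℕ p)) z
        ≈⟨ +-cong (+-cong (trans (*-congʳ (δ-diagonal p)) (*-identityˡ _))
             (-‿cong (columnCoefficient-diagonal (toℕ p)))) (zeroˡ _) ⟩
      ι r + ι (+ suc (toℕ p)) - ι (+ n) + 0#    ≈⟨ +-identityʳ _ ⟩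
      ι r + ι (+ suc (toℕ p)) - ι (+ n)
        ≈⟨ trans (ι-+ (r ℤ.+ + suc (toℕ p)) (ℤ.- + n)) (+-cong (ι-+ r (+ suc (toℕ p))) (ι-neg (+ n))) ⟨
      ι (r ℤ.+ + suc (toℕ p) ℤ.- + n) ∎)
      where
      lem : ∀ a p c → a ≡ (a ℤ.+ p ℤ.- (p ℤ.+ c)) ℤ.+ c
      lem = solve-∀
      -- The entry is r - `co` with `co` = n - 1 - p, and p ≥ 1 gives 0 ≤ `co` ≤ n - 2: one of the
      -- values excluded for r.
      co = m ℕ.∸ suc (toℕ p′)
      n≡ : n ≡ suc (toℕ p) ℕ.+ co
      n≡ = ≡.cong suc (≡.sym (ℕₚ.m+[n∸m]≡n (Finₚ.toℕ<n p′)))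
      nonzero : r ℤ.+ + suc (toℕ p) ℤ.- + n ≢ + 0
      nonzero eq = r≢i co (ℕₚ.∸-monoʳ-< {m} {suc (toℕ p′)} {0} (s≤s z≤n) (Finₚ.toℕ<n p′))
        (≡.trans (lem r (+ suc (toℕ p)) (+ co)) (≡.trans
          (≡.cong (ℤ._+ + co) (≡.trans (≡.cong (λ l → r ℤ.+ + suc (toℕ p) ℤ.- + l) (≡.sym n≡)) eq))
          (ℤₚ.+-identityˡ _)))

    M : Matrix n
    M i j = D (θ j) (u i) * IsUnit.inverse (u-unit i)

    θ-u : ∀ i j → D (θ j) (u i) ≈ M i j * u i
    θ-u i j = sym (trans (*-assoc _ _ _)
      (trans (*-congˡ (trans (*-comm _ _) (IsUnit.x*inverse (u-unit i)))) (*-identityʳ _)))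

    -- Times u_i, entry (i, p) of M Z is the sum of z_j^p θ_j(u_i) over j, that is V_p(u_i), which
    -- `V-u` evaluates.
    M⊗Z : M ⊗ Z ≋ Z ⊗ T
    M⊗Z = entries λ i p → trans (unit-cancel (u-unit i) (begin
      sum (λ j → M i j * z j ^ toℕ p) * u i
        ≈⟨ *-distribʳ-sum (u i) (λ j → M i j * z j ^ toℕ p) ⟩
      sum (λ j → M i j * z j ^ toℕ p * u i)
        ≈⟨ sum-cong-≋ (λ j → trans
             (solve 3 (λ a b c → a :* b :* c := b :* (a :* c)) refl (M i j) (z j ^ toℕ p) (u i))
             (*-congˡ (sym (θ-u i j)))) ⟩
      D (V (toℕ p)) (u i)
        ≈⟨ V-u (toℕ p) i ⟩
      (ι r * z i ^ toℕ p + pairSum (h (toℕ p)) (removeAt z i)) * u i ∎)) (sym (Z⊗T i p))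

    Z⁻¹ : Inverse Z
    Z⁻¹ = vandermonde-inverse z z-z-unit

    T⁻¹ : UpperInverse T
    T⁻¹ = upper-inverse T T-upper (λ p → let k , k≢0 , Tpp≈k = T-diagonal p in
      unit-resp (sym Tpp≈k) (ι-unit k k≢0))

    open LogDeterminant using (logDet; logDet-resp; logDet-⊗; logDet-inverse; logDet-upper; DM; D-⊗)

    -- The inverse of `M` is assembled from inverses of factors, so that `logDet-⊗` can be applied
    -- to it.
    Z⊗T⊗Z⁻¹ : Inverse ((Z ⊗ T) ⊗ inv Z⁻¹)
    Z⊗T⊗Z⁻¹ = ⊗-inverse (⊗-inverse Z⁻¹ (inverse T⁻¹)) (inverse-sym Z⁻¹)

    ≋M : (Z ⊗ T) ⊗ inv Z⁻¹ ≋ M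
    ≋M = ≋-trans (⊗-cong (≋-sym M⊗Z) (≋-refl {A = inv Z⁻¹})) (≋-trans (⊗-assoc M Z (inv Z⁻¹))
      (≋-trans (⊗-cong (≋-refl {A = M}) (inverseʳ Z⁻¹)) (⊗-identityʳ M)))

    M⁻¹ : Inverse M
    M⁻¹ = inverse-resp ≋M Z⊗T⊗Z⁻¹

    W : Matrix n
    W = inv M⁻¹

    -- det M = det T is a constant
    logDet-M : ∀ d → logDet d M⁻¹ ≈ 0#
    logDet-M d = begin
      logDet d M⁻¹
        ≈⟨ logDet-resp d ≋M Z⊗T⊗Z⁻¹ ⟩
      logDet d (⊗-inverse (⊗-inverse Z⁻¹ (inverse T⁻¹)) (inverse-sym Z⁻¹))
        ≈⟨ logDet-⊗ d (⊗-inverse Z⁻¹ (inverse T⁻¹)) (inverse-sym Z⁻¹) ⟩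
      logDet d (⊗-inverse Z⁻¹ (inverse T⁻¹)) + logDet d (inverse-sym Z⁻¹)
        ≈⟨ +-congʳ (trans (logDet-⊗ d Z⁻¹ (inverse T⁻¹))
             (trans (+-congˡ (logDet-upper d T-upper constant T⁻¹)) (+-identityʳ _))) ⟩
      logDet d Z⁻¹ + logDet d (inverse-sym Z⁻¹)
        ≈⟨ logDet-inverse d Z⁻¹ ⟩
      0# ∎
      where
      constant : ∀ p → D d (T p p) ≈ 0#
      constant p = let k , _ , Tpp≈k = T-diagonal p in trans (D-cong d Tpp≈k) (D-ι d k)

    -- The form d log u_i is closed: in θ_b θ_a(u_i) = θ_a θ_b(u_i) the terms M_ia M_ib u_i agree on
    -- both sides and cancel.
    M-closed : ∀ a b i → D (θ b) (M i a) ≈ D (θ a) (M i b)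
    M-closed a b i = unit-cancel (u-unit i) (begin
      D (θ b) (M i a) * u i
        ≈⟨ solve 4 (λ x v p q → x :* v := (x :* v :+ p :* (q :* v)) :- p :* q :* v) refl
             (D (θ b) (M i a)) (u i) (M i a) (M i b) ⟩
      (D (θ b) (M i a) * u i + M i a * (M i b * u i)) - M i a * M i b * u i
        ≈⟨ +-cong (second-derivative a b) (-‿cong (*-congʳ (*-comm (M i a) (M i b)))) ⟩
      (D (θ a) (M i b) * u i + M i b * (M i a * u i)) - M i b * M i a * u i
        ≈⟨ solve 4 (λ x v p q → x :* v := (x :* v :+ p :* (q :* v)) :- p :* q :* v) refl
             (D (θ a) (M i b)) (u i) (M i b) (M i a) ⟨
      D (θ a) (M i b) * u i ∎)
      where
      θθu : ∀ a b → D (θ b) (D (θ a) (u i)) ≈ D (θ b) (M i a) * u i + M i a * (M i b * u i)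
      θθu a b = trans (D-cong (θ b) (θ-u i a))
        (trans (leibniz (θ b) (M i a) (u i)) (+-congˡ (*-congˡ (θ-u i b))))
      second-derivative : ∀ a b → D (θ b) (M i a) * u i + M i a * (M i b * u i) ≈
                                  D (θ a) (M i b) * u i + M i b * (M i a * u i)
      second-derivative a b = trans (sym (θθu a b)) (trans (θ-comm b a (u i)) (θθu b a))

    divergence : Fin n → Carrier
    divergence l = sum (λ j → D (θ j) (W j l))

    -- Differentiating W M = 1 moves θ_j from `W` to `M` at the cost of a sign. Closedness then
    -- replaces θ_j(M_lb) by θ_b(M_lj), and what remains is minus the trace of W θ_b(M), the
    -- logarithmic derivative of det M.
    divergence-M : ∀ b → sum (λ l → divergence l * M l b) ≈ 0#
    divergence-M b = begin
      sum (λ l → divergence l * M l b)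
        ≈⟨ sum-cong-≋ (λ l → *-distribʳ-sum (M l b) (λ j → D (θ j) (W j l))) ⟩
      sum (λ l → sum (λ j → D (θ j) (W j l) * M l b))
        ≈⟨ ∑-comm (λ l j → D (θ j) (W j l) * M l b) ⟩
      sum (λ j → sum (λ l → D (θ j) (W j l) * M l b))
        ≈⟨ sum-cong-≋ (λ j → +-inverseˡ-unique _ _ (trans
             (sym (D-⊗ (θ j) W M j b))
             (trans (D-cong (θ j) (entry (inverseˡ M⁻¹) j b)) (D-δ (θ j) j b)))) ⟩
      sum (λ j → - sum (λ l → W j l * D (θ j) (M l b)))
        ≈⟨ sum-cong-≋ (λ j → -‿cong (sum-cong-≋ (λ l → *-congˡ {W j l} (M-closed b j l)))) ⟩
      sum (λ j → - sum (λ l → W j l * D (θ b) (M l j)))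
        ≈⟨ +-inverseˡ-unique _ (logDet (θ b) M⁻¹) (trans
             (sym (∑-distrib-+ (λ j → - (W ⊗ DM (θ b) M) j j) (λ j → (W ⊗ DM (θ b) M) j j)))
             (sum-zero (λ j → -‿inverseˡ ((W ⊗ DM (θ b) M) j j)))) ⟩
      - logDet (θ b) M⁻¹
        ≈⟨ trans (-‿cong (logDet-M (θ b))) -0#≈0# ⟩
      0# ∎

    -- The row vector `divergence` is killed by the invertible matrix `M`. Associativity is again
    -- applied to a matrix with constant rows.
    divergence-free : ∀ l → divergence l ≈ 0#
    divergence-free l = begin
      divergence l                              ≈⟨ δ-sumʳ l divergence ⟨
      sum (λ k → divergence k * δ k l)          ≈⟨ sum-cong-≋ (λ k → *-congˡ {divergence k} (entry (inverseʳ M⁻¹) k l)) ⟨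
      sum (λ k → divergence k * (M ⊗ W) k l)    ≈⟨ entry (⊗-assoc (λ _ → divergence) M W) l l ⟨
      sum (λ k → sum (λ b → divergence b * M b k) * W k l)
        ≈⟨ sum-zero (λ k → trans (*-congʳ {W k l} (divergence-M k)) (zeroˡ _)) ⟩
      0# ∎

    -- The primitive is column l of `W` times x = u^k. In the Leibniz rule the derivatives of `W`
    -- drop out because the column is divergence free; the others give the row k M applied to that
    -- column of `W`, which is k_l.
    exact : IsExact euler u u-unit
    exact k l = (λ j → W j l * x) , (begin
      sum (λ j → D (θ j) (W j l * x))
        ≈⟨ sum-cong-≋ (λ j → trans (leibniz (θ j) (W j l) x) (+-congˡ (*-congˡ (log-u^k j)))) ⟩
      sum (λ j → D (θ j) (W j l) * x + W j l * (sum (λ i → ι (k i) * M i j) * x))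
        ≈⟨ ∑-distrib-+ (λ j → D (θ j) (W j l) * x) (λ j → W j l * (sum (λ i → ι (k i) * M i j) * x)) ⟩
      sum (λ j → D (θ j) (W j l) * x) + sum (λ j → W j l * (sum (λ i → ι (k i) * M i j) * x))
        ≈⟨ +-cong (sym (*-distribʳ-sum x (λ j → D (θ j) (W j l))))
             (trans (sum-cong-≋ (λ j → solve 3 (λ w s x → w :* (s :* x) := s :* w :* x) refl
                      (W j l) (sum (λ i → ι (k i) * M i j)) x))
                    (sym (*-distribʳ-sum x (λ j → sum (λ i → ι (k i) * M i j) * W j l)))) ⟩
      divergence l * x + sum (λ j → sum (λ i → ι (k i) * M i j) * W j l) * x
        ≈⟨ +-cong (trans (*-congʳ (divergence-free l)) (zeroˡ x))
             (*-congʳ (entry (⊗-assoc (λ _ → ι ∘ k) M W) l l)) ⟩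
      0# + sum (λ i → ι (k i) * (M ⊗ W) i l) * x
        ≈⟨ trans (+-identityˡ _) (*-congʳ (trans
             (sum-cong-≋ (λ i → *-congˡ {ι (k i)} (entry (inverseʳ M⁻¹) i l))) (δ-sumʳ l (ι ∘ k)))) ⟩
      ι (k l) * x ∎)
      where
      x : Carrier
      x = product (λ i → power (u i) (u-unit i) (k i))
      log-u^k : ∀ j → D (θ j) x ≈ sum (λ i → ι (k i) * M i j) * x
      log-u^k j = log-product (λ i → power (u i) (u-unit i) (k i)) (λ i → ι (k i) * M i j)
        (λ i → log-power (u-unit i) (k i) (θ-u i j))
        where open Logarithmic (θ j)

-- Derivations of a ring of Laurent series.

module LaurentDerivations {ℓ} (R : CommutativeRing ℓ ℓ) where

  open CommutativeRing R hiding (zero)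
  open LaurentSeries R
  open Derivations R using (Derivation)
  open Derivation
  open Algebra.Properties.Ring ring using (-0#≈0#)
  open IntegerMultiples R using (ι; ι-+; ι-1)
  open IntegerMultiples laurentRing using () renaming (ι to ιᴸ)
  open Derivations laurentRing using () renaming (Derivation to Derivationᴸ)

  D-IsSum : ∀ (d : Derivation) {h s} → IsSum h s → IsSum (D d ∘ h) (D d s)
  D-IsSum d {h} (isSum a n (within b c) t) = isSum a n
    (within (λ i l → trans (D-cong d (b i l)) (D-0 d)) (λ i l → trans (D-cong d (c i l)) (D-0 d)))
    (trans (sym (D-sum d {n} (λ t → h (a ℤ.+ + toℕ t)))) (D-cong d t))

  lift : Derivation → Derivationᴸ
  lift d = record
    { D       = Dᴸ
    ; D-cong  = λ e → mk≈ λ k → D-cong d (coeff-≈ e k)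
    ; D-+     = λ f g → mk≈ λ k → D-+ d (coeff f k) (coeff g k)
    -- Both sides are finite sums of the same function, possibly over different windows;
    -- `sum-unique` identifies them.
    ; leibniz = λ f g → mk≈ λ k → sum-unique
        (sum-cong (λ i → leibniz d (coeff f i) (coeff g (k ℤ.- i))) (D-IsSum d (*-sum f g k)))
        (sum-+ (*-sum (Dᴸ f) g k) (*-sum f (Dᴸ g) k))
    }
    where
    Dᴸ : Laurent → Laurent
    Dᴸ f = record
      { coeff    = λ k → D d (coeff f k)
      ; low      = low f
      ; vanishes = λ k< → trans (D-cong d (vanishes f k<)) (D-0 d)
      }

  -- This is X d/dX; its Leibniz rule comes from splitting the exponent k as i + (k - i).
  euler : Derivationᴸ
  euler = record
    { D       = E
    ; D-cong  = λ e → mk≈ λ k → *-congˡ (coeff-≈ e k)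
    ; D-+     = λ f g → mk≈ λ k → distribˡ (ι k) (coeff f k) (coeff g k)
    ; leibniz = λ f g → mk≈ λ k → sum-unique
        (sum-cong (λ i → split k i (coeff f i) (coeff g (k ℤ.- i))) (sum-*ˡ (ι k) (*-sum f g k)))
        (sum-+ (*-sum (E f) g k) (*-sum f (E g) k))
    }
    where
    E : Laurent → Laurent
    E f = record
      { coeff    = λ k → ι k * coeff f k
      ; low      = low f
      ; vanishes = λ k< → trans (*-congˡ (vanishes f k<)) (zeroʳ _)
      }
    open import Relation.Binary.Reasoning.Setoid setoid
    open IntegerMultiples R using (module Solver)
    open Solver using (solve; _:+_; _:*_; _:=_)
    lem : ∀ k i → k ≡ i ℤ.+ (k ℤ.- i)
    lem = solve-∀
    split : ∀ k i x y → ι k * (x * y) ≈ ι i * x * y + x * (ι (k ℤ.- i) * y)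
    split k i x y = begin
      ι k * (x * y)                      ≡⟨ ≡.cong (λ l → ι l * (x * y)) (lem k i) ⟩
      ι (i ℤ.+ (k ℤ.- i)) * (x * y)      ≈⟨ *-congʳ (ι-+ i (k ℤ.- i)) ⟩
      (ι i + ι (k ℤ.- i)) * (x * y)
        ≈⟨ solve 4 (λ a b x y → (a :+ b) :* (x :* y) := a :* x :* y :+ x :* (b :* y)) refl (ι i) (ι (k ℤ.- i)) x y ⟩
      ι i * x * y + x * (ι (k ℤ.- i) * y) ∎

  Commute : Derivation → Derivation → Set ℓ
  Commute d e = ∀ x → D d (D e x) ≈ D e (D d x)

  lift-comm : ∀ {d e} → Commute d e → ∀ f → Derivationᴸ.D (lift d) (Derivationᴸ.D (lift e) f)
                                          ≈ᴸ Derivationᴸ.D (lift e) (Derivationᴸ.D (lift d) f)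
  lift-comm de f = mk≈ λ k → de (coeff f k)

  -- `d` kills integers, so it commutes with the multiplication of the coefficient at `k` by `ι k`.
  lift-euler-comm : ∀ d f → Derivationᴸ.D (lift d) (Derivationᴸ.D euler f)
                         ≈ᴸ Derivationᴸ.D euler (Derivationᴸ.D (lift d) f)
  lift-euler-comm d f = mk≈ λ k → trans (leibniz d (ι k) (coeff f k))
    (trans (+-congʳ (trans (*-congʳ (D-ι d k)) (zeroˡ _))) (+-identityˡ _))

  lift-C : ∀ d x → Derivationᴸ.D (lift d) (C x) ≈ᴸ C (D d x)
  lift-C d x = mk≈ at
    where
    at : ∀ k → D d (coeff (C x) k) ≈ coeff (C (D d x)) k
    at k with k ℤₚ.≟ + 0
    ... | yes _ = refl
    ... | no  _ = D-0 d

  lift-X : ∀ d → Derivationᴸ.D (lift d) X ≈ᴸ 0ᴸ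
  lift-X d = mk≈ at
    where
    at : ∀ k → D d (coeff X k) ≈ 0#
    at k with k ℤₚ.≟ + 1
    ... | yes _ = D-1 d
    ... | no  _ = D-0 d

  euler-C : ∀ x → Derivationᴸ.D euler (C x) ≈ᴸ 0ᴸ
  euler-C x = mk≈ at
    where
    at : ∀ k → ι k * coeff (C x) k ≈ 0#
    at k with k ℤₚ.≟ + 0
    ... | yes ≡.refl = zeroˡ x
    ... | no  _      = zeroʳ (ι k)

  euler-X : Derivationᴸ.D euler X ≈ᴸ X
  euler-X = mk≈ at
    where
    at : ∀ k → ι k * coeff X k ≈ coeff X k
    at k with k ℤₚ.≟ + 1
    ... | yes ≡.refl = trans (*-identityʳ _) ι-1
    ... | no  _      = zeroʳ (ι k)

  C-0 : C 0# ≈ᴸ 0ᴸ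
  C-0 = mk≈ at
    where
    at : ∀ k → coeff (C 0#) k ≈ 0#
    at k with k ℤₚ.≟ + 0
    ... | yes _ = refl
    ... | no  _ = refl

  C-ι : ∀ k → C (ι k) ≈ᴸ ιᴸ k
  C-ι (+ n)    = natural n
    where
    natural : ∀ n → C (ι (+ n)) ≈ᴸ ιᴸ (+ n)
    natural zero    = C-0
    natural (suc n) = mk≈ λ k → trans (at k) (+-congˡ (coeff-≈ (natural n) k))
      where
      at : ∀ k → coeff (C (ι (+ suc n))) k ≈ coeff 1ᴸ k + coeff (C (ι (+ n))) k
      at k with k ℤₚ.≟ + 0
      ... | yes _ = refl
      ... | no  _ = sym (+-identityʳ 0#)
  C-ι -[1+ n ] = mk≈ λ k → trans (at k) (-‿cong (coeff-≈ (C-ι (+ suc n)) k))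
    where
    at : ∀ k → coeff (C (ι -[1+ n ])) k ≈ - coeff (C (ι (+ suc n))) k
    at k with k ℤₚ.≟ + 0
    ... | yes _ = refl
    ... | no  _ = sym -0#≈0#

-- The Euler derivations of iterated Laurent series.

module IteratedDerivations {ℓ} (K : HeytingField ℓ ℓ ℓ) where

  open SeriesOver K
  open HeytingField K using (_≈_; 0#; _+_; _*_; -_; refl; sym; trans; +-cong; -‿cong; zeroˡ; *-identityˡ; distribʳ)
  private
    module F = CommutativeRing fieldRing
    module I (n : ℕ) = CommutativeRing (iterated n)
    module ι (n : ℕ) = IntegerMultiples (iterated n)
  open Derivations.Derivation

  coefficient-cong : ∀ n {f g} → I._≈_ n f g → ∀ k → coefficient n f k ≈ coefficient n g k
  coefficient-cong zero    e k = e
  coefficient-cong (suc n) e k = coefficient-cong n (LaurentSeries.coeff-≈ e (Vec.last k)) (Vec.init k)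

  coefficient-0 : ∀ n k → coefficient n (I.0# n) k ≈ 0#
  coefficient-0 zero    k = refl
  coefficient-0 (suc n) k = coefficient-0 n (Vec.init k)

  coefficient-+ : ∀ n f g k → coefficient n (I._+_ n f g) k ≈ coefficient n f k + coefficient n g k
  coefficient-+ zero    f g k = refl
  coefficient-+ (suc n) f g k = coefficient-+ n _ _ (Vec.init k)

  coefficient-neg : ∀ n f k → coefficient n (I.-_ n f) k ≈ - coefficient n f k
  coefficient-neg zero    f k = refl
  coefficient-neg (suc n) f k = coefficient-neg n _ (Vec.init k)

  coefficient-ι : ∀ n i f k → coefficient n (I._*_ n (ι.ι n i) f) k ≈ ι.ι 0 i * coefficient n f k
  coefficient-ι n (+ i)    f k = natural i
    where
    natural : ∀ i → coefficient n (I._*_ n (ι.ι n (+ i)) f) k ≈ ι.ι 0 (+ i) * coefficient n f k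
    natural zero    = trans (coefficient-cong n (I.zeroˡ n f) k)
      (trans (coefficient-0 n k) (sym (zeroˡ _)))
    natural (suc i) = trans
      (coefficient-cong n (I.trans n (I.distribʳ n f (I.1# n) (ι.ι n (+ i))) (I.+-congʳ n (I.*-identityˡ n f))) k)
      (trans (coefficient-+ n f _ k)
        (trans (+-cong (sym (*-identityˡ _)) (natural i)) (sym (distribʳ _ _ _))))
  coefficient-ι n -[1+ i ] f k = trans
    (coefficient-cong n (I.sym n (Algebra.Properties.Ring.-‿distribˡ-* (I.ring n) (ι.ι n (+ suc i)) f)) k)
    (trans (coefficient-neg n _ k) (trans (-‿cong (coefficient-ι n (+ suc i) f k))
      (Algebra.Properties.Ring.-‿distribˡ-* F.ring _ _)))

  coefficient-≈0 : ∀ n f → (∀ k → coefficient n f k ≈ 0#) → I._≈_ n f (I.0# n)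
  coefficient-≈0 zero    f z = z Vec.[]
  coefficient-≈0 (suc n) f z = LaurentSeries.mk≈ λ j → coefficient-≈0 n _ (λ k → trans
    (F.reflexive (≡.sym (≡.cong₂ (λ a l → coefficient n (LaurentSeries.Laurent.coeff f a) l)
      (Vecₚ.last-∷ʳ j k) (Vecₚ.init-∷ʳ j k)))) (z (k Vec.∷ʳ j)))

  last-replicate : ∀ n (x : ℤ) → Vec.last (Vec.replicate (suc n) x) ≡ x
  last-replicate zero    x = ≡.refl
  last-replicate (suc n) x = last-replicate n x

  init-replicate : ∀ n (x : ℤ) → Vec.init (Vec.replicate (suc n) x) ≡ Vec.replicate n x
  init-replicate zero    x = ≡.refl
  init-replicate (suc n) x = ≡.cong (x Vec.∷_) (init-replicate n x)

  CT-suc : ∀ n (f : K⟪z⟫ (suc n)) → CT {suc n} f ≡ CT {n} (LaurentSeries.Laurent.coeff f (+ 0))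
  CT-suc n f = ≡.cong₂ (λ a l → coefficient n (LaurentSeries.Laurent.coeff f a) l)
    (last-replicate n (+ 0)) (init-replicate n (+ 0))

  -- θ n j = z_j ∂/∂z_j
  θ : ∀ n → Fin n → Derivations.Derivation (iterated n)
  θ (suc n) j with view j
  ... | ‵fromℕ     = LaurentDerivations.euler (iterated n)
  ... | ‵inject₁ i = LaurentDerivations.lift (iterated n) (θ n i)

  -- For the outermost variable the coefficient at exponent 0 is multiplied by 0; for an inner
  -- variable the derivation acts on that coefficient, and the claim descends to it.
  CT-θ : ∀ n j f → CT {n} (D (θ n j) f) ≈ 0#
  CT-θ (suc n) j f with view j
  ... | ‵fromℕ     = trans
    (F.reflexive (CT-suc n (D (LaurentDerivations.euler (iterated n)) f)))
    (trans (coefficient-cong n (I.zeroˡ n (LaurentSeries.Laurent.coeff f (+ 0))) _) (coefficient-0 n _))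
  ... | ‵inject₁ i = trans
    (F.reflexive (CT-suc n (D (LaurentDerivations.lift (iterated n) (θ n i)) f)))
    (CT-θ n i (LaurentSeries.Laurent.coeff f (+ 0)))

  θ-comm : ∀ n i j f → I._≈_ n (D (θ n i) (D (θ n j) f)) (D (θ n j) (D (θ n i) f))
  θ-comm (suc n) i j f with view i | view j
  ... | ‵fromℕ      | ‵fromℕ      = I.refl (suc n)
  ... | ‵fromℕ      | ‵inject₁ j′ =
    I.sym (suc n) (LaurentDerivations.lift-euler-comm (iterated n) (θ n j′) f)
  ... | ‵inject₁ i′ | ‵fromℕ      = LaurentDerivations.lift-euler-comm (iterated n) (θ n i′) f
  ... | ‵inject₁ i′ | ‵inject₁ j′ =
    LaurentDerivations.lift-comm (iterated n) {θ n i′} {θ n j′} (θ-comm n i′ j′) f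

  θ-z-diagonal : ∀ n i → I._≈_ n (D (θ n i) (z n i)) (z n i)
  θ-z-diagonal (suc n) i with view i
  ... | ‵fromℕ      = LaurentDerivations.euler-X (iterated n)
  ... | ‵inject₁ i′ = I.trans (suc n) (LaurentDerivations.lift-C (iterated n) (θ n i′) (z n i′))
    (LaurentSeries.C-cong (iterated n) (θ-z-diagonal n i′))

  θ-z-off : ∀ n {i j} → i ≢ j → I._≈_ n (D (θ n j) (z n i)) (I.0# n)
  θ-z-off (suc n) {i} {j} i≢j with view i | view j
  ... | ‵fromℕ      | ‵fromℕ      = ⊥-elim (i≢j ≡.refl)
  ... | ‵fromℕ      | ‵inject₁ j′ = LaurentDerivations.lift-X (iterated n) (θ n j′)
  ... | ‵inject₁ i′ | ‵fromℕ      = LaurentDerivations.euler-C (iterated n) (z n i′)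
  ... | ‵inject₁ i′ | ‵inject₁ j′ = I.trans (suc n)
    (LaurentDerivations.lift-C (iterated n) (θ n j′) (z n i′))
    (I.trans (suc n) (LaurentSeries.C-cong (iterated n) (θ-z-off n (i≢j ∘ ≡.cong inject₁)))
      (LaurentDerivations.C-0 (iterated n)))

  θ-z : ∀ n i j → I._≈_ n (D (θ n j) (z n i)) (I._*_ n (Matrices.δ (iterated n) i j) (z n i))
  θ-z n i j with i Finₚ.≟ j
  ... | yes ≡.refl = I.trans n (θ-z-diagonal n i) (I.sym n
    (I.trans n (I.*-congʳ n (Matrices.δ-diagonal (iterated n) i)) (I.*-identityˡ n _)))
  ... | no  i≢j    = I.trans n (θ-z-off n i≢j) (I.sym n
    (I.trans n (I.*-congʳ n (Matrices.δ-off (iterated n) i j i≢j)) (I.zeroˡ n _)))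

  ι-unit : (∀ k → k ≢ + 0 → Iterated.IsUnit 0 (ι.ι 0 k)) →
           ∀ n k → k ≢ + 0 → Iterated.IsUnit n (ι.ι n k)
  ι-unit unit zero    k k≢0 = unit k k≢0
  ι-unit unit (suc n) k k≢0 = Iterated.unit-resp (suc n) (LaurentDerivations.C-ι (iterated n) k)
    (LaurentSeries.C-unit (iterated n) _ (ι-unit unit n k k≢0))

  eulerDerivations : ∀ n → Exactness.EulerDerivations (iterated n) n
  eulerDerivations n = record
    { θ = θ n ; θ-comm = θ-comm n ; z = z n ; z-unit = z-unit n ; z-z-unit = z-z-unit n ; θ-z = θ-z n }

-- Exponent vectors and their comparison by tail sums.

module _ {A : Set} where

  -- New entries go to the end, since the last variable is the outermost one.
  snoc : ∀ {n} → (Fin n → A) → A → Fin (suc n) → A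
  snoc {zero}  d a i       = a
  snoc {suc n} d a zero    = d zero
  snoc {suc n} d a (suc i) = snoc (d ∘ suc) a i

  snoc-fromℕ : ∀ {n} (d : Fin n → A) a → snoc d a (fromℕ n) ≡ a
  snoc-fromℕ {zero}  d a = ≡.refl
  snoc-fromℕ {suc n} d a = snoc-fromℕ (d ∘ suc) a

  snoc-inject₁ : ∀ {n} (d : Fin n → A) a i → snoc d a (inject₁ i) ≡ d i
  snoc-inject₁ {suc n} d a zero    = ≡.refl
  snoc-inject₁ {suc n} d a (suc i) = snoc-inject₁ (d ∘ suc) a i

  lookup-fromℕ : ∀ {n} (k : Vec A (suc n)) → Vec.lookup k (fromℕ n) ≡ Vec.last k
  lookup-fromℕ (x Vec.∷ Vec.[])      = ≡.refl
  lookup-fromℕ (x Vec.∷ y Vec.∷ ys) = lookup-fromℕ (y Vec.∷ ys)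

  lookup-inject₁ : ∀ {n} (k : Vec A (suc n)) i → Vec.lookup k (inject₁ i) ≡ Vec.lookup (Vec.init k) i
  lookup-inject₁ (x Vec.∷ y Vec.∷ ys) zero    = ≡.refl
  lookup-inject₁ (x Vec.∷ y Vec.∷ ys) (suc i) = lookup-inject₁ (y Vec.∷ ys) i

-- Dominates s d e: for every i, the sum of e j - d j over j ≥ i is at least - s.
data Dominates : ∀ {n} → ℤ → (Fin n → ℤ) → (Fin n → ℤ) → Set where
  [] : ∀ {s d e} → Dominates {zero} s d e
  _∷_ : ∀ {n s d e} → let slack = s ℤ.+ (e (fromℕ n) ℤ.- d (fromℕ n)) in
        + 0 ℤ.≤ slack → Dominates slack (d ∘ inject₁) (e ∘ inject₁) → Dominates {suc n} s d e

RevLex : ∀ {n} → (Fin n → ℤ) → (Fin n → ℤ) → Set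
RevLex d e = ∃ λ i → d i ℤ.< e i × (∀ j → i Fin.< j → d j ≡ e j)

i<j⇒i-j<0 : ∀ {i j} → i ℤ.< j → i ℤ.- j ℤ.< + 0
i<j⇒i-j<0 {i} {j} i<j = ≡.subst (i ℤ.- j ℤ.<_) (ℤₚ.+-inverseʳ j) (ℤₚ.+-monoˡ-< (ℤ.- j) i<j)

inject₁<fromℕ : ∀ {n} (i : Fin n) → inject₁ i Fin.< fromℕ n
inject₁<fromℕ {n} i = ≡.subst₂ ℕ._<_ (≡.sym (Finₚ.toℕ-inject₁ i)) (≡.sym (Finₚ.toℕ-fromℕ n)) (Finₚ.toℕ<n i)

-- At the decisive coordinate `i` all later differences vanish, so the tail sum there is e i - d i
-- alone, which cannot be negative. The allowance is only propositionally 0, because it is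
-- recomputed at each coordinate.
dominates⇒≮ : ∀ {n} {s} {d e : Fin n → ℤ} → s ≡ + 0 → Dominates s d e → ¬ RevLex e d
dominates⇒≮ {suc n} {s} {d} {e} s≡0 (0≤slack ∷ dom) (i , eᵢ<dᵢ , above) with view i
... | ‵fromℕ     = ℤₚ.<⇒≱ eᵢ<dᵢ (ℤₚ.0≤i-j⇒j≤i (≡.subst (+ 0 ℤ.≤_)
  (≡.trans (≡.cong (ℤ._+ (e (fromℕ n) ℤ.- d (fromℕ n))) s≡0) (ℤₚ.+-identityˡ _)) 0≤slack))
... | ‵inject₁ j = dominates⇒≮
  (≡.cong₂ ℤ._+_ s≡0 (ℤₚ.i≡j⇒i-j≡0 (above (fromℕ n) (inject₁<fromℕ j)))) dom
  (j , eᵢ<dᵢ , λ k j<k → above (inject₁ k)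
    (≡.subst₂ ℕ._<_ (≡.sym (Finₚ.toℕ-inject₁ j)) (≡.sym (Finₚ.toℕ-inject₁ k)) j<k))

-- Initial terms and supports of iterated Laurent series.

module InitialTerms {ℓ} (K : HeytingField ℓ ℓ ℓ) where

  open SeriesOver K hiding (u; u-unit)
  open IteratedDerivations K
  private
    module F = CommutativeRing fieldRing
    module I (n : ℕ) = CommutativeRing (iterated n)
    module L (n : ℕ) = LaurentSeries (iterated n)
  open LaurentSeries using (Laurent)
  open LaurentSeries.Laurent using (coeff)
  open LaurentSeries._≈ᴸ_ using (coeff-≈)

  -- The allowance left for the inner coordinates once the outermost exponent is `k`.
  slack : ∀ {n} → ℤ → (Fin (suc n) → ℤ) → ℤ → ℤ
  slack {n} s d k = s ℤ.+ (k ℤ.- d (fromℕ n))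

  -- every exponent e in the support of f satisfies Dominates s d e
  data Bounded : ∀ n → ℤ → (Fin n → ℤ) → K⟪z⟫ n → Set ℓ where
    base : ∀ {s d f} → Bounded zero s d f
    step : ∀ {n s d} {f : K⟪z⟫ (suc n)} →
           (∀ k → slack s d k ℤ.< + 0 → I._≈_ n (coeff f k) (I.0# n)) →
           (∀ k → Bounded n (slack s d k) (d ∘ inject₁) (coeff f k)) →
           Bounded (suc n) s d f

  bounded-resp : ∀ {n s d f g} → I._≈_ n f g → Bounded n s d f → Bounded n s d g
  bounded-resp {n} e base = base
  bounded-resp {suc n} e (step v b) = step
    (λ k l → I.trans n (I.sym n (coeff-≈ e k)) (v k l)) (λ k → bounded-resp (coeff-≈ e k) (b k))

  bounded-exponent : ∀ {n s t d e f} → s ≡ t → d ≗ e → Bounded n s d f → Bounded n t e f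
  bounded-exponent s≡t d≗e base = base
  bounded-exponent {suc n} {s} {t} {d} {e} s≡t d≗e (step v b) = step
    (λ k l → v k (≡.subst (ℤ._< + 0) (≡.sym (eq k)) l))
    (λ k → bounded-exponent (eq k) (d≗e ∘ inject₁) (b k))
    where
    eq : ∀ k → slack s d k ≡ slack t e k
    eq k = ≡.cong₂ (λ s x → s ℤ.+ (k ℤ.- x)) s≡t (d≗e (fromℕ n))

  bounded-0 : ∀ {n s d} → Bounded n s d (I.0# n)
  bounded-0 {zero}  = base
  bounded-0 {suc n} = step (λ k _ → I.refl n) (λ k → bounded-0)

  bounded-+ : ∀ {n s d f g} → Bounded n s d f → Bounded n s d g → Bounded n s d (I._+_ n f g)
  bounded-+ base base = base
  bounded-+ {suc n} (step v b) (step w c) = step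
    (λ k l → I.trans n (I.+-cong n (v k l) (w k l)) (I.+-identityʳ n _)) (λ k → bounded-+ (b k) (c k))

  bounded-neg : ∀ {n s d f} → Bounded n s d f → Bounded n s d (I.-_ n f)
  bounded-neg base = base
  bounded-neg {suc n} (step v b) = step
    (λ k l → I.trans n (I.-‿cong n (v k l)) (Algebra.Properties.Ring.-0#≈0# (I.ring n)))
    (λ k → bounded-neg (b k))

  bounded-sum : ∀ {n s d N} (h : Fin N → K⟪z⟫ n) → (∀ i → Bounded n s d (h i)) →
                Bounded n s d (Algebra.Definitions.RawMonoid.sum (I.+-rawMonoid n) h)
  bounded-sum {N = zero}  h b = bounded-0
  bounded-sum {N = suc N} h b = bounded-+ (b zero) (bounded-sum (h ∘ suc) (b ∘ suc))

  -- In the term f_i g_(k-i) the two slacks add up to the slack of `k` in the product. If that is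
  -- negative, one of the two is, and its factor vanishes.
  bounded-* : ∀ {n s t d e f g} → Bounded n s d f → Bounded n t e g →
              Bounded n (s ℤ.+ t) (λ i → d i ℤ.+ e i) (I._*_ n f g)
  bounded-* base base = base
  bounded-* {suc n} {s} {t} {d} {e} {f} {g} (step v b) (step w c) = step
    (λ k l → L.sum-zero n (L.length n (k ℤ.- Laurent.low f ℤ.- Laurent.low g ℤ.+ + 1))
      (λ i → term≈0 k (Laurent.low f ℤ.+ + toℕ i) l))
    (λ k → bounded-sum {N = L.length n (k ℤ.- Laurent.low f ℤ.- Laurent.low g ℤ.+ + 1)}
      (λ i → L.term n f g k (Laurent.low f ℤ.+ + toℕ i))
      (λ i → bounded-exponent (eq s t k (Laurent.low f ℤ.+ + toℕ i) (d (fromℕ n)) (e (fromℕ n)))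
        (λ _ → ≡.refl)
        (bounded-* (b (Laurent.low f ℤ.+ + toℕ i)) (c (k ℤ.- (Laurent.low f ℤ.+ + toℕ i))))))
    where
    eq : ∀ s t k i d e → (s ℤ.+ (i ℤ.- d)) ℤ.+ (t ℤ.+ (k ℤ.- i ℤ.- e)) ≡ (s ℤ.+ t) ℤ.+ (k ℤ.- (d ℤ.+ e))
    eq = solve-∀
    term≈0 : ∀ k i → slack (s ℤ.+ t) (λ i → d i ℤ.+ e i) k ℤ.< + 0 → I._≈_ n (L.term n f g k i) (I.0# n)
    term≈0 k i l with slack s d i ℤₚ.<? + 0
    ... | yes l₁ = I.trans n (I.*-congʳ n (v i l₁)) (I.zeroˡ n _)
    ... | no  l₁ with slack t e (k ℤ.- i) ℤₚ.<? + 0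
    ...   | yes l₂ = I.trans n (I.*-congˡ n (w (k ℤ.- i) l₂)) (I.zeroʳ n _)
    ...   | no  l₂ = ⊥-elim (ℤₚ.<⇒≱ l (≡.subst (+ 0 ℤ.≤_) (eq s t k i (d (fromℕ n)) (e (fromℕ n)))
      (ℤₚ.+-mono-≤ (ℤₚ.≮⇒≥ l₁) (ℤₚ.≮⇒≥ l₂))))

  -- `coefficient` for exponents given as functions, the form used by `Dominates` and `Bounded`.
  at : ∀ n → (Fin n → ℤ) → K⟪z⟫ n → F.Carrier
  at zero    d f = f
  at (suc n) d f = at n (d ∘ inject₁) (coeff f (d (fromℕ n)))

  at-cong : ∀ n d {f g} → I._≈_ n f g → at n d f F.≈ at n d g
  at-cong zero    d e = e
  at-cong (suc n) d e = at-cong n (d ∘ inject₁) (coeff-≈ e (d (fromℕ n)))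

  at-exponent : ∀ n {d e} f → d ≗ e → at n d f ≡ at n e f
  at-exponent zero    f d≗e = ≡.refl
  at-exponent (suc n) {d} f d≗e = ≡.trans (at-exponent n _ (d≗e ∘ inject₁))
    (≡.cong (λ k → at n _ (coeff f k)) (d≗e (fromℕ n)))

  at-0 : ∀ n d → at n d (I.0# n) F.≈ F.0#
  at-0 zero    d = F.refl
  at-0 (suc n) d = at-0 n (d ∘ inject₁)

  coefficient≡at : ∀ n f k → coefficient n f k ≡ at n (Vec.lookup k) f
  coefficient≡at zero    f k = ≡.refl
  coefficient≡at (suc n) f k = ≡.trans (coefficient≡at n _ (Vec.init k)) (≡.trans
    (at-exponent n _ (λ i → ≡.sym (lookup-inject₁ k i)))
    (≡.cong (λ j → at n (Vec.lookup k ∘ inject₁) (coeff f j)) (≡.sym (lookup-fromℕ k))))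

  bounded⇒dominates : ∀ {n s d f} → Bounded n s d f → ∀ e → ¬ at n e f F.≈ F.0# → Dominates s d e
  bounded⇒dominates base e _ = []
  bounded⇒dominates {suc n} (step v b) e ≉0 =
    ℤₚ.≮⇒≥ (λ l → ≉0 (F.trans (at-cong n (e ∘ inject₁) (v (e (fromℕ n)) l)) (at-0 n (e ∘ inject₁))))
    ∷ bounded⇒dominates (b (e (fromℕ n))) (e ∘ inject₁) ≉0

  -- With allowance 0 only the term with outermost exponents d′ and e′ survives: a smaller exponent
  -- in `f` is excluded by its bound, a larger one forces an exponent below e′ in `g`. The inner
  -- allowances are 0 again.
  at-* : ∀ {n s t d e f g} → s ≡ + 0 → t ≡ + 0 → Bounded n s d f → Bounded n t e g →
         at n (λ i → d i ℤ.+ e i) (I._*_ n f g) F.≈ at n d f F.* at n e g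
  at-* s≡0 t≡0 base base = F.refl
  at-* {suc n} {d = d} {e} {f} {g} ≡.refl ≡.refl (step v b) (step w c) = F.trans
    (at-cong n _ (I.trans n
      (L.sum-unique n (L.*-sum n f g (d′ ℤ.+ e′)) (L.single-sum n d′ off))
      (I.*-congˡ n (I.reflexive n (≡.cong (coeff g) (lem d′ e′))))))
    (at-* (lem₂ d′) (lem₂ e′) (b d′) (c e′))
    where
    d′ e′ : ℤ
    d′ = d (fromℕ n)
    e′ = e (fromℕ n)
    lem : ∀ d e → d ℤ.+ e ℤ.- d ≡ e
    lem = solve-∀
    lem₂ : ∀ d → + 0 ℤ.+ (d ℤ.- d) ≡ + 0
    lem₂ = solve-∀
    lem₃ : ∀ d e i → d ℤ.- i ≡ + 0 ℤ.+ (d ℤ.+ e ℤ.- i ℤ.- e)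
    lem₃ = solve-∀
    off : ∀ i → i ≢ d′ → I._≈_ n (L.term n f g (d′ ℤ.+ e′) i) (I.0# n)
    off i i≢d with i ℤₚ.<? d′
    ... | yes i<d = I.trans n (I.*-congʳ n (v i
      (≡.subst (ℤ._< + 0) (≡.sym (ℤₚ.+-identityˡ _)) (i<j⇒i-j<0 i<d)))) (I.zeroˡ n _)
    ... | no  i≮d = I.trans n (I.*-congˡ n (w (d′ ℤ.+ e′ ℤ.- i)
      (≡.subst (ℤ._< + 0) (lem₃ d′ e′ i) (i<j⇒i-j<0 (ℤₚ.≤∧≢⇒< (ℤₚ.≮⇒≥ i≮d) (i≢d ∘ ≡.sym)))))) (I.zeroʳ n _)

  bounded-single : ∀ {n s d} a {x} → (∀ k → k ≡ a →
                    + 0 ℤ.≤ slack s d k × Bounded n (slack s d k) (d ∘ inject₁) x) →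
                   Bounded (suc n) s d (L.single n a x)
  bounded-single {n} {s} {d} a {x} h = step v b
    where
    v : ∀ k → slack s d k ℤ.< + 0 → I._≈_ n (coeff (L.single n a x) k) (I.0# n)
    v k l with k ℤₚ.≟ a
    ... | yes k≡a = ⊥-elim (ℤₚ.<⇒≱ l (proj₁ (h k k≡a)))
    ... | no  _   = I.refl n
    b : ∀ k → Bounded n (slack s d k) (d ∘ inject₁) (coeff (L.single n a x) k)
    b k with k ℤₚ.≟ a
    ... | yes k≡a = proj₂ (h k k≡a)
    ... | no  _   = bounded-0

  bounded-single-snoc : ∀ {n s d} a b {x} → + 0 ℤ.≤ s ℤ.+ (a ℤ.- b) → Bounded n (s ℤ.+ (a ℤ.- b)) d x →
                        Bounded (suc n) s (snoc d b) (L.single n a x)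
  bounded-single-snoc {n} {s} {d} a b 0≤ x = bounded-single a λ { k ≡.refl →
    ≡.subst (+ 0 ℤ.≤_) eq 0≤ , bounded-exponent eq (λ i → ≡.sym (snoc-inject₁ d b i)) x }
    where
    eq : s ℤ.+ (a ℤ.- b) ≡ slack s (snoc d b) a
    eq = ≡.cong (λ b → s ℤ.+ (a ℤ.- b)) (≡.sym (snoc-fromℕ d b))

  bounded-1 : ∀ {n} → Bounded n (+ 0) (λ _ → + 0) (I.1# n)
  bounded-1 {zero}  = base
  bounded-1 {suc n} = bounded-single (+ 0) λ { k ≡.refl → ℤₚ.≤-refl , bounded-1 }

  at-1 : ∀ n → at n (λ _ → + 0) (I.1# n) F.≈ F.1#
  at-1 zero    = F.refl
  at-1 (suc n) = at-1 n

  -- The coefficient of f at d is invertible, as d and - d add up to the exponent of 1.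
  record HasInitial n (d : Fin n → ℤ) (f : K⟪z⟫ n) : Set ℓ where
    field
      unit            : Iterated.IsUnit n f
      bounded         : Bounded n (+ 0) d f
      inverse-bounded : Bounded n (+ 0) (λ i → ℤ.- d i) (RingNotation.IsUnit.inverse unit)

  open HasInitial

  at-initial≉0 : ¬ F.1# F.≈ F.0# → ∀ {n d f} → HasInitial n d f → ¬ at n d f F.≈ F.0#
  at-initial≉0 1≉0 {n} {d} {f} i ≈0 = 1≉0 (begin
    F.1#                                         ≈⟨ at-1 n ⟨
    at n (λ _ → + 0) (I.1# n)                    ≡⟨ at-exponent n (I.1# n) (λ j → ≡.sym (ℤₚ.+-inverseʳ (d j))) ⟩
    at n (λ j → d j ℤ.+ ℤ.- d j) (I.1# n)        ≈⟨ at-cong n _ (RingNotation.IsUnit.x*inverse (unit i)) ⟨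
    at n (λ j → d j ℤ.+ ℤ.- d j) (I._*_ n f f⁻¹) ≈⟨ at-* ≡.refl ≡.refl (bounded i) (inverse-bounded i) ⟩
    at n d f F.* at n (λ j → ℤ.- d j) f⁻¹        ≈⟨ F.*-congʳ ≈0 ⟩
    F.0# F.* at n (λ j → ℤ.- d j) f⁻¹            ≈⟨ F.zeroˡ _ ⟩
    F.0#                                         ∎)
    where
    open import Relation.Binary.Reasoning.Setoid F.setoid
    f⁻¹ = RingNotation.IsUnit.inverse (unit i)

  initial-resp : ∀ {n d f g} → I._≈_ n f g → HasInitial n d f → HasInitial n d g
  initial-resp {n} e i = record
    { unit            = Iterated.unit-resp n e (unit i)
    ; bounded         = bounded-resp e (bounded i)
    ; inverse-bounded = inverse-bounded i
    }

  initial-exponent : ∀ {n d e f} → d ≗ e → HasInitial n d f → HasInitial n e f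
  initial-exponent d≗e i = record
    { unit            = unit i
    ; bounded         = bounded-exponent ≡.refl d≗e (bounded i)
    ; inverse-bounded = bounded-exponent ≡.refl (≡.cong ℤ.-_ ∘ d≗e) (inverse-bounded i)
    }

  initial-* : ∀ {n d e f g} → HasInitial n d f → HasInitial n e g →
              HasInitial n (λ i → d i ℤ.+ e i) (I._*_ n f g)
  initial-* {n} {d} {e} i j = record
    { unit            = Iterated.*-unit n (unit i) (unit j)
    ; bounded         = bounded-* (bounded i) (bounded j)
    ; inverse-bounded = bounded-exponent ≡.refl (λ k → ≡.sym (ℤₚ.neg-distrib-+ (d k) (e k)))
        (bounded-* (inverse-bounded i) (inverse-bounded j))
    }

  -- The inverse supplied by `p` need not be syntactically the one for which a bound is known;
  -- uniqueness of inverses transfers the bound.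
  initial-inverse : ∀ {n d f} → HasInitial n d f → (p : Iterated.IsUnit n f) →
                    HasInitial n (λ i → ℤ.- d i) (RingNotation.IsUnit.inverse p)
  initial-inverse {n} {d} {f} i (RingNotation.isUnit g fg≈1) = record
    { unit            = RingNotation.isUnit f (I.trans n (I.*-comm n g f) fg≈1)
    ; bounded         = bounded-resp (Derivations.unit-cancel (iterated n) (unit i)
        (I.trans n (I.*-comm n f⁻¹ f) (I.trans n (RingNotation.IsUnit.x*inverse (unit i))
          (I.trans n (I.sym n fg≈1) (I.*-comm n f g))))) (inverse-bounded i)
    ; inverse-bounded = bounded-exponent ≡.refl (λ j → ≡.sym (ℤₚ.neg-involutive (d j))) (bounded i)
    }
    where f⁻¹ = RingNotation.IsUnit.inverse (unit i)

  initial-1 : ∀ {n} → HasInitial n (λ _ → + 0) (I.1# n)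
  initial-1 {n} = record { unit = Iterated.1-unit n ; bounded = bounded-1 ; inverse-bounded = bounded-1 }

  initial--1 : ∀ {n} → HasInitial n (λ _ → + 0) (I.-_ n (I.1# n))
  initial--1 {n} = record
    { unit = Iterated.-1-unit n ; bounded = bounded-neg bounded-1 ; inverse-bounded = bounded-neg bounded-1 }

  initial-^ : ∀ {n d f} → HasInitial n d f → ∀ k → HasInitial n (λ i → + k ℤ.* d i) (Iterated._^_ n f k)
  initial-^ {d = d} i zero    = initial-exponent (λ j → ≡.sym (ℤₚ.*-zeroˡ (d j))) initial-1
  initial-^ {d = d} i (suc k) = initial-exponent (λ j → ≡.sym (ℤₚ.suc-* (+ k) (d j)))
    (initial-* i (initial-^ i k))

  initial-power : ∀ {n d f} → HasInitial n d f → (p : Iterated.IsUnit n f) → ∀ k →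
                  HasInitial n (λ i → k ℤ.* d i) (Iterated.power n f p k)
  initial-power i p (+ k) = initial-^ i k
  initial-power {d = d} i p -[1+ k ] = initial-exponent
    (λ j → ≡.trans (≡.sym (ℤₚ.neg-distribʳ-* (+ suc k) (d j))) (ℤₚ.neg-distribˡ-* (+ suc k) (d j)))
    (initial-^ (initial-inverse i p) (suc k))

  initial-product : ∀ {n N} (d : Fin N → Fin n → ℤ) (f : Fin N → K⟪z⟫ n) → (∀ i → HasInitial n (d i) (f i)) →
                    HasInitial n (λ j → Algebra.Definitions.RawMonoid.sum ℤ.+-0-rawMonoid (λ i → d i j))
                                 (Iterated.product n f)
  initial-product {N = zero}  d f h = initial-1
  initial-product {N = suc N} d f h = initial-* (h zero) (initial-product (d ∘ suc) (f ∘ suc) (h ∘ suc))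

  -- The exponent is left existential; for the series u_i, `initial-u-b` identifies it with the
  -- given one.
  initial-Δ : ∀ {n N} (y : Fin N → K⟪z⟫ n) →
              (∀ {a b} → a Fin.< b → ∃ λ d → HasInitial n d (I._-_ n (y a) (y b))) →
              ∃ λ d → HasInitial n d (Iterated.Δ n y)
  initial-Δ {N = zero}  y h = _ , initial-1
  initial-Δ {N = suc N} y h = _ , initial-*
    (initial-product (λ b → proj₁ (h {zero} {suc b} (s≤s z≤n))) _ (λ b → proj₂ (h {zero} {suc b} (s≤s z≤n))))
    (proj₂ (initial-Δ (y ∘ suc) (λ a<b → h (s≤s a<b))))

  initial-C : ∀ {n d f} → HasInitial n d f → HasInitial (suc n) (snoc d (+ 0)) (L.C n f)
  initial-C {n} {d} {f} i = record
    { unit            = L.C-unit n f (unit i)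
    ; bounded         = bounded-single-snoc (+ 0) (+ 0) ℤₚ.≤-refl (bounded i)
    ; inverse-bounded = bounded-exponent ≡.refl (snoc-neg d)
        (bounded-single-snoc (+ 0) (+ 0) ℤₚ.≤-refl (inverse-bounded i))
    }
    where
    snoc-neg : ∀ {n} (d : Fin n → ℤ) i → snoc (λ i → ℤ.- d i) (+ 0) i ≡ ℤ.- snoc d (+ 0) i
    snoc-neg {zero}  d i       = ≡.refl
    snoc-neg {suc n} d zero    = ≡.refl
    snoc-neg {suc n} d (suc i) = snoc-neg (d ∘ suc) i

  initial-X : ∀ {n} → HasInitial (suc n) (snoc (λ _ → + 0) (+ 1)) (L.X n)
  initial-X {n} = record
    { unit            = L.X-unit n
    ; bounded         = bounded-single-snoc (+ 1) (+ 1) ℤₚ.≤-refl bounded-1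
    ; inverse-bounded = bounded-exponent ≡.refl (snoc-neg n)
        (bounded-single-snoc -[1+ 0 ] -[1+ 0 ] ℤₚ.≤-refl bounded-1)
    }
    where
    snoc-neg : ∀ n (i : Fin (suc n)) → snoc {n = n} (λ _ → + 0) -[1+ 0 ] i ≡ ℤ.- snoc {n = n} (λ _ → + 0) (+ 1) i
    snoc-neg zero    i       = ≡.refl
    snoc-neg (suc n) zero    = ≡.refl
    snoc-neg (suc n) (suc i) = snoc-neg n i

  zExponent : ∀ n → Fin n → Fin n → ℤ
  zExponent (suc n) i with view i
  ... | ‵fromℕ     = snoc (λ _ → + 0) (+ 1)
  ... | ‵inject₁ j = snoc (zExponent n j) (+ 0)

  initial-z : ∀ n i → HasInitial n (zExponent n i) (z n i)
  initial-z (suc n) i with view i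
  ... | ‵fromℕ     = initial-X
  ... | ‵inject₁ j = initial-C (initial-z n j)

  -- The exponent 0 falls short of that of z_i by one in a single coordinate, which an allowance of
  -- 1 covers.
  bounded-1-z : ∀ n i → Bounded n (+ 1) (zExponent n i) (I.1# n)
  bounded-1-z (suc n) i with view i
  ... | ‵fromℕ     = bounded-single-snoc (+ 0) (+ 1) ℤₚ.≤-refl bounded-1
  ... | ‵inject₁ j = bounded-single-snoc (+ 0) (+ 0) (ℤ.+≤+ z≤n) (bounded-1-z n j)

  -- The inverse is the geometric series of the z_i^(-k-1) X^k. Relative to z_i^(-1), the factor X^k
  -- adds k to the last coordinate, and this pays for the k further factors z_i^(-1).
  initial-C-X : ∀ n i → HasInitial (suc n) (snoc (zExponent n i) (+ 0)) (I._-_ (suc n) (L.C n (z n i)) (L.X n))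
  initial-C-X n i = record
    { unit            = L.C-X-unit n (z n i) (unit zᵢ)
    ; bounded         = bounded-+ (bounded (initial-C zᵢ))
        (bounded-neg (bounded-single-snoc (+ 1) (+ 0) (ℤ.+≤+ z≤n) (bounded-1-z n i)))
    ; inverse-bounded = step vanish bound
    }
    where
    d : Fin n → ℤ
    d = zExponent n i
    zᵢ : HasInitial n d (z n i)
    zᵢ = initial-z n i
    y : K⟪z⟫ n
    y = RingNotation.IsUnit.inverse (unit zᵢ)
    y-bounded : Bounded n (+ 1) (λ _ → + 0) y
    -- The factor 1, bounded relative to `d` with allowance 1, shifts the bound of `y` from - d to
    -- 0.
    y-bounded = bounded-resp (I.*-identityˡ n y) (bounded-exponent ≡.refl (λ j → ℤₚ.+-inverseʳ (d j))
      (bounded-* (bounded-1-z n i) (inverse-bounded zᵢ)))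
    y^-bounded : ∀ k → Bounded n (+ k) (λ _ → + 0) (Iterated._^_ n y k)
    y^-bounded zero    = bounded-1
    y^-bounded (suc k) = bounded-* y-bounded (y^-bounded k)
    slack≡ : ∀ k → slack (+ 0) (λ j → ℤ.- snoc d (+ 0) j) k ≡ k
    slack≡ k = ≡.trans (ℤₚ.+-identityˡ _) (≡.trans
      (≡.cong (λ b → k ℤ.- (ℤ.- b)) (snoc-fromℕ d (+ 0))) (ℤₚ.+-identityʳ k))
    vanish : ∀ k → slack (+ 0) (λ j → ℤ.- snoc d (+ 0) j) k ℤ.< + 0 →
             I._≈_ n (coeff (RingNotation.IsUnit.inverse (L.C-X-unit n (z n i) (unit zᵢ))) k) (I.0# n)
    vanish (+ k)    l = ⊥-elim (ℤₚ.<⇒≱ l (≡.subst (+ 0 ℤ.≤_) (≡.sym (slack≡ (+ k))) (ℤ.+≤+ z≤n)))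
    vanish -[1+ k ] l = I.refl n
    bound : ∀ k → Bounded n (slack (+ 0) (λ j → ℤ.- snoc d (+ 0) j) k) (λ j → ℤ.- snoc d (+ 0) (inject₁ j))
                    (coeff (RingNotation.IsUnit.inverse (L.C-X-unit n (z n i) (unit zᵢ))) k)
    bound -[1+ k ] = bounded-0
    bound (+ k)    = bounded-exponent
      (≡.trans (ℤₚ.+-identityˡ _) (≡.sym (slack≡ (+ k))))
      (λ j → ≡.trans (ℤₚ.+-identityʳ _) (≡.cong ℤ.-_ (≡.sym (snoc-inject₁ d (+ 0) j))))
      (bounded-* (inverse-bounded zᵢ) (y^-bounded k))

  initial-z-z : ∀ n {i j} → i Fin.< j → ∃ λ d → HasInitial n d (I._-_ n (z n i) (z n j))
  initial-z-z (suc n) {i} {j} i<j with view i | view j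
  ... | ‵fromℕ | ‵fromℕ = ⊥-elim (ℕₚ.<-irrefl ≡.refl i<j)
  ... | ‵fromℕ | ‵inject₁ j′ = ⊥-elim (ℕₚ.<-asym i<j (inject₁<fromℕ j′))
  ... | ‵inject₁ i′ | ‵fromℕ = _ , initial-C-X n i′
  ... | ‵inject₁ i′ | ‵inject₁ j′ = _ , initial-resp (L.C-‿- n (z n i′) (z n j′))
    (initial-C (proj₂ (initial-z-z n
      (≡.subst₂ ℕ._<_ (Finₚ.toℕ-inject₁ i′) (Finₚ.toℕ-inject₁ j′) i<j))))

  initial-alternant : ∀ n {k} (E : Exactness.EulerDerivations (iterated n) (suc k)) →
    let open Exactness.EulerDerivations E using () renaming (z to y) in
    (∀ j → ∃ λ d → HasInitial n d (y j)) →
    (∀ {i j} → i Fin.< j → ∃ λ d → HasInitial n d (I._-_ n (y i) (y j))) →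
    ∀ r j → ∃ λ d → HasInitial n d (Exactness.alternant (iterated n) E r j)
  initial-alternant n E y-initial y-y-initial r j = _ , initial-*
    (initial-* (initial-^ initial--1 (toℕ j)) (initial-power (proj₂ (y-initial j)) (y-unit j) r))
    (proj₂ (initial-Δ (removeAt y j) (λ {a} {b} a<b → y-y-initial (punchIn-< a b a<b))))
    where
    open Exactness.EulerDerivations E using () renaming (z to y; z-unit to y-unit)
    punchIn-< : ∀ a b → a Fin.< b → Fin.punchIn j a Fin.< Fin.punchIn j b
    punchIn-< a b a<b = ℕₚ.≰⇒> (λ le → ℕₚ.<⇒≱ a<b (Finₚ.punchIn-cancel-≤ j b a le))

  initial-u : ∀ {m} r j → ∃ λ d → HasInitial (suc m) d (SeriesOver.u K {m} r j)
  initial-u {m} r j = _ , initial-resp {suc m}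
    {f = Exactness.alternant (iterated (suc m)) (eulerDerivations (suc m)) r j}
    -- `alternant` at these derivations has the same definition as `u`, so reflexivity suffices at
    -- each coefficient.
    (LaurentSeries.mk≈ λ k → I.refl m)
    (proj₂ (initial-alternant (suc m) (eulerDerivations (suc m)) (z-initial (suc m)) (z-z-initial (suc m)) r j))
    where
    module E n = Exactness.EulerDerivations (eulerDerivations n)
    z-initial : ∀ n j → ∃ λ d → HasInitial n d (E.z n j)
    z-initial n j = _ , initial-z n j
    z-z-initial : ∀ n {i j} → i Fin.< j → ∃ λ d → HasInitial n d (I._-_ n (E.z n i) (E.z n j))
    z-z-initial n i<j = initial-z-z n i<j

  u-exact : (∀ k → k ≢ + 0 → Iterated.IsUnit 0 (IntegerMultiples.ι fieldRing k)) →
            ∀ m r → (∀ i → i ℕ.< m → r ≢ + i) → r ≢ ℤ.- (+ (m choose 2)) →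
            Exactness.IsExact (iterated (suc m)) (eulerDerivations (suc m))
              (SeriesOver.u K {m} r) (SeriesOver.u-unit K r)
  u-exact unit m r = Exactness.Jacobian.exact (iterated (suc m)) m (eulerDerivations (suc m))
    (ι-unit unit (suc m)) (SeriesOver.u K r) (SeriesOver.u-unit K r) r
    (λ j → LaurentSeries.mk≈ λ k → I.refl m)

-- Well-ordered families of exponents and summability.

dominates-cong : ∀ {n s t} {d e e′ : Fin n → ℤ} → s ≡ t → e ≗ e′ → Dominates s d e → Dominates t d e′
dominates-cong s≡t e≗e′ [] = []
dominates-cong {suc n} {s} {t} {d} {e} {e′} s≡t e≗e′ (p ∷ dom) =
  ≡.subst (+ 0 ℤ.≤_) eq p ∷ dominates-cong eq (e≗e′ ∘ inject₁) dom
  where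
  eq : s ℤ.+ (e (fromℕ n) ℤ.- d (fromℕ n)) ≡ t ℤ.+ (e′ (fromℕ n) ℤ.- d (fromℕ n))
  eq = ≡.cong₂ (λ s x → s ℤ.+ (x ℤ.- d (fromℕ n))) s≡t (e≗e′ (fromℕ n))

interval : ∀ low high → ∃ λ N → ∀ v → v ℤ.≤ high → v ℤ.< low ℤ.+ + N
-- The absolute value keeps the length a natural number; for high < low the interval is merely
-- longer than necessary.
interval low high = suc ℤ.∣ high ℤ.- low ∣ , λ v v≤high → ℤₚ.≤-<-trans v≤high
  (≡.subst (ℤ._< low ℤ.+ + suc ℤ.∣ high ℤ.- low ∣) (lem low high)
    (ℤₚ.+-monoʳ-< low (ℤₚ.≤-<-trans (i≤∣i∣ (high ℤ.- low)) (ℤ.+<+ ℕₚ.≤-refl))))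
  where
  lem : ∀ a b → a ℤ.+ (b ℤ.- a) ≡ b
  lem = solve-∀
  i≤∣i∣ : ∀ i → i ℤ.≤ + ℤ.∣ i ∣
  i≤∣i∣ (+ n)    = ℤₚ.≤-refl
  i≤∣i∣ -[1+ n ] = ℤ.-≤+

module _ {ℓ} {A : Set} (X : (A → Set ℓ) → Set ℓ)
  (X-mono : ∀ {P Q} → (∀ a → Q a → P a) → X P → X Q)
  (X-∅ : X (λ _ → ⊥)) (X-∪ : ∀ {P Q} → X P → X Q → X (λ a → P a ⊎ Q a))
  where

  -- `X` is instantiated twice: with finiteness of sets of indices, and with realizability as the
  -- support of a series.
  interval-∪ : (S : ℤ → A → Set ℓ) → (∀ v → X (S v)) → ∀ low N →
               X (λ a → ∃ λ v → low ℤ.≤ v × v ℤ.< low ℤ.+ + N × S v a)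
  interval-∪ S x low zero    = X-mono
    (λ { a (v , low≤v , v<low , _) → ⊥-elim (ℤₚ.<⇒≱ (≡.subst (v ℤ.<_) (ℤₚ.+-identityʳ low) v<low) low≤v) }) X-∅
  interval-∪ S x low (suc N) = X-mono split (X-∪ (interval-∪ S x low N) (x (low ℤ.+ + N)))
    where
    lem : ∀ low n → low ℤ.+ (+ 1 ℤ.+ n) ≡ + 1 ℤ.+ (low ℤ.+ n)
    lem = solve-∀
    split : ∀ a → (∃ λ v → low ℤ.≤ v × v ℤ.< low ℤ.+ + suc N × S v a) →
            (∃ λ v → low ℤ.≤ v × v ℤ.< low ℤ.+ + N × S v a) ⊎ S (low ℤ.+ + N) a
    split a (v , low≤v , v< , s) with v ℤₚ.≟ low ℤ.+ + N
    ... | yes ≡.refl = inj₂ s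
    ... | no  v≢     = inj₁ (v , low≤v , ℤₚ.≤∧≢⇒< v≤ v≢ , s)
      where
      v≤ : v ℤ.≤ low ℤ.+ + N
      v≤ = ℤₚ.≮⇒≥ (λ l → ℤₚ.<⇒≱ v< (≡.subst (ℤ._≤ v) (≡.sym (lem low (+ N))) (ℤₚ.i<j⇒suc[i]≤j l)))

module Summability {ℓ} (em : ExcludedMiddle ℓ) where

  WellOrdered : ∀ {n} {I : Set} → (I → Set ℓ) → (I → Fin n → ℤ) → Set ℓ
  WellOrdered P w = WellFounded {A = ∃ P} (RevLex on w ∘ proj₁)

  -- Descend along accessibility until excluded middle reports that nothing smaller is left.
  minimal : ∀ {n} {I : Set} {P : I → Set ℓ} (w : I → Fin n → ℤ) {a : ∃ P} →
            Acc (RevLex on w ∘ proj₁) a →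
            ∃ λ (c : ∃ P) → ∀ i → P i → ¬ RevLex (w i) (w (proj₁ c))
  minimal {P = P} w {a} (acc smaller) with em {∃ λ (i : ∃ P) → RevLex (w (proj₁ i)) (w (proj₁ a))}
  ... | yes (i , i<a) = minimal w {i} (smaller i<a)
  ... | no  none      = a , λ i p i<a → none ((i , p) , i<a)

  -- The last coordinate of w is bounded below on P, and so it is, recursively, on all the
  -- sets on which the last coordinate is constant.
  BoundedBelow : ∀ n {I : Set} → (I → Set ℓ) → (I → Fin n → ℤ) → Set ℓ
  BoundedBelow zero    P w = ⊤
  BoundedBelow (suc n) P w = (∃ λ low → ∀ i → P i → low ℤ.≤ w i (fromℕ n)) ×
    (∀ v → BoundedBelow n (λ i → P i × w i (fromℕ n) ≡ v) (λ i → w i ∘ inject₁))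

  -- The last coordinate is the most significant one, so a minimal element has the least last
  -- coordinate. On a slice where it is constant, the order of the remaining coordinates embeds into
  -- the given order, hence is well-founded too.
  wellOrdered⇒boundedBelow : ∀ {n} {I : Set} (P : I → Set ℓ) w → WellOrdered {n} P w → BoundedBelow n P w
  wellOrdered⇒boundedBelow {zero}  P w wo = tt
  wellOrdered⇒boundedBelow {suc n} P w wo = below ,
    λ v → wellOrdered⇒boundedBelow (λ i → P i × w i (fromℕ n) ≡ v) (λ i → w i ∘ inject₁)
      (Subrelation.wellFounded (λ {i} {j} → extend {v} {i} {j})
        (On.wellFounded (λ { (i , p , _) → i , p }) wo))
    where
    below : ∃ λ low → ∀ i → P i → low ℤ.≤ w i (fromℕ n)
    below with em {∃ P}
    ... | no  ∄ = + 0 , λ i p → ⊥-elim (∄ (i , p))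
    ... | yes a = let (c , _) , least = minimal w (wo a) in
      w c (fromℕ n) , λ i p → ℤₚ.≮⇒≥ (λ wi<wc → least i p
        (fromℕ n , wi<wc , λ j n<j → ⊥-elim (ℕₚ.<⇒≱ n<j (Finₚ.≤fromℕ j))))
    extend : ∀ {v} {i j : ∃ λ i → P i × w i (fromℕ n) ≡ v} →
             RevLex (w (proj₁ i) ∘ inject₁) (w (proj₁ j) ∘ inject₁) → RevLex (w (proj₁ i)) (w (proj₁ j))
    extend {v} {i , _ , wi≡v} {j , _ , wj≡v} (t , wi<wj , above) = inject₁ t , wi<wj , above′
      where
      above′ : ∀ s → inject₁ t Fin.< s → w i s ≡ w j s
      above′ s t<s with view s
      ... | ‵fromℕ      = ≡.trans wi≡v (≡.sym wj≡v)
      ... | ‵inject₁ s′ = above s′ (≡.subst₂ ℕ._<_ (Finₚ.toℕ-inject₁ t) (Finₚ.toℕ-inject₁ s′) t<s)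

  Finite : ∀ {I : Set} → (I → Set ℓ) → Set ℓ
  Finite {I} P = Σ (List I) λ ks → ∀ i → P i → i ∈ ks

  -- Domination bounds the last coordinate of `w i` above by s + l_n, and `low` bounds it below. So
  -- it takes finitely many values, and each slice is finite by induction. Without coordinates left,
  -- injectivity admits at most one index.
  dominated-finite : ∀ {n} {I : Set} (P : I → Set ℓ) w → BoundedBelow n P w →
                     (∀ {i j} → P i → P j → w i ≗ w j → i ≡ j) → ∀ s l →
                     Finite (λ i → P i × Dominates s (w i) l)
  dominated-finite {zero}  P w _ injective s l with em {∃ P}
  ... | no  ∄       = List.[] , λ i (p , _) → ⊥-elim (∄ (i , p))
  ... | yes (a , q) = List.[ a ] , λ i (p , _) → here (injective p q (λ ()))
  dominated-finite {suc n} {I} P w ((low , low≤) , slices) injective s l =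
    let N , bound = interval low (s ℤ.+ l (fromℕ n)) in
    mono (λ { i (p , 0≤ ∷ dom) → w i (fromℕ n) , low≤ i p ,
                bound _ (ℤₚ.0≤i-j⇒j≤i (≡.subst (+ 0 ℤ.≤_) (lem s (l (fromℕ n)) (w i (fromℕ n))) 0≤)) ,
                (p , ≡.refl) , dom })
      (interval-∪ {A = I} Finite mono (List.[] , λ _ ()) ∪
        (λ v i → (P i × w i (fromℕ n) ≡ v) × Dominates (s ℤ.+ (l (fromℕ n) ℤ.- v)) (w i ∘ inject₁) (l ∘ inject₁))
        (λ v → dominated-finite (λ i → P i × w i (fromℕ n) ≡ v) (λ i → w i ∘ inject₁) (slices v)
          (λ { (p , wi≡v) (q , wj≡v) e → injective p q (agree e (≡.trans wi≡v (≡.sym wj≡v))) })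
          (s ℤ.+ (l (fromℕ n) ℤ.- v)) (l ∘ inject₁))
        low N)
    where
    lem : ∀ s l v → s ℤ.+ (l ℤ.- v) ≡ s ℤ.+ l ℤ.- v
    lem = solve-∀
    mono : ∀ {P Q : I → Set ℓ} → (∀ a → Q a → P a) → Finite P → Finite Q
    mono Q⊆P (ks , complete) = ks , λ i q → complete i (Q⊆P i q)
    ∪ : ∀ {P Q : I → Set ℓ} → Finite P → Finite Q → Finite (λ a → P a ⊎ Q a)
    ∪ (ks , c) (ls , d) = ks List.++ ls ,
      λ { i (inj₁ p) → ∈-++⁺ˡ (c i p) ; i (inj₂ q) → ∈-++⁺ʳ ks (d i q) }
    agree : ∀ {i j} → w i ∘ inject₁ ≗ w j ∘ inject₁ → w i (fromℕ n) ≡ w j (fromℕ n) → w i ≗ w j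
    agree e e′ k with view k
    ... | ‵fromℕ      = e′
    ... | ‵inject₁ k′ = e k′

  -- Q is contained in the support of an iterated Laurent series
  Realizable : ∀ n → (Vec ℤ n → Set ℓ) → Set ℓ
  Realizable zero    Q = ⊤
  Realizable (suc n) Q = (∃ λ low → ∀ k j → Q (k Vec.∷ʳ j) → low ℤ.≤ j) ×
    (∀ j → Realizable n (λ k → Q (k Vec.∷ʳ j)))

  realizable-mono : ∀ {n} {P Q : Vec ℤ n → Set ℓ} → (∀ k → Q k → P k) → Realizable n P → Realizable n Q
  realizable-mono {zero}  Q⊆P _ = tt
  realizable-mono {suc n} Q⊆P ((low , low≤) , slices) =
    (low , λ k j q → low≤ k j (Q⊆P _ q)) , λ j → realizable-mono (λ k → Q⊆P (k Vec.∷ʳ j)) (slices j)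

  realizable-∅ : ∀ {n} → Realizable n (λ _ → ⊥)
  realizable-∅ {zero}  = tt
  realizable-∅ {suc n} = (+ 0 , λ _ _ ()) , λ j → realizable-∅

  realizable-∪ : ∀ {n} {P Q : Vec ℤ n → Set ℓ} → Realizable n P → Realizable n Q →
                 Realizable n (λ k → P k ⊎ Q k)
  realizable-∪ {zero}  _ _ = tt
  realizable-∪ {suc n} ((a , a≤) , p) ((b , b≤) , q) =
    (a ℤ.⊓ b , λ { k j (inj₁ x) → ℤₚ.≤-trans (ℤₚ.i⊓j≤i a b) (a≤ k j x)
                 ; k j (inj₂ y) → ℤₚ.≤-trans (ℤₚ.i⊓j≤j a b) (b≤ k j y) }) ,
    λ j → realizable-∪ (p j) (q j)

  -- The last exponent j of a dominating `l` is at least low - s. For fixed j the last coordinate of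
  -- `w i` lies between `low` and s + j, so the slice is a finite union of sets realizable by
  -- induction.
  dominating-realizable : ∀ {n} {I : Set} (P : I → Set ℓ) w → BoundedBelow n P w → ∀ s →
                          Realizable n (λ l → ∃ λ i → P i × Dominates s (w i) (Vec.lookup l))
  dominating-realizable {zero}  P w _ s = tt
  dominating-realizable {suc n} P w ((low , low≤) , slices) s =
    (low ℤ.- s , λ { k j (i , p , dom) → bound k j i p (unsnoc k j dom) }) ,
    λ j → let N , v< = interval low (s ℤ.+ j) in realizable-mono
      (λ { k (i , p , dom) → slice j N v< k i p (unsnoc k j dom) })
      (interval-∪ (Realizable n) realizable-mono realizable-∅ realizable-∪
        (λ v k → ∃ λ i → (P i × w i (fromℕ n) ≡ v) × Dominates (s ℤ.+ (j ℤ.- v)) (w i ∘ inject₁) (Vec.lookup k))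
        (λ v → dominating-realizable (λ i → P i × w i (fromℕ n) ≡ v) (λ i → w i ∘ inject₁) (slices v)
                 (s ℤ.+ (j ℤ.- v)))
        low N)
    where
    unsnoc : ∀ {d} (k : Vec ℤ n) j → Dominates s d (Vec.lookup (k Vec.∷ʳ j)) →
             + 0 ℤ.≤ s ℤ.+ (j ℤ.- d (fromℕ n)) ×
             Dominates (s ℤ.+ (j ℤ.- d (fromℕ n))) (d ∘ inject₁) (Vec.lookup k)
    unsnoc {d} k j (0≤ ∷ dom) = ≡.subst (+ 0 ℤ.≤_) eq 0≤ , dominates-cong eq
      (λ i → ≡.trans (lookup-inject₁ (k Vec.∷ʳ j) i) (≡.cong (λ k → Vec.lookup k i) (Vecₚ.init-∷ʳ j k))) dom
      where
      eq = ≡.cong (λ j → s ℤ.+ (j ℤ.- d (fromℕ n))) (≡.trans (lookup-fromℕ (k Vec.∷ʳ j)) (Vecₚ.last-∷ʳ j k))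
    lem : ∀ s j v → s ℤ.+ (j ℤ.- v) ≡ s ℤ.+ j ℤ.- v
    lem = solve-∀
    lem₂ : ∀ s j v → s ℤ.+ (j ℤ.- v) ≡ j ℤ.- (v ℤ.- s)
    lem₂ = solve-∀
    bound : ∀ (k : Vec ℤ n) j i → P i → (+ 0 ℤ.≤ s ℤ.+ (j ℤ.- w i (fromℕ n)) × _) → low ℤ.- s ℤ.≤ j
    bound k j i p (0≤ , _) = ℤₚ.≤-trans (ℤₚ.+-monoˡ-≤ (ℤ.- s) (low≤ i p))
      (ℤₚ.0≤i-j⇒j≤i (≡.subst (+ 0 ℤ.≤_) (lem₂ s j (w i (fromℕ n))) 0≤))
    slice : ∀ j N → (∀ v → v ℤ.≤ s ℤ.+ j → v ℤ.< low ℤ.+ + N) → ∀ (k : Vec ℤ n) i → P i →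
            (+ 0 ℤ.≤ s ℤ.+ (j ℤ.- w i (fromℕ n)) ×
             Dominates (s ℤ.+ (j ℤ.- w i (fromℕ n))) (w i ∘ inject₁) (Vec.lookup k)) →
            ∃ λ v → low ℤ.≤ v × v ℤ.< low ℤ.+ + N ×
              (∃ λ i → (P i × w i (fromℕ n) ≡ v) × Dominates (s ℤ.+ (j ℤ.- v)) (w i ∘ inject₁) (Vec.lookup k))
    slice j N v< k i p (0≤ , dom) = w i (fromℕ n) , low≤ i p ,
      v< _ (ℤₚ.0≤i-j⇒j≤i (≡.subst (+ 0 ℤ.≤_) (lem s j (w i (fromℕ n))) 0≤)) , i , (p , ≡.refl) , dom

  module _ (K : HeytingField ℓ ℓ ℓ) where

    open SeriesOver K
    open IteratedDerivations K using (coefficient-≈0)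
    open HeytingField K using (Carrier; _≈_; 0#; trans)
    private module F = CommutativeRing fieldRing

    realize : ∀ n (c : Vec ℤ n → Carrier) → Realizable n (Support c) →
              ∃ λ (f : K⟪z⟫ n) → ∀ k → coefficient n f k ≈ c k
    realize zero    c _ = c Vec.[] , λ { Vec.[] → F.refl }
    realize (suc n) c ((low , low≤) , slices) = f , λ k → trans
      (proj₂ (rows (Vec.last k)) (Vec.init k))
      (F.reflexive (≡.cong c (≡.sym (proj₂ (proj₂ (Vec.initLast k))))))
      where
      rows : ∀ j → ∃ λ (f : K⟪z⟫ n) → ∀ k → coefficient n f k ≈ c (k Vec.∷ʳ j)
      rows j = realize n (λ k → c (k Vec.∷ʳ j)) (slices j)
      zero-row : ∀ j → j ℤ.< low → ∀ k → c (k Vec.∷ʳ j) ≈ 0#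
      -- `low` bounds only exponents with nonzero coefficient; excluded middle turns this into
      -- vanishing below it.
      zero-row j j<low k with em {c (k Vec.∷ʳ j) ≈ 0#}
      ... | yes ≈0 = ≈0
      ... | no  ≉0 = ⊥-elim (ℤₚ.<⇒≱ j<low (low≤ k j ≉0))
      f : K⟪z⟫ (suc n)
      f = record
        { coeff    = λ j → proj₁ (rows j)
        ; low      = low
        ; vanishes = λ {j} j<low → coefficient-≈0 n _
            (λ k → trans (proj₂ (rows j) k) (zero-row j j<low k))
        }

-- Substitution and its constant term.

lookup-injective : ∀ {A : Set} {n} {k l : Vec A n} → Vec.lookup k ≗ Vec.lookup l → k ≡ l
lookup-injective {k = k} {l} e = ≡.trans (≡.sym (Vecₚ.tabulate∘lookup k))
  (≡.trans (Vecₚ.tabulate-cong e) (Vecₚ.tabulate∘lookup l))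

module _ {ℓ} (em : ExcludedMiddle ℓ) (K : HeytingField ℓ ℓ ℓ) where

  open SeriesOver K hiding (u; u-unit; u^)
  open IteratedDerivations K
  open InitialTerms K
  open Summability em
  private
    module F = CommutativeRing fieldRing
    module I (n : ℕ) = CommutativeRing (iterated n)
    module ι (n : ℕ) = IntegerMultiples (iterated n)
  open F using (_≈_; 0#; _+_; _*_)

  stable : {P : Set ℓ} → ¬ ¬ P → P
  stable = decidable-stable em

  -- Tightness and excluded middle turn `x≉0` into apartness from 0. The inverse so obtained is that
  -- of x - 0, whence the correction.
  ≉0-unit : ∀ {x} → ¬ x ≈ 0# → Iterated.IsUnit 0 x
  ≉0-unit {x} x≉0 with em {HeytingField._#_ K x 0#}
  ... | no  ¬x#0 = ⊥-elim (x≉0 (proj₁ (HeytingField.tight K x 0#) ¬x#0))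
  ... | yes x#0  = let y , _ , xy≈1 = HeytingField.#⇒invertible K x#0 in
    RingNotation.isUnit y (F.trans
      (F.*-congʳ (F.sym (F.trans (F.+-congˡ (Algebra.Properties.Ring.-0#≈0# F.ring)) (F.+-identityʳ x)))) xy≈1)

  foldr-0 : ∀ {A : Set} (f : A → F.Carrier) (ks : List A) → (∀ k → k ∈ ks → f k ≈ 0#) →
            List.foldr _+_ 0# (List.map f ks) ≈ 0#
  foldr-0 f List.[]       z = F.refl
  foldr-0 f (k List.∷ ks) z = F.trans
    (F.+-cong (z k (here ≡.refl)) (foldr-0 f ks (λ l l∈ks → z l (there l∈ks)))) (F.+-identityʳ 0#)

  foldr-single : ∀ {A : Set} → DecidableEquality A → (f : A → F.Carrier) (a : A) {ks : List A} → Unique ks →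
                 (∀ k → k ≢ a → f k ≈ 0#) → (a ∉ ks → f a ≈ 0#) →
                 List.foldr _+_ 0# (List.map f ks) ≈ f a
  foldr-single _≟_ f a {List.[]}     []        z z′ = F.sym (z′ (λ ()))
  foldr-single _≟_ f a {k List.∷ ks} (k∉ks ∷ u) z z′ with k ≟ a
  ... | yes ≡.refl = F.trans
    (F.+-congˡ (foldr-0 f ks (λ l l∈ks → z l (λ l≡k → All.lookup k∉ks l∈ks (≡.sym l≡k))))) (F.+-identityʳ _)
  ... | no  k≢a    = F.trans (F.+-cong (z k k≢a) (foldr-single _≟_ f a u z
    (λ a∉ks → z′ (λ { (here a≡k) → k≢a (≡.sym a≡k) ; (there a∈ks) → a∉ks a∈ks })))) (F.+-identityˡ _)

  CT-sum : ∀ n {N} (f : Fin N → K⟪z⟫ n) → (∀ i → CT {n} (f i) ≈ 0#) →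
           CT {n} (Algebra.Definitions.RawMonoid.sum (I.+-rawMonoid n) f) ≈ 0#
  CT-sum n {zero}  f z = coefficient-0 n _
  CT-sum n {suc N} f z = F.trans (coefficient-+ n (f zero) _ _)
    (F.trans (F.+-cong (z zero) (CT-sum n (f ∘ suc) (z ∘ suc))) (F.+-identityʳ 0#))

  product-1 : ∀ n {N} (f : Fin N → K⟪z⟫ n) → (∀ i → I._≈_ n (f i) (I.1# n)) →
              I._≈_ n (Iterated.product n f) (I.1# n)
  product-1 n {zero}  f e = I.refl n
  product-1 n {suc N} f e = I.trans n (I.*-cong n (e zero) (product-1 n (f ∘ suc) (e ∘ suc))) (I.*-identityʳ n _)

  module _ (char0 : CharacteristicZero) where

    ι-unit₀ : ∀ k → k ≢ + 0 → Iterated.IsUnit 0 (ι.ι 0 k)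
    ι-unit₀ (+ zero)  k≢0 = ⊥-elim (k≢0 ≡.refl)
    ι-unit₀ (+ suc n) k≢0 = ≉0-unit (char0 n)
    ι-unit₀ -[1+ n ]  k≢0 = ≉0-unit (λ ≈0 → char0 n (F.trans (F.sym (Algebra.Properties.Ring.-‿involutive F.ring _))
      (F.trans (F.-‿cong ≈0) (Algebra.Properties.Ring.-0#≈0# F.ring))))

    1≉0 : ¬ F.1# ≈ 0#
    1≉0 1≈0 = char0 0 (F.trans (F.+-identityʳ F.1#) 1≈0)

    module _ (n : ℕ) (u : Fin n → K⟪z⟫ n) (u-unit : ∀ i → Iterated.IsUnit n (u i))
      (u-exact : Exactness.IsExact (iterated n) (eulerDerivations n) u u-unit)
      (u-initial : ∀ i → ∃ λ d → HasInitial n d (u i))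
      where

      private
        𝟎 : Vec ℤ n
        𝟎 = Vec.replicate n (+ 0)

      u^ : Vec ℤ n → K⟪z⟫ n
      u^ k = Iterated.product n (λ i → Iterated.power n (u i) (u-unit i) (Vec.lookup k i))

      -- By exactness k_l times the constant term is 0 for every l. A nonzero constant term would
      -- force every k_l to be 0, since nonzero integers are invertible.
      CT-u^ : ∀ k → k ≢ 𝟎 → CT {n} (u^ k) ≈ 0#
      CT-u^ k k≢0 = stable (λ ≉0 → k≢0 (lookup-injective (λ l →
        ≡.trans (entry≡0 ≉0 l) (≡.sym (Vecₚ.lookup-replicate l (+ 0))))))
        where
        ιk*CT≈0 : ∀ l → ι.ι 0 (Vec.lookup k l) * CT {n} (u^ k) ≈ 0#
        ιk*CT≈0 l = F.trans (F.sym (coefficient-ι n (Vec.lookup k l) (u^ k) 𝟎))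
          (F.trans (coefficient-cong n (I.sym n (proj₂ (u-exact (Vec.lookup k) l))) 𝟎)
            (CT-sum n _ (λ j → CT-θ n j _)))
        entry≡0 : ¬ CT {n} (u^ k) ≈ 0# → ∀ l → Vec.lookup k l ≡ + 0
        entry≡0 ≉0 l with Vec.lookup k l ℤₚ.≟ + 0
        ... | yes k≡0 = k≡0
        ... | no  k≢0 = ⊥-elim (≉0 (Derivations.unit-cancel fieldRing (ι-unit₀ (Vec.lookup k l) k≢0)
          (F.trans (F.*-comm _ _) (F.trans (ιk*CT≈0 l) (F.sym (F.zeroˡ _))))))

      CT-u^0 : CT {n} (u^ 𝟎) ≈ F.1#
      CT-u^0 = F.trans
        (coefficient-cong n (product-1 n _ (λ i → I.reflexive n
          (≡.cong (Iterated.power n (u i) (u-unit i)) (Vecₚ.lookup-replicate i (+ 0))))) 𝟎)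
        (F.trans (F.reflexive (≡.trans (coefficient≡at n (I.1# n) 𝟎)
          (at-exponent n (I.1# n) (λ i → Vecₚ.lookup-replicate i (+ 0))))) (at-1 n))

      module _ (b : Fin n → Vec ℤ n) (b-initial : ∀ i → IsInitialExponent {n} (u i) (b i)) where

        ρ : Vec ℤ n → Fin n → ℤ
        ρ k = Vec.lookup (linear b k)

        -- Minimality of `b i` gives b i ≤ d, as the coefficient at d is not 0. Since `b i` lies in
        -- the support, it dominates d, which excludes b i < d.
        initial-u-b : ∀ i → HasInitial n (Vec.lookup (b i)) (u i)
        initial-u-b i = initial-exponent d≗b hasInitial
          where
          d : Fin n → ℤ
          d = proj₁ (u-initial i)
          hasInitial : HasInitial n d (u i)
          hasInitial = proj₂ (u-initial i)
          coefficient≉0 : Support (coefficient n (u i)) (Vec.tabulate d)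
          coefficient≉0 ≈0 = at-initial≉0 1≉0 hasInitial (F.trans
            (F.reflexive (≡.sym (≡.trans (coefficient≡at n (u i) (Vec.tabulate d))
              (at-exponent n (u i) (Vecₚ.lookup∘tabulate d))))) ≈0)
          dominates : Dominates (+ 0) d (Vec.lookup (b i))
          dominates = bounded⇒dominates (HasInitial.bounded hasInitial) (Vec.lookup (b i))
            (λ ≈0 → proj₁ (b-initial i) (F.trans (F.reflexive (coefficient≡at n (u i) (b i))) ≈0))
          d≗b : d ≗ Vec.lookup (b i)
          d≗b j with proj₂ (b-initial i) (Vec.tabulate d) coefficient≉0
          ... | inj₂ b≡d = ≡.trans (≡.sym (Vecₚ.lookup∘tabulate d j)) (≡.cong (λ k → Vec.lookup k j) (≡.sym b≡d))
          ... | inj₁ (t , b<d , above) = ⊥-elim (dominates⇒≮ ≡.refl dominates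
            (t , ≡.subst (Vec.lookup (b i) t ℤ.<_) (Vecₚ.lookup∘tabulate d t) b<d ,
             λ s t<s → ≡.trans (above s t<s) (Vecₚ.lookup∘tabulate d s)))

        initial-u^ : ∀ k → HasInitial n (ρ k) (u^ k)
        initial-u^ k = initial-exponent (λ j → ≡.sym (Vecₚ.lookup∘tabulate _ j))
          (initial-product (λ i j → Vec.lookup k i ℤ.* Vec.lookup (b i) j) _
            (λ i → initial-power (initial-u-b i) (u-unit i) (Vec.lookup k i)))

        ρ-kernel : ∀ k → (∀ j → ρ k j ≡ + 0) → k ≡ 𝟎
        ρ-kernel k ρk≡0 with Vecₚ.≡-dec ℤₚ._≟_ k 𝟎
        ... | yes k≡0 = k≡0
        ... | no  k≢0 = ⊥-elim (at-initial≉0 1≉0 (initial-u^ k) (F.trans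
          (F.reflexive (≡.sym (≡.trans (coefficient≡at n (u^ k) 𝟎) (at-exponent n (u^ k)
            (λ j → ≡.trans (Vecₚ.lookup-replicate j (+ 0)) (≡.sym (ρk≡0 j)))))))
          (CT-u^ k k≢0)))

        -- By linearity the difference of `k` and `l` lies in the kernel.
        ρ-injective : ∀ {k l} → ρ k ≗ ρ l → k ≡ l
        ρ-injective {k} {l} ρk≗ρl = lookup-injective (λ i → ℤₚ.i-j≡0⇒i≡j _ _
          (≡.trans (≡.sym (Vecₚ.lookup∘tabulate _ i))
            (≡.trans (≡.cong (λ d → Vec.lookup d i) (ρ-kernel d ρd≡0)) (Vecₚ.lookup-replicate i (+ 0)))))
          where
          open Algebra.Properties.CommutativeMonoid.Sum ℤₚ.+-0-commutativeMonoid
            using (sum; ∑-distrib-+; sum-cong-≗)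
          d : Vec ℤ n
          d = Vec.tabulate (λ i → Vec.lookup k i ℤ.- Vec.lookup l i)
          term : Vec ℤ n → Fin n → Fin n → ℤ
          term k j i = Vec.lookup k i ℤ.* Vec.lookup (b i) j
          lem : ∀ x y c → (x ℤ.- y) ℤ.* c ℤ.+ y ℤ.* c ≡ x ℤ.* c
          lem = solve-∀
          lem₂ : ∀ x y → x ≡ (x ℤ.+ y) ℤ.- y
          lem₂ = solve-∀
          ρ-sum : ∀ k j → ρ k j ≡ sum (term k j)
          ρ-sum k j = Vecₚ.lookup∘tabulate _ j
          d+l : ∀ j → sum (term d j) ℤ.+ sum (term l j) ≡ sum (term k j)
          d+l j = ≡.trans (≡.sym (∑-distrib-+ (term d j) (term l j))) (sum-cong-≗ (λ i →
            ≡.trans (≡.cong (λ x → x ℤ.* Vec.lookup (b i) j ℤ.+ term l j i) (Vecₚ.lookup∘tabulate _ i))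
              (lem (Vec.lookup k i) (Vec.lookup l i) (Vec.lookup (b i) j))))
          ρd≡0 : ∀ j → ρ d j ≡ + 0
          ρd≡0 j = ≡.trans (ρ-sum d j) (≡.trans (lem₂ (sum (term d j)) (sum (term l j)))
            (ℤₚ.i≡j⇒i-j≡0 (≡.trans (d+l j) (≡.trans (≡.sym (ρ-sum k j)) (≡.trans (ρk≗ρl j) (ρ-sum l j))))))

        module _ (Φ : Series (linear b)) where

          open Series Φ using (coeff; wellOrdered)

          term : Vec ℤ n → Vec ℤ n → F.Carrier
          term l k = coeff k * coefficient n (u^ k) l

          -- A bound for the support of `term l` in terms of exponents alone, to which the
          -- finiteness and realizability lemmas apply.
          Contributes : Vec ℤ n → Vec ℤ n → Set ℓ
          Contributes l k = Support coeff k × Dominates (+ 0) (ρ k) (Vec.lookup l)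

          contributes : ∀ l k → ¬ term l k ≈ 0# → Contributes l k
          contributes l k ≉0 = (λ c≈0 → ≉0 (F.trans (F.*-congʳ c≈0) (F.zeroˡ _))) ,
            bounded⇒dominates (HasInitial.bounded (initial-u^ k)) (Vec.lookup l)
              (λ ≈0 → ≉0 (F.trans (F.*-congˡ (F.trans (F.reflexive (coefficient≡at n (u^ k) l)) ≈0))
                (F.zeroʳ _)))

          boundedBelow : BoundedBelow n (Support coeff) ρ
          boundedBelow = wellOrdered⇒boundedBelow (Support coeff) ρ wellOrdered

          contributors : ∀ l → Finite (Contributes l)
          contributors l = dominated-finite (Support coeff) ρ boundedBelow
            (λ _ _ → ρ-injective) (+ 0) (Vec.lookup l)

          -- Duplicates are removed because `IsSum` demands a list without repetitions.
          indices : Vec ℤ n → List (Vec ℤ n)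
          indices l = List.deduplicate (Vecₚ.≡-dec ℤₚ._≟_) (proj₁ (contributors l))

          indices-unique : ∀ l → Unique (indices l)
          indices-unique l = UniqueDec.deduplicate-! (Vecₚ.≡-dec ℤₚ._≟_) (proj₁ (contributors l))

          indices-complete : ∀ l k → k ∉ indices l → term l k ≈ 0#
          indices-complete l k k∉ = stable (λ ≉0 → k∉ (∈-deduplicate⁺ (Vecₚ.≡-dec ℤₚ._≟_)
            (proj₂ (contributors l) k (contributes l k ≉0))))

          value : Vec ℤ n → F.Carrier
          value l = List.foldr _+_ 0# (List.map (term l) (indices l))

          value-support : ∀ l → Support value l → ∃ λ k → Contributes l k
          value-support l ≉0 = stable (λ ∄ → ≉0 (foldr-0 (term l) (indices l)
            (λ k _ → stable (λ ≉0 → ∄ (k , contributes l k ≉0)))))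

          substitution : ∃ λ (Ψ : K⟪z⟫ n) → ∀ l → coefficient n Ψ l ≈ value l
          substitution = realize K n value (realizable-mono value-support
            (dominating-realizable (Support coeff) ρ boundedBelow (+ 0)))

          CT-substitution : CT {n} (proj₁ substitution) ≈ constantTerm Φ
          CT-substitution = F.trans (proj₂ substitution 𝟎) (F.trans
            -- Every term with k ≠ 0 vanishes. If `𝟎` is missing from the list, its own term is 0 as
            -- well, so the sum equals the term at `𝟎` in either case.
            (foldr-single (Vecₚ.≡-dec ℤₚ._≟_) (term 𝟎) 𝟎 (indices-unique 𝟎)
              (λ k k≢0 → F.trans (F.*-congˡ (CT-u^ k k≢0)) (F.zeroʳ _)) (indices-complete 𝟎 𝟎))
            (F.trans (F.*-congˡ CT-u^0) (F.*-identityʳ _)))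

          change-of-variables : ∃ λ (Ψ : K⟪z⟫ n) →
            (∀ l → IsSum (λ k → coeff k * coefficient n (u^ k) l) (coefficient n Ψ l)) ×
            CT {n} Ψ ≈ constantTerm Φ
          change-of-variables = proj₁ substitution ,
            (λ l → indices l , indices-unique l , indices-complete l , F.sym (proj₂ substitution l)) ,
            CT-substitution

open import Data.Integer.Base using (-_)
open import Data.Nat.Base using (_<_)
open import Data.Nat.Combinatorics using (_C_)

mainTheorem8 : ∀ {ℓ} → ExcludedMiddle ℓ →
    (K : HeytingField ℓ ℓ ℓ) →
    let open HeytingField K using (_≈_)
        open SeriesOver K in
    CharacteristicZero →
    (m : ℕ) → let n = suc m in
    (r : ℤ) → (∀ i → i < m → r ≢ + i) → r ≢ - (+ (m C 2)) →
    (b : Fin n → Vec ℤ n) → (∀ i → IsInitialExponent {n} (u r i) (b i)) →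
    (Φ : Series (linear b)) →
    ∃ λ (Ψ : K⟪z⟫ n) → IsSubstitution r Φ Ψ × CT {n} Ψ ≈ constantTerm Φ
mainTheorem8 em K char0 m r r≢i r≢-mC2 b b-initial Φ =
  change-of-variables em K char0 (suc m) (SeriesOver.u K r) (SeriesOver.u-unit K r)
    (InitialTerms.u-exact K (ι-unit₀ em K char0) m r r≢i r≢-mC2) (InitialTerms.initial-u K r) b b-initial Φ
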